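{- The model checking problem $\mathrm{MC}(\mathrm{TeamLTL})$ restricted to splitjunction-free formulae (given a TeamLTL-formula $\varphi$ without any occurrence of $\lor$ and a Kripke structure $\mathcal{K}$, decide whether $T(\mathcal{K})\models\varphi$) is in $\mathrm{PSPACE}$.
   Context: Let $\mathrm{AP}$ be a countably infinite set of atomic propositions. A trace is an infinite sequence $t=t(0)t(1)t(2)\cdots\in(2^{\mathrm{AP}})^\omega$; $t[i,\infty)=t(i)t(i+1)\cdots$. A team is a (possibly infinite) set $T\subseteq(2^{\mathrm{AP}})^\omega$ of traces, and $T[i,\infty)=\{t[i,\infty)\mid t\in T\}$. TeamLTL-formulae (same syntax as LTL, in negation normal form) are given by $$\varphi ::= p\mid\neg p\mid\varphi\land\varphi\mid\varphi\lor\varphi\mid\mathsf{X}\varphi\mid\varphi\mathsf{U}\varphi\mid\varphi\mathsf{R}\varphi,\qquad p\in\mathrm{AP}.$$ The connective $\lor$ is called splitjunction. Team semantics: - $T\models p$ iff $p\in t(0)$ for all $t\in T$; $T\models\neg p$ iff $p\notin t(0)$ for all $t\in T$. - $T\models\psi\land\phi$ iff $T\models\psi$ and $T\models\phi$. - $T\models\psi\lor\phi$ iff there are $T_1,T_2$ with $T_1\cup T_2=T$, $T_1\models\psi$ and $T_2\models\phi$. - $T\models\mathsf{X}\varphi$ iff $T[1,\infty)\models\varphi$. - $T\models\psi\mathsf{U}\phi$ iff there is $k\ge0$ with $T[k,\infty)\models\phi$ and $T[k',\infty)\models\psi$ for all $k'<k$. - $T\models\psi\mathsf{R}\phi$ iff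 for all $k\ge0$: $T[k,\infty)\models\phi$ or there is $k'<k$ with $T[k',\infty)\models\psi$. A Kripke structure $\mathcal{K}=(W,R,\eta,w_I)$ consists of a finite set $W$ of worlds, a left-total relation $R\subseteq W\times W$, a labeling $\eta\colon W\to2^{\mathrm{AP}}$ with each $\eta(w)$ finite, and an initial world $w_I\in W$. A path through $\mathcal{K}$ is $\pi=\pi(0)\pi(1)\cdots\in W^\omega$ with $\pi(0)=w_I$ and $(\pi(i),\pi(i+1))\in R$ for all $i\ge0$; its trace is $t(\pi)=\eta(\pi(0))\eta(\pi(1))\cdots$. $T(\mathcal{K})=\{t(\pi)\mid\pi\text{ is a path through }\mathcal{K}\}$. -}

module Defs where

open import Level using (Level; 0ℓ; Lift; _⊔_) renaming (suc to lsuc)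
open import Data.Bool.Base using (Bool; true; false)
open import Data.Fin.Base using (Fin; toℕ)
open import Data.List.Base
  using (List; []; _∷_; _++_; map; concatMap; allFin; replicate; length)
open import Data.Maybe.Base as Maybe using (Maybe; just; nothing)
open import Data.Nat.Base using (ℕ; zero; suc; _+_; _*_; _≤_; _<_)
open import Data.Nat.Binary.Base using (ℕᵇ; zero; 2[1+_]; 1+[2_]; fromℕ)
open import Data.Nat.Properties using (_≟_)
open import Data.Product.Base using (Σ; ∃; ∃₂; _×_; _,_)
open import Data.Sum.Base using (_⊎_)
open import Data.Unit.Base using (⊤)
open import Data.Empty using (⊥)
open import Data.Vec.Base as Vec using (Vec)
open import Data.List.Membership.DecPropositional _≟_ using (_∈?_)
open import Function.Base using (_∘_)
open import Function.Bundles using (_↔_; _↣_; _⇔_; Injection)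
open import Relation.Binary.Construct.Closure.ReflexiveTransitive using (Star)
open import Relation.Binary.PropositionalEquality using (_≡_; _≢_)
open import Relation.Nullary.Decidable.Core using (does)
open import Relation.Unary using (Pred; _∪_; _≐_)

------------------------------------------------------------------------
-- TeamLTL

AP : Set
AP = ℕ

-- Letters of 2^AP are characteristic functions.
Trace : Set
Trace = ℕ → (AP → Bool)

-- Traces are functions, so the operations below that build a team close it
-- under pointwise equality of traces.
_≋_ : Trace → Trace → Set
t ≋ u = ∀ i p → t i p ≡ u i p

Team : Set₁
Team = Pred Trace 0ℓ

suffix : ℕ → Trace → Trace
suffix i t j = t (i + j)

_[_,∞⟩ : Team → ℕ → Team
(T [ i ,∞⟩) u = ∃ λ t → T t × u ≋ suffix i t

infixr 7 _∧ᶠ_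
infixr 6 _∨ᶠ_
infixr 5 _U_ _R_

data Formula : Set where
  pos neg         : AP → Formula
  _∧ᶠ_ _∨ᶠ_       : Formula → Formula → Formula
  X               : Formula → Formula
  _U_ _R_         : Formula → Formula → Formula

infix 4 _⊨_

-- The splitjunction quantifies over teams, which puts satisfaction in Set₁.
_⊨_ : Team → Formula → Set₁
T ⊨ pos p    = Lift (lsuc 0ℓ) (∀ t → T t → t 0 p ≡ true)
T ⊨ neg p    = Lift (lsuc 0ℓ) (∀ t → T t → t 0 p ≡ false)
T ⊨ ψ ∧ᶠ φ   = T ⊨ ψ × T ⊨ φ
T ⊨ ψ ∨ᶠ φ   = ∃₂ λ T₁ T₂ → (T₁ ∪ T₂) ≐ T × T₁ ⊨ ψ × T₂ ⊨ φ
T ⊨ X φ      = T [ 1 ,∞⟩ ⊨ φ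
T ⊨ ψ U φ    = ∃ λ k → T [ k ,∞⟩ ⊨ φ × (∀ j → j < k → T [ j ,∞⟩ ⊨ ψ)
T ⊨ ψ R φ    = ∀ k → T [ k ,∞⟩ ⊨ φ ⊎ (∃ λ j → j < k × T [ j ,∞⟩ ⊨ ψ)

SplitFree : Pred Formula 0ℓ
SplitFree (pos p)  = ⊤
SplitFree (neg p)  = ⊤
SplitFree (ψ ∧ᶠ φ) = SplitFree ψ × SplitFree φ
SplitFree (ψ ∨ᶠ φ) = ⊥
SplitFree (X φ)    = SplitFree φ
SplitFree (ψ U φ)  = SplitFree ψ × SplitFree φ
SplitFree (ψ R φ)  = SplitFree ψ × SplitFree φ

------------------------------------------------------------------------
-- Kripke structures

-- Worlds are numbered; labels are finite sets of propositions given as lists.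
record Kripke : Set where
  field
    size     : ℕ
    edge     : Fin size → Fin size → Bool
    total    : ∀ w → ∃ λ v → edge w v ≡ true
    label    : Fin size → List AP
    initial  : Fin size

  record Path : Set where
    field
      at     : ℕ → Fin size
      start  : at 0 ≡ initial
      follow : ∀ i → edge (at i) (at (suc i)) ≡ true

  trace : Path → Trace
  trace π i p = does (p ∈? label (Path.at π i))

  traces : Team
  traces u = ∃ λ π → u ≋ trace π

------------------------------------------------------------------------
-- Deterministic multi-tape Turing machines and PSPACE

Language : Set → (ℓ : Level) → Set (lsuc ℓ)
Language A ℓ = Pred (List A) ℓ

Finite : Set → Set
Finite A = ∃ λ n → A ↔ Fin n

data Move : Set where
  left stay right : Move

-- A two-way infinite tape, restricted to the cells that held the input or
-- have been visited; all other cells are blank. Both sides list the cells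
-- from the head outwards.
record Tape (Γ : Set) : Set where
  constructor tape
  field
    before : List Γ
    head   : Γ
    after  : List Γ

tapeSize : ∀ {Γ} → Tape Γ → ℕ
tapeSize (tape ls _ rs) = length ls + suc (length rs)

-- Tape 0 initially holds the input, with the head on its first symbol.
-- The machine halts where δ is undefined, and then accepts iff its state is
-- accepting.
record TM (A : Set) : Set₁ where
  field
    State       : Set
    Γ           : Set
    State-fin   : Finite State
    Γ-fin       : Finite Γ
    input       : A ↣ Γ
    blank       : Γ
    blank-fresh : ∀ a → Injection.to input a ≢ blank
    workTapes   : ℕ
    start       : State
    accepting   : State → Bool
    δ           : State → Vec Γ (suc workTapes) →
                  Maybe (State × Vec (Γ × Move) (suc workTapes))

module Computation {A : Set} (M : TM A) where
  open TM M

  record Config : Set where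
    constructor config
    field
      state : State
      tapes : Vec (Tape Γ) (suc workTapes)

  move : Move → Tape Γ → Tape Γ
  move left  (tape []       a rs)       = tape [] blank (a ∷ rs)
  move left  (tape (l ∷ ls) a rs)       = tape ls l (a ∷ rs)
  move stay  (tape ls       a rs)       = tape ls a rs
  move right (tape ls       a [])       = tape (a ∷ ls) blank []
  move right (tape ls       a (r ∷ rs)) = tape (a ∷ ls) r rs

  writeAndMove : Γ × Move → Tape Γ → Tape Γ
  writeAndMove (b , m) (tape ls _ rs) = move m (tape ls b rs)

  step : Config → Maybe Config
  step (config q ts) =
    Maybe.map (λ (q′ , acts) → config q′ (Vec.zipWith writeAndMove acts ts))
              (δ q (Vec.map Tape.head ts))

  _⟶*_ : Config → Config → Set
  _⟶*_ = Star (λ c d → step c ≡ just d)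

  load : List Γ → Tape Γ
  load []       = tape [] blank []
  load (a ∷ as) = tape [] a as

  initialConfig : List A → Config
  initialConfig x =
    config start (load (map (Injection.to input) x) Vec.∷
                  Vec.replicate workTapes (load []))

  space : Config → ℕ
  space c = Vec.sum (Vec.map tapeSize (Config.tapes c))

  -- As M is deterministic, the halting configuration is unique.
  Decides : ∀ {ℓ} → Language A ℓ → Set ℓ
  Decides L = ∀ x → ∃ λ c → initialConfig x ⟶* c × step c ≡ nothing ×
                             (accepting (Config.state c) ≡ true ⇔ L x)

  RunsInSpace : (ℕ → ℕ) → Set
  RunsInSpace f = ∀ x c → initialConfig x ⟶* c → space c ≤ f (length x)

-- Coefficients, constant term first.
Polynomial : Set
Polynomial = List ℕ

eval : Polynomial → ℕ → ℕ
eval []       n = 0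
eval (a ∷ as) n = a + n * eval as n

PSPACE : {A : Set} {ℓ : Level} → Language A ℓ → Set (lsuc 0ℓ ⊔ ℓ)
PSPACE {A} L = Σ (TM A) λ M → let open Computation M in
  Decides L × ∃ λ p → RunsInSpace (eval p)

------------------------------------------------------------------------
-- Encoding of instances

data Symbol : Set where
  bit                       : Bool → Symbol
  tick worldˢ labelˢ        : Symbol
  posˢ negˢ ∧ˢ ∨ˢ Xˢ Uˢ Rˢ  : Symbol

-- Propositions are written in bijective base 2, least significant digit
-- first, where `bit false` is the digit 1 and `bit true` the digit 2. Every
-- word of bits thus names exactly one proposition.
digits : ℕᵇ → List Symbol
digits zero     = []
digits 1+[2 n ] = bit false ∷ digits n
digits 2[1+ n ] = bit true  ∷ digits n

encodeAP : AP → List Symbol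
encodeAP = digits ∘ fromℕ

-- Polish notation.
encodeFormula : Formula → List Symbol
encodeFormula (pos p)  = posˢ ∷ encodeAP p
encodeFormula (neg p)  = negˢ ∷ encodeAP p
encodeFormula (ψ ∧ᶠ φ) = ∧ˢ ∷ encodeFormula ψ ++ encodeFormula φ
encodeFormula (ψ ∨ᶠ φ) = ∨ˢ ∷ encodeFormula ψ ++ encodeFormula φ
encodeFormula (X φ)    = Xˢ ∷ encodeFormula φ
encodeFormula (ψ U φ)  = Uˢ ∷ encodeFormula ψ ++ encodeFormula φ
encodeFormula (ψ R φ)  = Rˢ ∷ encodeFormula ψ ++ encodeFormula φ

-- The index of the initial world in unary, then for every world its row of
-- the adjacency matrix and its label.
encodeKripke : Kripke → List Symbol
encodeKripke K = replicate (toℕ initial) tick ++ concatMap encodeWorld (allFin size)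
  where
  open Kripke K

  encodeWorld : Fin size → List Symbol
  encodeWorld w = worldˢ ∷ map (λ v → bit (edge w v)) (allFin size)
                  ++ concatMap (λ p → labelˢ ∷ encodeAP p) (label w)

encode : Formula → Kripke → List Symbol
encode φ K = encodeKripke K ++ encodeFormula φ

-- Model checking for the formulae in F. Words that do not encode an instance
-- are not in the language.
MC : Pred Formula 0ℓ → Language Symbol (lsuc 0ℓ)
MC F x = ∃₂ λ φ K → F φ × x ≡ encode φ K × Kripke.traces K ⊨ φ

{-# OPTIONS --safe #-}
module Submission where

-- For a formula without splitjunctions, whether T(K)[k,∞) satisfies it depends
-- only on the set S_k of worlds that are reachable in exactly k steps, and
-- S_{k+1} is determined by S_k. So the formula is evaluated as an LTL formula
-- on the single word S_0 S_1 S_2 ..., in which at most 2^n sets occur, and the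
-- search for a witness of an until or a release can stop after 2^n steps.
--
-- The machine computes backwards in time. At time k it recomputes S_k from S_0
-- by counting, and sweeps from right to left over the formula in Polish
-- notation with a stack of truth values; every X, U and R keeps one truth value
-- from time k + 1. To get these values right at the start, the symbols of the
-- formula are activated one by one from right to left, each 2^n sweeps after
-- the previous one: when an until (a release) is activated with the value false
-- (true), all its subformulas are exact already, and 2^n sweeps later it is
-- exact, too. The counters for the time and for the sweeps have as many bits as
-- the input has symbols and worlds, so the space is linear.

open import Defs
open import Data.Bool.Base using (Bool; true; false; if_then_else_; not; _∧_; _∨_; _xor_)
open import Data.Bool.ListAction using (or)
open import Data.Bool.Properties using (T-≡; ∧-identityʳ; ∧-zeroʳ; ∨-identityʳ; ∨-zeroʳ; ∨-assoc)
open import Data.Fin.Base using (Fin; zero; suc; toℕ; fromℕ<)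
open import Data.Fin.Patterns
open import Data.Fin.Properties as Fin using (+↔⊎; *↔×; toℕ<n; toℕ-fromℕ<; fromℕ<-injective; pigeonhole)
open import Data.List.Base
  using (List; []; _∷_; _++_; map; length; replicate; _ʳ++_; zipWith; foldl; concatMap; allFin; tabulate)
open import Data.List.Properties
  using (length-map; length-replicate; length-zipWith; length-tabulate; length-ʳ++; ++-assoc; ++-identityʳ; ʳ++-ʳ++;
         map-id; map-∘; map-cong; map-replicate; map-tabulate)
open import Data.List.Membership.Propositional using (_∈_)
open import Data.List.Membership.Propositional.Properties using (∈-allFin)
open import Data.List.Relation.Unary.All as All using (All; []; _∷_)
import Data.List.Relation.Unary.All.Properties as All
open import Data.List.Relation.Unary.Any using (here; there)
open import Data.Maybe.Base as Maybe using (Maybe; just; nothing; maybe)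
open import Data.Maybe.Properties using (just-injective)
open import Data.Nat.Base
  using (ℕ; zero; suc; pred; _+_; _*_; _∸_; _^_; _⊓_; _≤_; _<_; z≤n; s≤s; z<s; s<s; _≡ᵇ_; _<ᵇ_; _≤ᵇ_)
open import Data.Nat.Binary.Base as ℕᵇ using (ℕᵇ; 2[1+_]; 1+[2_]; fromℕ) renaming (toℕ to toℕᵇ)
open import Data.Nat.Binary.Properties using (fromℕ-toℕ; fromℕ-injective)
open import Data.Nat.Properties
open import Data.Nat.Solver using (module +-*-Solver)
open import Data.List.Membership.DecPropositional _≟_ using (_∈?_)
open import Data.Product.Base using (∃; ∃₂; _×_; _,_; proj₁; proj₂; map₁)
open import Data.Product.Function.NonDependent.Propositional using (_×-↔_)
open import Data.Sum.Base as Sum using (_⊎_; inj₁; inj₂)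
open import Data.Sum.Function.Propositional using (_⊎-↔_)
open import Data.Unit.Base using (⊤; tt)
open import Data.Vec.Base as Vec using (Vec; []; _∷_; lookup; _[_]≔_)
open import Data.Vec.Properties using (lookup-map; []≔-lookup; []≔-idempotent; lookup∘update)
open import Data.Vec.Relation.Binary.Pointwise.Inductive using (Pointwise; []; _∷_)
open import Data.Vec.Relation.Unary.All using ([]; _∷_) renaming (All to Allᵥ)
open import Function.Base using (_∘_; id; const)
open import Function.Bundles using (_↔_; mk↔ₛ′; mk↣; _⇔_; mk⇔; Equivalence)
open import Function.Construct.Composition using (_↔-∘_)
open import Function.Construct.Symmetry using (↔-sym)
open import Level using (lift; lower)
open import Relation.Binary.Construct.Closure.ReflexiveTransitive using (ε; _◅_; _◅◅_)
open import Relation.Binary.PropositionalEquality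
open import Relation.Nullary using (contradiction; yes; no; does)
open import Relation.Nullary.Decidable using (dec-true; dec-false)
open import Relation.Unary using (_≐_)

-- Activating all symbols at once would not work. The expansion law of an until, `b ∨ (a ∧ g)`, has
-- several solutions, and a wrong `true` in `g`, caused by an operand that is not exact yet, may be
-- handed on for as long as `a` holds. Only a start at `false` over exact operands is sure to reach
-- the least solution; dually for a release. The clock starts at 2^l - 1, where l is the length of
-- the input. With m symbols in the formula it has to cover m passes of 2^n sweeps and one more
-- sweep at time 0. It does, because every world takes a header and at least one bit of its row,
-- hence l ≥ 2n + m. Left-totality is used semantically as well: it prolongs a finite path to a
-- world of S_k into an infinite one, so that every world of S_k occurs at position k of some trace.
-- The machine is written as a structured program with a big-step semantics whose index counts
-- extensions of the tapes. Only the initial scan of the input extends them, so one derivation gives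
-- termination, correctness and the space bound.

∨-true : ∀ {a b} → a ∨ b ≡ true → a ≡ true ⊎ b ≡ true
∨-true {true}  _ = inj₁ refl
∨-true {false} p = inj₂ p

∧-intro : ∀ {a b} → a ≡ true → b ≡ true → a ∧ b ≡ true
∧-intro refl refl = refl

∧-elim : ∀ {a b} → a ∧ b ≡ true → a ≡ true × b ≡ true
∧-elim {true} {true} _ = refl , refl

-- Finite types

private variable
  A B : Set

finite-⊤ : Finite ⊤
finite-⊤ = 1 , mk↔ₛ′ (λ _ → zero) (λ _ → tt) (λ { zero → refl }) (λ _ → refl)

finite-Fin : ∀ {n} → Finite (Fin n)
finite-Fin {n} = n , mk↔ₛ′ id id (λ _ → refl) (λ _ → refl)

finite-⊎ : Finite A → Finite B → Finite (A ⊎ B)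
finite-⊎ (m , f) (n , g) = m + n , ↔-sym +↔⊎ ↔-∘ (f ⊎-↔ g)

finite-× : Finite A → Finite B → Finite (A × B)
finite-× (m , f) (n , g) = m * n , ↔-sym *↔× ↔-∘ (f ×-↔ g)

finite-↔ : A ↔ B → Finite B → Finite A
finite-↔ f (n , g) = n , g ↔-∘ f

finite-Maybe : Finite A → Finite (Maybe A)
finite-Maybe fin = finite-↔
  (mk↔ₛ′ (maybe inj₂ (inj₁ tt)) (λ { (inj₁ _) → nothing ; (inj₂ a) → just a })
         (λ { (inj₁ _) → refl ; (inj₂ _) → refl })
         (λ { nothing → refl ; (just _) → refl }))
  (finite-⊎ finite-⊤ fin)

finite-Bool : Finite Bool
finite-Bool = finite-↔
  (mk↔ₛ′ (λ { true → inj₁ tt ; false → inj₂ tt }) (λ { (inj₁ _) → true ; (inj₂ _) → false })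
         (λ { (inj₁ _) → refl ; (inj₂ _) → refl })
         (λ { true → refl ; false → refl }))
  (finite-⊎ finite-⊤ finite-⊤)

-- Tapes with a left end marker

pattern □   = nothing
pattern ▷   = just nothing
pattern `_ a = just (just a)

Cell : Set → Set
Cell A = Maybe (Maybe A)

-- A tape with a marker ▷ left of its content: the head is on the marker, or
-- it is right of it. L ▸ S lists both sides from the head outwards, and S
-- starts with the scanned symbol.
infix 4.5 ◂_ _▸_

data Zip (A : Set) : Set where
  ◂_  : List A → Zip A
  _▸_ : List A → List A → Zip A

top : Zip A → Cell A
top (◂ _)       = ▷
top (_ ▸ [])    = □
top (_ ▸ a ∷ _) = ` a

Act : Set → Set
Act A = Maybe A × Move

-- The flag tells whether writing at the right end extends the content.
put : Bool → Maybe A → Zip A → Zip A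
put g     nothing  t           = t
put g     (just a) (◂ S)       = ◂ S
put false (just a) (L ▸ [])    = L ▸ []
put true  (just a) (L ▸ [])    = L ▸ a ∷ []
put g     (just a) (L ▸ _ ∷ S) = L ▸ a ∷ S

shift : Move → Zip A → Zip A
shift stay  t           = t
shift left  (◂ S)       = ◂ S
shift left  ([] ▸ S)    = ◂ S
shift left  (l ∷ L ▸ S) = L ▸ l ∷ S
shift right (◂ S)       = [] ▸ S
shift right (L ▸ [])    = L ▸ []
shift right (L ▸ r ∷ S) = r ∷ L ▸ S

perform : Bool → Act A → Zip A → Zip A
perform g (w , m) t = shift m (put g w t)

width : Zip A → ℕ
width (◂ S)   = length S
width (L ▸ S) = length L + length S

cost : Bool → ℕ
cost true  = 1
cost false = 0

width-shift : ∀ m (t : Zip A) → width (shift m t) ≡ width t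
width-shift stay  t           = refl
width-shift left  (◂ S)       = refl
width-shift left  ([] ▸ S)    = refl
width-shift left  (l ∷ L ▸ S) = +-suc (length L) (length S)
width-shift right (◂ S)       = refl
width-shift right (L ▸ [])    = refl
width-shift right (L ▸ r ∷ S) = sym (+-suc (length L) (length S))

width-put : ∀ g w (t : Zip A) → width (put g w t) ≤ cost g + width t
width-put g     nothing  t           = m≤n+m _ (cost g)
width-put g     (just a) (◂ S)       = m≤n+m _ (cost g)
width-put false (just a) (L ▸ [])    = ≤-refl
width-put true  (just a) (L ▸ [])    = ≤-reflexive (+-suc (length L) 0)
width-put false (just a) (L ▸ x ∷ S) = ≤-refl
width-put true  (just a) (L ▸ x ∷ S) = n≤1+n _

width-perform : ∀ g a (t : Zip A) → width (perform g a t) ≤ cost g + width t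
width-perform g (w , m) t = ≤-trans (≤-reflexive (width-shift m _)) (width-put g w t)

-- Structured programs on tapes

module Machine (A Reg : Set) (k : ℕ) where

  Heads : Set
  Heads = Vec (Cell A) (suc k)

  Conf : Set
  Conf = Reg × Vec (Zip A) (suc k)

  infixr 4 _⨾_

  data Prog : Set where
    act   : Bool → (Reg → Heads → Reg × Vec (Act A) (suc k)) → Prog
    _⨾_   : Prog → Prog → Prog
    ite   : (Reg → Heads → Bool) → Prog → Prog → Prog
    while : (Reg → Heads → Bool) → Prog → Prog

  exec : Bool → (Reg → Heads → Reg × Vec (Act A) (suc k)) → Conf → Conf
  exec g f (r , σ) = let (r′ , as) = f r (Vec.map top σ) in r′ , Vec.zipWith (perform g) as σ

  holds : (Reg → Heads → Bool) → Conf → Bool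
  holds p (r , σ) = p r (Vec.map top σ)

  infix 3 _⊢_⇓[_]_ _⊢_⇓_

  -- Big-step semantics; the index bounds how far a content has been extended.
  data _⊢_⇓[_]_ : Prog → Conf → ℕ → Conf → Set where
    act       : ∀ {g f s} → act g f ⊢ s ⇓[ cost g ] exec g f s
    _⨾_       : ∀ {P Q s t u m n} → P ⊢ s ⇓[ m ] t → Q ⊢ t ⇓[ n ] u → P ⨾ Q ⊢ s ⇓[ m + n ] u
    ite-true  : ∀ {p P Q s t n} → holds p s ≡ true → P ⊢ s ⇓[ n ] t → ite p P Q ⊢ s ⇓[ n ] t
    ite-false : ∀ {p P Q s t n} → holds p s ≡ false → Q ⊢ s ⇓[ n ] t → ite p P Q ⊢ s ⇓[ n ] t
    stop      : ∀ {p P s} → holds p s ≡ false → while p P ⊢ s ⇓[ 0 ] s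
    loop      : ∀ {p P s t u m n} → holds p s ≡ true → P ⊢ s ⇓[ m ] t →
                while p P ⊢ t ⇓[ n ] u → while p P ⊢ s ⇓[ m + n ] u

  _⊢_⇓_ : Prog → Conf → Conf → Set
  P ⊢ s ⇓ t = P ⊢ s ⇓[ 0 ] t

  private
    clash : ∀ {b} {C : Set} → b ≡ true → b ≡ false → C
    clash refl ()

  ⇓-deterministic : ∀ {P s m n t u} → P ⊢ s ⇓[ m ] t → P ⊢ s ⇓[ n ] u → t ≡ u
  ⇓-deterministic act act = refl
  ⇓-deterministic (d ⨾ e) (d′ ⨾ e′) with refl ← ⇓-deterministic d d′ = ⇓-deterministic e e′
  ⇓-deterministic (ite-true _ d)  (ite-true _ d′)  = ⇓-deterministic d d′
  ⇓-deterministic (ite-true p _)  (ite-false q _)  = clash p q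
  ⇓-deterministic (ite-false q _) (ite-true p _)   = clash p q
  ⇓-deterministic (ite-false _ d) (ite-false _ d′) = ⇓-deterministic d d′
  ⇓-deterministic (stop _) (stop _) = refl
  ⇓-deterministic (stop q) (loop p _ _) = clash p q
  ⇓-deterministic (loop p _ _) (stop q) = clash p q
  ⇓-deterministic (loop _ d e) (loop _ d′ e′) with refl ← ⇓-deterministic d d′ = ⇓-deterministic e e′

  Within : ℕ → Conf → Set
  Within m (_ , σ) = Allᵥ (λ t → width t ≤ m) σ

  exec-within : ∀ g {n m} (as : Vec (Act A) n) {σ} → Allᵥ (λ t → width t ≤ m) σ →
                Allᵥ (λ t → width t ≤ m + cost g) (Vec.zipWith (perform g) as σ)
  exec-within g []       []       = []
  exec-within g {m = m} (a ∷ as) (p ∷ ps) =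
    ≤-trans (width-perform g a _) (≤-trans (+-monoʳ-≤ (cost g) p) (≤-reflexive (+-comm (cost g) m)))
    ∷ exec-within g as ps

  ⇓-within : ∀ {P s t c m} → P ⊢ s ⇓[ c ] t → Within m s → Within (m + c) t
  ⇓-within (act {g} {f} {r , σ}) w = exec-within g (proj₂ (f r (Vec.map top σ))) w
  ⇓-within {t = t} {m = m} (_⨾_ {m = c} {d} x y) w =
    subst (λ e → Within e t) (+-assoc m c d) (⇓-within y (⇓-within x w))
  ⇓-within (ite-true _ d)  w = ⇓-within d w
  ⇓-within (ite-false _ d) w = ⇓-within d w
  ⇓-within {t = t} {m = m} (stop _) w = subst (λ e → Within e t) (sym (+-identityʳ m)) w
  ⇓-within {t = t} {m = m} (loop {m = c} {d} _ x y) w =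
    subst (λ e → Within e t) (+-assoc m c d) (⇓-within y (⇓-within x w))

  -- The extra `nothing` of a test or of a loop is the point at which its condition is evaluated.
  -- The end of a program is no location; it is the `nothing` of `Maybe (Loc P)`.
  Loc : Prog → Set
  Loc (act _ _)   = ⊤
  Loc (P ⨾ Q)     = Loc P ⊎ Loc Q
  Loc (ite _ P Q) = Maybe (Loc P ⊎ Loc Q)
  Loc (while _ P) = Maybe (Loc P)

  Loc-fin : ∀ P → Finite (Loc P)
  Loc-fin (act _ _)   = finite-⊤
  Loc-fin (P ⨾ Q)     = finite-⊎ (Loc-fin P) (Loc-fin Q)
  Loc-fin (ite _ P Q) = finite-Maybe (finite-⊎ (Loc-fin P) (Loc-fin Q))
  Loc-fin (while _ P) = finite-Maybe (Loc-fin P)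

  entry : ∀ P → Loc P
  entry (act _ _)   = tt
  entry (P ⨾ Q)     = inj₁ (entry P)
  entry (ite _ P Q) = nothing
  entry (while _ P) = nothing

  -- The machine cannot tell from a blank how far it is from the content, so
  -- it never moves right from a blank that it does not overwrite.
  instruction : Bool → Cell A → Act A → Cell A × Move
  instruction g     ▷     (w , left)  = ▷ , stay
  instruction g     ▷     (w , stay)  = ▷ , stay
  instruction g     ▷     (w , right) = ▷ , right
  instruction true  □ (just a , m)    = ` a , m
  instruction false □ (just a , right) = □ , stay
  instruction false □ (just a , stay) = □ , stay
  instruction false □ (just a , left) = □ , left
  instruction g     □ (nothing , right) = □ , stay
  instruction g     □ (nothing , stay) = □ , stay
  instruction g     □ (nothing , left) = □ , left
  instruction g     (` a) (just b , m)  = ` b , m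
  instruction g     (` a) (nothing , m) = ` a , m

  rest : Cell A → Cell A × Move
  rest a = a , stay

  Output : Set → Set
  Output S = S × Reg × Vec (Cell A × Move) (suc k)

  -- The target `nothing` means that the program is finished. Hence a sequence redirects the end of
  -- its first part to the entry of the second, and a loop redirects the end of its body to its own
  -- condition.
  run : ∀ P → Loc P → Reg → Heads → Output (Maybe (Loc P))
  run (act g f)   tt              r h = let (r′ , as) = f r h in
                                        nothing , r′ , Vec.zipWith (instruction g) h as
  run (P ⨾ Q)     (inj₁ c)        r h = map₁ (just ∘ maybe inj₁ (inj₂ (entry Q))) (run P c r h)
  run (P ⨾ Q)     (inj₂ c)        r h = map₁ (Maybe.map inj₂) (run Q c r h)
  run (ite p P Q) nothing         r h = just (just (if p r h then inj₁ (entry P) else inj₂ (entry Q)))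
                                        , r , Vec.map rest h
  run (ite p P Q) (just (inj₁ c)) r h = map₁ (Maybe.map (just ∘ inj₁)) (run P c r h)
  run (ite p P Q) (just (inj₂ c)) r h = map₁ (Maybe.map (just ∘ inj₂)) (run Q c r h)
  run (while p P) nothing         r h = (if p r h then just (just (entry P)) else nothing)
                                        , r , Vec.map rest h
  run (while p P) (just c)        r h = map₁ just (run P c r h)

  loaded : List A → Vec (Zip A) (suc k)
  loaded x = ([] ▸ x) ∷ Vec.replicate k ([] ▸ [])

  -- Compilation into Turing machines

  module Compile (A-fin : Finite A) (Reg-fin : Finite Reg)
                 (main : Prog) (r₀ : Reg) (accept : Reg → Bool) where

    Control : Set
    Control = Maybe (Loc main) × Reg

    -- The first two states put the markers in place.
    transition : Maybe (Maybe Control) → Heads →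
                 Maybe (Maybe (Maybe Control) × Vec (Cell A × Move) (suc k))
    transition nothing (a ∷ _) =
      just (just nothing , (a , left) ∷ Vec.replicate k (▷ , right))
    transition (just nothing) (_ ∷ h) =
      just (just (just (just (entry main) , r₀)) , (▷ , right) ∷ Vec.map rest h)
    transition (just (just (nothing , r))) h = nothing
    transition (just (just (just c , r))) h =
      let (n , r′ , as) = run main c r h in just (just (just (n , r′)) , as)

    machine : TM A
    machine = record
      { State       = Maybe (Maybe Control)
      ; Γ           = Cell A
      ; State-fin   = finite-Maybe (finite-Maybe (finite-× (finite-Maybe (Loc-fin main)) Reg-fin))
      ; Γ-fin       = finite-Maybe (finite-Maybe A-fin)
      ; input       = mk↣ {to = `_} (just-injective ∘ just-injective)
      ; blank       = □
      ; blank-fresh = λ _ ()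
      ; workTapes   = k
      ; start       = nothing
      ; accepting   = λ { (just (just (_ , r))) → accept r ; _ → false }
      ; δ           = transition
      }

    open Computation machine

    -- A blank right of the content that has been visited remains a cell of the tape. As the head
    -- never moves right from such a blank, there is at most one, and a Boolean records whether it
    -- exists.
    pad : Bool → List (Cell A)
    pad true  = □ ∷ []
    pad false = []

    represent : Bool → Zip A → Tape (Cell A)
    represent e (◂ S)       = tape [] ▷ (map `_ S ++ pad e)
    represent e (L ▸ [])    = tape (map `_ L ++ ▷ ∷ []) □ []
    represent e (L ▸ r ∷ S) = tape (map `_ L ++ ▷ ∷ []) (` r) (map `_ S ++ pad e)

    Represents : Zip A → Tape (Cell A) → Set
    Represents t T = ∃ λ e → T ≡ represent e t

    represent-head : ∀ e t → Tape.head (represent e t) ≡ top t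
    represent-head e (◂ S)       = refl
    represent-head e (L ▸ [])    = refl
    represent-head e (L ▸ r ∷ S) = refl

    move-right : ∀ e L a S → Represents (a ∷ L ▸ S) (move right (represent e (L ▸ a ∷ S)))
    move-right true  L a []      = true , refl
    move-right false L a []      = true , refl
    move-right e     L a (r ∷ S) = e , refl

    move-marker : ∀ e S → Represents ([] ▸ S) (move right (represent e (◂ S)))
    move-marker true  []      = true , refl
    move-marker false []      = true , refl
    move-marker e     (r ∷ S) = e , refl

    move-content : ∀ m e L a S → Represents (shift m (L ▸ a ∷ S)) (move m (represent e (L ▸ a ∷ S)))
    move-content left  e []      a S = e , refl
    move-content left  e (l ∷ L) a S = e , refl
    move-content stay  e L       a S = e , refl
    move-content right e L       a S = move-right e L a S

    move-end : ∀ L → Represents (shift left (L ▸ [])) (move left (represent false (L ▸ [])))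
    move-end []      = true , refl
    move-end (l ∷ L) = true , refl

    perform-represents : ∀ g a e t →
      Represents (perform g a t) (writeAndMove (instruction g (top t) a) (represent e t))
    perform-represents g     (nothing , left)  e (◂ S) = e , refl
    perform-represents g     (nothing , stay)  e (◂ S) = e , refl
    perform-represents g     (nothing , right) e (◂ S) = move-marker e S
    perform-represents g     (just _ , left)   e (◂ S) = e , refl
    perform-represents g     (just _ , stay)   e (◂ S) = e , refl
    perform-represents g     (just _ , right)  e (◂ S) = move-marker e S
    perform-represents true  (just a , m)      e (L ▸ []) = move-content m false L a []
    perform-represents false (just a , left)   e (L ▸ []) = move-end L
    perform-represents false (just a , stay)   e (L ▸ []) = e , refl
    perform-represents false (just a , right)  e (L ▸ []) = e , refl
    perform-represents true  (nothing , left)  e (L ▸ []) = move-end L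
    perform-represents true  (nothing , stay)  e (L ▸ []) = e , refl
    perform-represents true  (nothing , right) e (L ▸ []) = e , refl
    perform-represents false (nothing , left)  e (L ▸ []) = move-end L
    perform-represents false (nothing , stay)  e (L ▸ []) = e , refl
    perform-represents false (nothing , right) e (L ▸ []) = e , refl
    perform-represents true  (just b , m)      e (L ▸ a ∷ S) = move-content m e L b S
    perform-represents false (just b , m)      e (L ▸ a ∷ S) = move-content m e L b S
    perform-represents g     (nothing , m)     e (L ▸ a ∷ S) = move-content m e L a S

    Representsᵥ : ∀ {n} → Vec (Zip A) n → Vec (Tape (Cell A)) n → Set
    Representsᵥ = Pointwise Represents

    heads-represent : ∀ {n} {σ : Vec _ n} {Ts} → Representsᵥ σ Ts → Vec.map Tape.head Ts ≡ Vec.map top σ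
    heads-represent [] = refl
    heads-represent {σ = t ∷ _} ((e , refl) ∷ ρs) = cong₂ _∷_ (represent-head e t) (heads-represent ρs)

    exec-represents : ∀ g {n} (as : Vec (Act A) n) {σ Ts} → Representsᵥ σ Ts →
      Representsᵥ (Vec.zipWith (perform g) as σ)
                  (Vec.zipWith writeAndMove (Vec.zipWith (instruction g) (Vec.map top σ) as) Ts)
    exec-represents g [] [] = []
    exec-represents g (a ∷ as) {t ∷ _} ((e , refl) ∷ ρs) = perform-represents g a e t ∷ exec-represents g as ρs

    rest-stays : ∀ {n} {σ : Vec _ n} {Ts} → Representsᵥ σ Ts →
                 Vec.zipWith writeAndMove (Vec.map rest (Vec.map top σ)) Ts ≡ Ts
    rest-stays [] = refl
    rest-stays {σ = t ∷ _} ((e , refl) ∷ ρs) = cong₂ _∷_ (stays t) (rest-stays ρs)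
      where
      stays : ∀ t → writeAndMove (rest (top t)) (represent e t) ≡ represent e t
      stays (◂ S)       = refl
      stays (L ▸ [])    = refl
      stays (L ▸ r ∷ S) = refl

    stepMain : Maybe (Loc main) → Reg → Heads → Maybe (Output (Maybe (Loc main)))
    stepMain nothing  r h = nothing
    stepMain (just c) r h = just (run main c r h)

    -- Here `κ` places the control of a subprogram inside that of `main`, and `κ nothing` is the
    -- point where `main` continues afterwards. With `κ` arbitrary, the simulation can be proved by
    -- induction on derivations without a notion of program context.
    Embedding : ∀ P → (Maybe (Loc P) → Maybe (Loc main)) → Set
    Embedding P κ = ∀ c r h → stepMain (κ (just c)) r h ≡ just (map₁ κ (run P c r h))

    at : Maybe (Loc main) → Reg → Vec (Tape (Cell A)) (suc k) → Config
    at c r Ts = config (just (just (c , r))) Ts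

    at-step : ∀ c {r σ Ts n r′ as} → Representsᵥ σ Ts →
              stepMain c r (Vec.map top σ) ≡ just (n , r′ , as) →
              step (at c r Ts) ≡ just (at n r′ (Vec.zipWith writeAndMove as Ts))
    at-step (just c) ρ eq rewrite heads-represent ρ with refl ← eq = refl

    Simulation : ∀ P → (Maybe (Loc P) → Maybe (Loc main)) → Conf → Conf → Set
    Simulation P κ (r , σ) (r′ , σ′) = ∀ {Ts} → Representsᵥ σ Ts →
      ∃ λ Ts′ → Representsᵥ σ′ Ts′ × at (κ (just (entry P))) r Ts ⟶* at (κ nothing) r′ Ts′

    at-rest : ∀ c {r σ Ts n} → Representsᵥ σ Ts →
              stepMain c r (Vec.map top σ) ≡ just (n , r , Vec.map rest (Vec.map top σ)) →
              step (at c r Ts) ≡ just (at n r Ts)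
    at-rest c {Ts = Ts} ρ eq = trans (at-step c ρ eq) (cong (just ∘ at _ _) (rest-stays ρ))

    -- The outcome of a step at a test as a function of the Boolean, so that `cong` can replace the
    -- condition by its known value; `after-guard` does the same for loops.
    after-test : ∀ {h : Vec (Cell A × Move) (suc k)} p P Q → (Maybe (Loc (ite p P Q)) → Maybe (Loc main)) →
                 Reg → Bool → Maybe (Output (Maybe (Loc main)))
    after-test {h} p P Q κ r b = just (κ (just (just (if b then inj₁ (entry P) else inj₂ (entry Q)))) , r , h)

    after-guard : ∀ {h : Vec (Cell A × Move) (suc k)} p P → (Maybe (Loc (while p P)) → Maybe (Loc main)) →
                  Reg → Bool → Maybe (Output (Maybe (Loc main)))
    after-guard {h} p P κ r b = just (κ (if b then just (just (entry P)) else nothing) , r , h)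

    simulate : ∀ {P s c t} (κ : Maybe (Loc P) → Maybe (Loc main)) → Embedding P κ →
               P ⊢ s ⇓[ c ] t → Simulation P κ s t
    simulate κ emb (act {g} {f} {r , σ}) ρ =
      _ , exec-represents g _ ρ , at-step (κ (just tt)) ρ (emb tt r _) ◅ ε
    simulate {P ⨾ Q} κ emb (d ⨾ e) ρ =
      let (_ , ρ₁ , x) = simulate (κ ∘ just ∘ maybe inj₁ (inj₂ (entry Q))) (λ c → emb (inj₁ c)) d ρ
          (_ , ρ₂ , y) = simulate (κ ∘ Maybe.map inj₂) (λ c → emb (inj₂ c)) e ρ₁
      in _ , ρ₂ , x ◅◅ y
    simulate {ite p P Q} {r , σ} κ emb (ite-true q d) ρ =
      let (_ , ρ₁ , x) = simulate (κ ∘ Maybe.map (just ∘ inj₁)) (λ c → emb (just (inj₁ c))) d ρ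
      in _ , ρ₁ , at-rest (κ (just nothing)) ρ (trans (emb nothing r _) (cong (after-test p P Q κ r) q)) ◅ x
    simulate {ite p P Q} {r , σ} κ emb (ite-false q d) ρ =
      let (_ , ρ₁ , x) = simulate (κ ∘ Maybe.map (just ∘ inj₂)) (λ c → emb (just (inj₂ c))) d ρ
      in _ , ρ₁ , at-rest (κ (just nothing)) ρ (trans (emb nothing r _) (cong (after-test p P Q κ r) q)) ◅ x
    simulate {while p P} {r , σ} κ emb (stop q) ρ =
      _ , ρ , at-rest (κ (just nothing)) ρ (trans (emb nothing r _) (cong (after-guard p P κ r) q)) ◅ ε
    simulate {while p P} {r , σ} κ emb (loop q d e) ρ =
      let (_ , ρ₁ , x) = simulate (κ ∘ just) (λ c → emb (just c)) d ρ
          (_ , ρ₂ , y) = simulate κ emb e ρ₁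
      in _ , ρ₂ , at-rest (κ (just nothing)) ρ (trans (emb nothing r _) (cong (after-guard p P κ r) q)) ◅ (x ◅◅ y)

    blanks-represent : ∀ n →
      let Ts = Vec.zipWith writeAndMove (Vec.replicate n (▷ , right)) (Vec.replicate n (load []))
      in Representsᵥ (Vec.replicate n ([] ▸ [])) (Vec.zipWith writeAndMove (Vec.map rest (Vec.map Tape.head Ts)) Ts)
    blanks-represent zero    = []
    blanks-represent (suc n) = (false , refl) ∷ blanks-represent n

    initial-represents : ∀ x → ∃ λ Ts → Representsᵥ (loaded x) Ts ×
                         initialConfig x ⟶* at (just (entry main)) r₀ Ts
    initial-represents []      = _ , (false , refl) ∷ blanks-represent k , refl ◅ refl ◅ ε
    initial-represents (a ∷ x) =
      _ , (false , cong (tape _ _) (sym (++-identityʳ (map `_ x)))) ∷ blanks-represent k , refl ◅ refl ◅ ε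

    simulate-main : ∀ {x c r σ} → main ⊢ (r₀ , loaded x) ⇓[ c ] (r , σ) →
                    ∃ λ Ts → Representsᵥ σ Ts × initialConfig x ⟶* at nothing r Ts
    simulate-main {x} d =
      let (_ , ρ , init) = initial-represents x
          (Ts , ρ′ , go) = simulate id (λ _ _ _ → refl) d ρ
      in Ts , ρ′ , init ◅◅ go

    tapeSize-move : ∀ m T → tapeSize T ≤ tapeSize (move m T)
    tapeSize-move left  (tape []       a rs)       = n≤1+n _
    tapeSize-move left  (tape (l ∷ ls) a rs)       = ≤-reflexive (sym (+-suc (length ls) (suc (length rs))))
    tapeSize-move stay  (tape ls       a rs)       = ≤-refl
    tapeSize-move right (tape ls       a [])       = n≤1+n _
    tapeSize-move right (tape ls       a (r ∷ rs)) = ≤-reflexive (+-suc (length ls) (suc (length rs)))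

    sizes : ∀ {n} → Vec (Tape (Cell A)) n → ℕ
    sizes Ts = Vec.sum (Vec.map tapeSize Ts)

    sizes-mono : ∀ {n} (as : Vec (Cell A × Move) n) Ts → sizes Ts ≤ sizes (Vec.zipWith writeAndMove as Ts)
    sizes-mono []             []       = z≤n
    sizes-mono ((b , m) ∷ as) (tape ls a rs ∷ Ts) = +-mono-≤ (tapeSize-move m (tape ls b rs)) (sizes-mono as Ts)

    space-step : ∀ {c d} → step c ≡ just d → space c ≤ space d
    space-step {config q Ts} eq with transition q (Vec.map Tape.head Ts)
    space-step {config q Ts} refl | just (_ , as) = sizes-mono as Ts

    space-steps : ∀ {c d} → c ⟶* d → space c ≤ space d
    space-steps ε         = ≤-refl
    space-steps {c} {d} (_◅_ {j = e} eq s) = ≤-trans (space-step {c} {e} eq) (space-steps s)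

    -- Determinism puts every reachable configuration on the one halting run. Since cells are never
    -- given back, a bound on the space of the halting configuration then bounds all of them.
    halts-last : ∀ {c d e} → step e ≡ nothing → c ⟶* e → c ⟶* d → d ⟶* e
    halts-last halt s          ε         = s
    halts-last halt ε          (q ◅ _)   with () ← trans (sym halt) q
    halts-last halt (p ◅ s)    (q ◅ s′)  with refl ← trans (sym p) q = halts-last halt s s′

    tapeSize-represent : ∀ e t → tapeSize (represent e t) ≤ 2 + width t
    tapeSize-represent e (◂ S)       = s≤s (size-content e S)
      where
      size-content : ∀ e S → length (map `_ S ++ pad e) ≤ suc (length S)
      size-content true  []      = ≤-refl
      size-content false []      = z≤n
      size-content e     (_ ∷ S) = s≤s (size-content e S)
    tapeSize-represent e ([] ▸ [])       = ≤-refl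
    tapeSize-represent e ([] ▸ r ∷ S)    = tapeSize-represent e (◂ r ∷ S)
    tapeSize-represent e (l ∷ L ▸ [])    = s≤s (tapeSize-represent e (L ▸ []))
    tapeSize-represent e (l ∷ L ▸ r ∷ S) = s≤s (tapeSize-represent e (L ▸ r ∷ S))

    sizes-represent : ∀ {n m} {σ : Vec _ n} {Ts} → Representsᵥ σ Ts → Allᵥ (λ t → width t ≤ m) σ →
                      sizes Ts ≤ n * (2 + m)
    sizes-represent [] [] = z≤n
    sizes-represent {σ = t ∷ _} ((e , refl) ∷ ρs) (w ∷ ws) =
      +-mono-≤ (≤-trans (tapeSize-represent e t) (s≤s (s≤s w))) (sizes-represent ρs ws)

    initial-within : ∀ x → Within (length x) (r₀ , loaded x)
    initial-within x = ≤-refl ∷ blanks k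
      where
      blanks : ∀ n → Allᵥ (λ t → width t ≤ length x) (Vec.replicate n ([] ▸ []))
      blanks zero    = []
      blanks (suc n) = z≤n ∷ blanks n

    decides-in-pspace : ∀ {ℓ} {Lang : Language A ℓ} →
      (∀ x → ∃₂ λ r σ → main ⊢ (r₀ , loaded x) ⇓[ length x ] (r , σ) × (accept r ≡ true ⇔ Lang x)) →
      PSPACE Lang
    -- Each of the `suc k` tapes has a content of width at most n at the start, extended by at most
    -- n, and two further cells for the marker and a visited blank. This gives the polynomial (k +
    -- 1)(2 + 2n).
    decides-in-pspace {Lang = Lang} runs = machine , decides , suc k * 2 ∷ suc k * 2 ∷ [] , bounded
      where
      decides : Decides Lang
      decides x =
        let (_ , _ , d , eq) = runs x
            (_ , _ , s) = simulate-main d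
        in _ , s , refl , eq

      bounded : RunsInSpace (eval (suc k * 2 ∷ suc k * 2 ∷ []))
      bounded x c s =
        let (_ , σ , d , _) = runs x
            (Ts , ρ , s′) = simulate-main d
        in ≤-trans (space-steps (halts-last refl s′ s))
          (≤-trans (sizes-represent ρ (⇓-within d (initial-within x)))
                   (≤-reflexive (arith (suc k) (length x))))
        where
        arith : ∀ a n → a * (2 + (n + n)) ≡ a * 2 + n * (a * 2 + n * 0)
        arith = solve 2 (λ a n → a :* (con 2 :+ (n :+ n)) := a :* con 2 :+ n :* (a :* con 2 :+ n :* con 0)) refl
          where open +-*-Solver

-- Alphabet, registers and tapes of the machine

Symbol-finite : Finite Symbol
Symbol-finite = finite-↔ (mk↔ₛ′ to from to-from from-to) (finite-⊎ finite-Bool (finite-Fin {10}))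
  where
  to : Symbol → Bool ⊎ Fin 10
  to (bit b) = inj₁ b
  to tick    = inj₂ 0F
  to worldˢ  = inj₂ 1F
  to labelˢ  = inj₂ 2F
  to posˢ    = inj₂ 3F
  to negˢ    = inj₂ 4F
  to ∧ˢ      = inj₂ 5F
  to ∨ˢ      = inj₂ 6F
  to Xˢ      = inj₂ 7F
  to Uˢ      = inj₂ 8F
  to Rˢ      = inj₂ 9F

  from : Bool ⊎ Fin 10 → Symbol
  from (inj₁ b)  = bit b
  from (inj₂ 0F) = tick
  from (inj₂ 1F) = worldˢ
  from (inj₂ 2F) = labelˢ
  from (inj₂ 3F) = posˢ
  from (inj₂ 4F) = negˢ
  from (inj₂ 5F) = ∧ˢ
  from (inj₂ 6F) = ∨ˢ
  from (inj₂ 7F) = Xˢ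
  from (inj₂ 8F) = Uˢ
  from (inj₂ 9F) = Rˢ

  to-from : ∀ y → to (from y) ≡ y
  to-from (inj₁ _)  = refl
  to-from (inj₂ 0F) = refl
  to-from (inj₂ 1F) = refl
  to-from (inj₂ 2F) = refl
  to-from (inj₂ 3F) = refl
  to-from (inj₂ 4F) = refl
  to-from (inj₂ 5F) = refl
  to-from (inj₂ 6F) = refl
  to-from (inj₂ 7F) = refl
  to-from (inj₂ 8F) = refl
  to-from (inj₂ 9F) = refl

  from-to : ∀ y → from (to y) ≡ y
  from-to (bit _) = refl
  from-to tick    = refl
  from-to worldˢ  = refl
  from-to labelˢ  = refl
  from-to posˢ    = refl
  from-to negˢ    = refl
  from-to ∧ˢ      = refl
  from-to ∨ˢ      = refl
  from-to Xˢ      = refl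
  from-to Uˢ      = refl
  from-to Rˢ      = refl

-- In the second phase the current row has no edge yet.
pattern atStart   = 0F
pattern inRow     = 1F
pattern inBlock   = 2F
pattern inFormula = 3F
pattern failed    = 4F

record Reg : Set where
  constructor reg
  field
    phase : Fin 5
    flag live found res sign : Bool

Reg-finite : Finite Reg
Reg-finite = finite-↔
  (mk↔ₛ′ (λ (reg q a b c d e) → q , a , b , c , d , e) (λ (q , a , b , c , d , e) → reg q a b c d e)
         (λ _ → refl) (λ _ → refl))
  (finite-× finite-Fin (finite-× finite-Bool (finite-× finite-Bool (finite-× finite-Bool
    (finite-× finite-Bool finite-Bool)))))

open Machine Symbol Reg 9

-- x: the input; f: its formula; g: for every symbol of the formula a truth
-- value at the next time, or `tick` if there is none yet; v: a stack of truth
-- values; c: the time; e: a counter; s: the worlds reached at that time;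
-- a: their successors; i: the initial world; d: a counter.
pattern xT = 0F
pattern fT = 1F
pattern gT = 2F
pattern vT = 3F
pattern cT = 4F
pattern eT = 5F
pattern sT = 6F
pattern aT = 7F
pattern iT = 8F
pattern dT = 9F

Zips : Set
Zips = Vec (Zip Symbol) 10

st : Reg → (x f g v c e s a i d : Zip Symbol) → Conf
st r x f g v c e s a i d = r , x ∷ f ∷ g ∷ v ∷ c ∷ e ∷ s ∷ a ∷ i ∷ d ∷ []

bits : List Bool → List Symbol
bits = map bit

idle : Vec (Act Symbol) 10
idle = Vec.replicate 10 (nothing , stay)

go : Move → Act Symbol
go m = nothing , m

putBit : Bool → Move → Act Symbol
putBit b m = just (bit b) , m

symbol : Cell Symbol → Maybe Symbol
symbol (` y) = just y
symbol _     = nothing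

isTrue isBit isEnd isMarker isKripke : Cell Symbol → Bool
isTrue (` bit b) = b
isTrue _         = false

isBit (` bit _) = true
isBit _         = false

isEnd □ = true
isEnd _ = false

isMarker ▷ = true
isMarker _ = false

isKripke (` bit _)  = true
isKripke (` tick)   = true
isKripke (` worldˢ) = true
isKripke (` labelˢ) = true
isKripke _          = false

isWorld isLabel isTick : Cell Symbol → Bool
isWorld (` worldˢ) = true
isWorld _          = false

isLabel (` labelˢ) = true
isLabel _          = false

isTick (` tick) = true
isTick _        = false

at-tape : Fin 10 → (Reg → Cell Symbol → Reg × Act Symbol) → Reg → Heads → Reg × Vec (Act Symbol) 10
at-tape i p r h = let (r′ , a) = p r (lookup h i) in r′ , idle [ i ]≔ a

on : Fin 10 → (Reg → Cell Symbol → Reg × Act Symbol) → Prog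
on i p = act false (at-tape i p)

whileOn : Fin 10 → (Reg → Cell Symbol → Bool) → Prog → Prog
whileOn i p = while λ r h → p r (lookup h i)

infixl 2 _⇒_

_⇒_ : ∀ {P s t u n} → P ⊢ s ⇓[ n ] t → t ≡ u → P ⊢ s ⇓[ n ] u
d ⇒ refl = d

-- Elementary programs

perform-idle : ∀ {n} (σ : Vec (Zip Symbol) n) → Vec.zipWith (perform false) (Vec.replicate n (nothing , stay)) σ ≡ σ
perform-idle []      = refl
perform-idle (t ∷ σ) = cong (t ∷_) (perform-idle σ)

perform-at : ∀ {n} i a (σ : Vec (Zip Symbol) n) →
  Vec.zipWith (perform false) (Vec.replicate n (nothing , stay) [ i ]≔ a) σ ≡ σ [ i ]≔ perform false a (lookup σ i)
perform-at zero    a (t ∷ σ) = cong (perform false a t ∷_) (perform-idle σ)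
perform-at (suc i) a (t ∷ σ) = cong (t ∷_) (perform-at i a σ)

scanned : ∀ i (σ : Zips) t → lookup (Vec.map top (σ [ i ]≔ t)) i ≡ top t
scanned i σ t = trans (lookup-map i top (σ [ i ]≔ t)) (cong top (lookup∘update i σ t))

-- Writing the configuration as an update at `i` makes the lemmas about a single tape independent of
-- the index; on a concrete vector the update computes away.
on-run : ∀ i p r σ t → on i p ⊢ (r , σ [ i ]≔ t) ⇓
         (let (r′ , a) = p r (top t) in r′ , σ [ i ]≔ perform false a t)
on-run i p r σ t = subst (λ s → on i p ⊢ (r , σ [ i ]≔ t) ⇓ s) eq act
  where
  eq : exec false (at-tape i p) (r , σ [ i ]≔ t) ≡ (let (r′ , a) = p r (top t) in r′ , σ [ i ]≔ perform false a t)
  eq rewrite scanned i σ t | perform-at i (proj₂ (p r (top t))) (σ [ i ]≔ t) | lookup∘update i σ t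
     = cong (_ ,_) ([]≔-idempotent σ i)

loop-at : ∀ {i} p {P r σ t u v} → p r (top t) ≡ true →
          P ⊢ (r , σ [ i ]≔ t) ⇓ u → whileOn i p P ⊢ u ⇓ v → whileOn i p P ⊢ (r , σ [ i ]≔ t) ⇓ v
loop-at {i} p {r = r} {σ} {t} q = loop (trans (cong (p r) (scanned i σ t)) q)

stop-at : ∀ {i} p {P r σ t} → p r (top t) ≡ false → whileOn i p P ⊢ (r , σ [ i ]≔ t) ⇓ (r , σ [ i ]≔ t)
stop-at {i} p {r = r} {σ} {t} q = stop (trans (cong (p r) (scanned i σ t)) q)

rewound : Zip Symbol → Zip Symbol
rewound (◂ S)   = ◂ S
rewound (L ▸ S) = ◂ (L ʳ++ S)

steer : Move → Reg → Cell Symbol → Reg × Act Symbol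
steer m r _ = r , go m

unmarked : Reg → Cell Symbol → Bool
unmarked _ y = not (isMarker y)

rewind : Fin 10 → Prog
rewind i = whileOn i unmarked (on i (steer left))

rewind-loop : ∀ i r σ t → rewind i ⊢ (r , σ [ i ]≔ t) ⇓ (r , σ [ i ]≔ rewound t)
rewind-loop i r σ (◂ S)   = stop-at unmarked refl
rewind-loop i r σ (L ▸ S) = from L S
  where
  off-marker : ∀ L S → not (isMarker (top (L ▸ S))) ≡ true
  off-marker L []      = refl
  off-marker L (_ ∷ _) = refl

  from : ∀ L S → rewind i ⊢ (r , σ [ i ]≔ (L ▸ S)) ⇓ (r , σ [ i ]≔ (◂ (L ʳ++ S)))
  from []      S = loop-at unmarked (off-marker [] S) (on-run i (steer left) r σ _) (stop-at unmarked refl)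
  from (l ∷ L) S = loop-at unmarked (off-marker (l ∷ L) S) (on-run i (steer left) r σ _) (from L (l ∷ S))

rewind-run : ∀ i {r σ} → rewind i ⊢ (r , σ) ⇓ (r , σ [ i ]≔ rewound (lookup σ i))
rewind-run i {r} {σ} = subst (λ τ → rewind i ⊢ (r , τ) ⇓ (r , σ [ i ]≔ rewound (lookup σ i))) ([]≔-lookup σ i)
                             (rewind-loop i r σ (lookup σ i))

-- Binary counters, least significant bit first. Decrementing 0 wraps around.
pred? : List Bool → Bool
pred? []           = false
pred? (true ∷ bs)  = true
pred? (false ∷ bs) = pred? bs

pred₂ : List Bool → List Bool
pred₂ []           = []
pred₂ (true ∷ bs)  = false ∷ bs
pred₂ (false ∷ bs) = true ∷ pred₂ bs

setFlag : Bool → Reg → Reg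
setFlag b r = record r { flag = b }

isZero : Reg → Cell Symbol → Bool
isZero _ (` bit b) = not b
isZero _ _         = false

setOne clearOne : Reg → Cell Symbol → Reg × Act Symbol
setOne   r _ = r , putBit true right
clearOne r y = setFlag (isTrue y) r , putBit false stay

borrow decrement : Fin 10 → Prog
borrow i    = whileOn i isZero (on i setOne)
decrement i = on i (steer right) ⨾ borrow i ⨾ on i clearOne ⨾ rewind i

-- The loop stops at the first digit 1 or, if the counter is 0, on the blank behind it. There
-- `clearOne` writes nothing, because the content may not be extended, and it sets the flag to
-- `false`.
borrow-run : ∀ i r σ L bs → ∃ λ t → borrow i ⊢ (r , σ [ i ]≔ (L ▸ bits bs)) ⇓ (r , σ [ i ]≔ t) ×
  isTrue (top t) ≡ pred? bs × rewound (perform false (putBit false stay) t) ≡ (◂ (L ʳ++ bits (pred₂ bs)))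
borrow-run i r σ L []           = _ , stop-at isZero refl , refl , refl
borrow-run i r σ L (true ∷ bs)  = _ , stop-at isZero refl , refl , refl
borrow-run i r σ L (false ∷ bs) =
  let (t , d , p , q) = borrow-run i r σ (bit true ∷ L) bs
  in t , loop-at isZero refl (on-run i setOne r σ _) d , p , q

decrement-run : ∀ i r σ bs → decrement i ⊢ (r , σ [ i ]≔ (◂ bits bs)) ⇓ (setFlag (pred? bs) r , σ [ i ]≔ (◂ bits (pred₂ bs)))
decrement-run i r σ bs with borrow-run i r σ [] bs
... | t , d , p , q =
  on-run i (steer right) r σ (◂ bits bs) ⨾ d ⨾ on-run i clearOne r σ t ⨾ rewind-loop i _ σ _
  ⇒ cong₂ (λ b u → setFlag b r , σ [ i ]≔ u) p q

copying : Fin 10 → Fin 10 → Maybe Symbol → Prog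
copying i j w = while (λ _ h → not (isEnd (lookup h i)))
  (act false λ r h → r , idle [ i ]≔ (w , right) [ j ]≔ (symbol (lookup h i) , right))

copy : Fin 10 → Fin 10 → Maybe Symbol → Prog
copy i j w = act false (λ r _ → r , idle [ i ]≔ go right [ j ]≔ go right) ⨾ copying i j w ⨾ rewind i ⨾ rewind j

private variable
  r : Reg
  x f g v c e s a i d : Zip Symbol

there-and-back : ∀ (xs : List Symbol) → (xs ʳ++ []) ʳ++ [] ≡ xs
there-and-back xs = trans (ʳ++-ʳ++ xs) (++-identityʳ xs)

copy-time : ∀ {xs ys} → length xs ≡ length ys →
  copy cT eT nothing ⊢ st r x f g v (◂ xs) (◂ ys) s a i d ⇓ st r x f g v (◂ xs) (◂ xs) s a i d
copy-time {xs = xs} {ys} eq =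
  act ⨾ across [] [] xs ys eq ⨾ rewind-run cT ⨾ rewind-run eT
  ⇒ cong (λ zs → st _ _ _ _ _ (◂ zs) (◂ zs) _ _ _ _) (there-and-back xs)
  where
  across : ∀ L M xs ys → length xs ≡ length ys → copying cT eT nothing ⊢ st r x f g v (L ▸ xs) (M ▸ ys) s a i d ⇓
           st r x f g v ((xs ʳ++ L) ▸ []) ((xs ʳ++ M) ▸ []) s a i d
  across L M []       []       eq = stop refl
  across L M (y ∷ xs) (_ ∷ ys) eq = loop refl act (across _ _ xs ys (suc-injective eq))

copy-initial : ∀ {xs ys} → length xs ≡ length ys →
  copy iT sT nothing ⊢ st r x f g v c e (◂ ys) a (◂ xs) d ⇓ st r x f g v c e (◂ xs) a (◂ xs) d
copy-initial {xs = xs} {ys} eq =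
  act ⨾ across [] [] xs ys eq ⨾ rewind-run iT ⨾ rewind-run sT
  ⇒ cong (λ zs → st _ _ _ _ _ _ _ (◂ zs) _ (◂ zs) _) (there-and-back xs)
  where
  across : ∀ L M xs ys → length xs ≡ length ys → copying iT sT nothing ⊢ st r x f g v c e (M ▸ ys) a (L ▸ xs) d ⇓
           st r x f g v c e ((xs ʳ++ M) ▸ []) a ((xs ʳ++ L) ▸ []) d
  across L M []       []       eq = stop refl
  across L M (y ∷ xs) (_ ∷ ys) eq = loop refl act (across _ _ xs ys (suc-injective eq))

move-successors : ∀ {xs ys} → length xs ≡ length ys →
  copy aT sT (just (bit false)) ⊢ st r x f g v c e (◂ ys) (◂ xs) i d ⇓
  st r x f g v c e (◂ xs) (◂ replicate (length xs) (bit false)) i d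
move-successors {xs = xs} {ys} eq =
  act ⨾ across [] [] xs ys eq ⨾ rewind-run aT ⨾ rewind-run sT
  ⇒ cong₂ (λ zs ws → st _ _ _ _ _ _ _ (◂ zs) (◂ ws) _ _)
          (there-and-back xs) (there-and-back (replicate (length xs) (bit false)))
  where
  across : ∀ L M xs ys → length xs ≡ length ys → copying aT sT (just (bit false)) ⊢ st r x f g v c e (M ▸ ys) (L ▸ xs) i d ⇓
           st r x f g v c e ((xs ʳ++ M) ▸ []) ((replicate (length xs) (bit false) ʳ++ L) ▸ []) i d
  across L M []       []       eq = stop refl
  across L M (y ∷ xs) (_ ∷ ys) eq = loop refl act (across _ _ xs ys (suc-injective eq))

decrement-time : ∀ bs → decrement cT ⊢ st r x f g v (◂ bits bs) e s a i d
                                     ⇓ st (setFlag (pred? bs) r) x f g v (◂ bits (pred₂ bs)) e s a i d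
decrement-time {r} {x} {f} {g} {v} {e} {s} {a} {i} {d} =
  -- The entry at the position of the counter is an arbitrary filler, since the update overwrites
  -- it.
  decrement-run cT r (x ∷ f ∷ g ∷ v ∷ e ∷ e ∷ s ∷ a ∷ i ∷ d ∷ [])

decrement-counter : ∀ bs → decrement eT ⊢ st r x f g v c (◂ bits bs) s a i d
                                        ⇓ st (setFlag (pred? bs) r) x f g v c (◂ bits (pred₂ bs)) s a i d
decrement-counter {r} {x} {f} {g} {v} {c} {s} {a} {i} {d} =
  decrement-run eT r (x ∷ f ∷ g ∷ v ∷ c ∷ c ∷ s ∷ a ∷ i ∷ d ∷ [])

decrement-pass : ∀ bs → decrement dT ⊢ st r x f g v c e s a i (◂ bits bs)
                                     ⇓ st (setFlag (pred? bs) r) x f g v c e s a i (◂ bits (pred₂ bs))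
decrement-pass {r} {x} {f} {g} {v} {c} {e} {s} {a} {i} =
  decrement-run dT r (x ∷ f ∷ g ∷ v ∷ c ∷ e ∷ s ∷ a ∷ i ∷ i ∷ [])

-- A world: its row of the adjacency matrix and its label.
Block : Set
Block = List Bool × List (List Bool)

labelsText : List (List Bool) → List Symbol → List Symbol
labelsText []       S = S
labelsText (l ∷ ls) S = labelˢ ∷ bits l ++ labelsText ls S

blocksText : List Block → List Symbol → List Symbol
blocksText []                S = S
blocksText ((row , ls) ∷ bs) S = worldˢ ∷ bits row ++ labelsText ls (blocksText bs S)

text : ℕ → List Block → List Symbol → List Symbol
text zero    bs S = blocksText bs S
text (suc n) bs S = tick ∷ text n bs S

Rows : ℕ → List Block → Set
Rows n = All λ b → length (proj₁ b) ≡ n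

replace-s : ∀ {s′} → s ≡ s′ → st r x f g v c e s a i d ≡ st r x f g v c e s′ a i d
replace-s refl = refl

-- In continuation-passing style, the iterations of a loop compose.
infix 3 _⊢_⟿_

_⊢_⟿_ : Prog → Conf → Conf → Set
W ⊢ s ⟿ t = ∀ {u} → W ⊢ t ⇓ u → W ⊢ s ⇓ u

readsKripke : Reg → Heads → Bool
readsKripke _ h = isKripke (lookup h xT)

-- Successors and atoms

addSuccessor : Cell Symbol → Cell Symbol → Cell Symbol → Act Symbol
addSuccessor (` bit b) w v = putBit (isTrue v ∨ (isTrue w ∧ b)) right
addSuccessor _         _ _ = go stay

postBody postLoop post : Prog
postBody = ite (λ _ h → isWorld (lookup h xT))
  (rewind aT ⨾ act false λ r _ → r , idle [ xT ]≔ go right [ sT ]≔ go right [ aT ]≔ go right)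
  (act false λ r h → r , idle [ xT ]≔ go right [ aT ]≔ addSuccessor (lookup h xT) (lookup h sT) (lookup h aT))
postLoop = while readsKripke postBody
post = on xT (steer right) ⨾ postLoop ⨾ rewind xT ⨾ rewind sT ⨾ rewind aT ⨾ copy aT sT (just (bit false))

addRow : Bool → List Bool → List Bool → List Bool
addRow w = zipWith λ a b → a ∨ (w ∧ b)

successors : List Block → List Bool → List Bool → List Bool
successors ((row , _) ∷ bs) (w ∷ ws) acc = successors bs ws (addRow w acc row)
successors _                _        acc = acc

post-row : ∀ {w L S M N V} acc row → length acc ≡ length row →
  postLoop ⊢ st r (L ▸ bits row ++ S) f g v c e (M ▸ bit w ∷ N) (V ▸ bits acc) i d
           ⟿ st r ((bits row ʳ++ L) ▸ S) f g v c e (M ▸ bit w ∷ N) ((bits (addRow w acc row) ʳ++ V) ▸ []) i d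
post-row []        []        eq k = k
post-row (b ∷ acc) (_ ∷ row) eq k = loop refl (ite-false refl act) (post-row acc row (suc-injective eq) k)

-- After a complete row the head on the successors is behind their end, where writing has no effect.
-- Thus the digits of labels can be treated like edges.
post-digits : ∀ {L S V} l →
  postLoop ⊢ st r (L ▸ bits l ++ S) f g v c e s (V ▸ []) i d ⟿ st r ((bits l ʳ++ L) ▸ S) f g v c e s (V ▸ []) i d
post-digits []      k = k
post-digits (_ ∷ l) k = loop refl (ite-false refl act) (post-digits l k)

post-labels : ∀ {L S V} ls → ∃ λ L′ → L′ ʳ++ S ≡ L ʳ++ labelsText ls S ×
  (postLoop ⊢ st r (L ▸ labelsText ls S) f g v c e s (V ▸ []) i d ⟿ st r (L′ ▸ S) f g v c e s (V ▸ []) i d)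
post-labels []       = _ , refl , id
post-labels (l ∷ ls) =
  let (_ , eq , k) = post-labels ls
  in _ , trans eq (ʳ++-ʳ++ (bits l)) , λ d → loop refl (ite-false refl act) (post-digits l (k d))

rewound-right : ∀ t → rewound t ≡ rewound (shift right t)
rewound-right (◂ S)       = refl
rewound-right (L ▸ [])    = refl
rewound-right (L ▸ _ ∷ S) = refl

-- The hypotheses speak of `s` after the next move to the right and of `a` after rewinding. In this
-- form they cover both the start, with the heads on the markers, and the situation after a block.
post-blocks : ∀ {n L S M s a} bs ws acc → Rows n bs → length acc ≡ n → length ws ≡ length bs →
  shift right s ≡ (M ▸ bits ws) → rewound a ≡ (◂ bits acc) →
  ∃ λ L′ → ∃₂ λ s′ a′ → L′ ʳ++ S ≡ L ʳ++ blocksText bs S ×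
  rewound s′ ≡ rewound (M ▸ bits ws) × rewound a′ ≡ (◂ bits (successors bs ws acc)) ×
  (postLoop ⊢ st r (L ▸ blocksText bs S) f g v c e s a i d ⟿ st r (L′ ▸ S) f g v c e s′ a′ i d)
post-blocks [] [] acc rows len lens es ea = _ , _ , _ , refl , trans (rewound-right _) (cong rewound es) , ea , id
post-blocks {r = r} {f} {g} {v} {c} {e} {i = i} {d = d} {n = n} {L} {S} {M} {s} {a} 
            ((row , ls) ∷ bs) (w ∷ ws) acc (len′ ∷ rows) len lens es ea =
  let acc′ = addRow w acc row
      (_ , eq₁ , k₁) = post-labels ls
      (_ , _ , _ , eq₂ , es₂ , ea₂ , k₂) =
        post-blocks bs ws acc′ rows (trans (length-zipWith _ acc row) (trans (cong₂ _⊓_ len len′) (⊓-idem n)))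
                    (suc-injective lens) refl (cong ◂_ (there-and-back (bits acc′)))
  in _ , _ , _ , trans eq₂ (trans eq₁ (ʳ++-ʳ++ (bits row))) , es₂ , ea₂ ,
     λ k → loop refl (ite-true refl (rewind-run aT ⨾ act ⇒ first))
                (post-row acc row (trans len (sym len′)) (k₁ (k₂ k)))
  where
  first : st r (worldˢ ∷ L ▸ bits row ++ labelsText ls (blocksText bs S))
             f g v c e (shift right s) (shift right (rewound a)) i d
        ≡ st r (worldˢ ∷ L ▸ bits row ++ labelsText ls (blocksText bs S)) f g v c e (M ▸ bit w ∷ bits ws) ([] ▸ bits acc) i d
  first rewrite es | ea = refl

post-ticks : ∀ {L S} n bs → ∃ λ L′ → L′ ʳ++ blocksText bs S ≡ L ʳ++ text n bs S ×
  (postLoop ⊢ st r (L ▸ text n bs S) f g v c e s a i d ⟿ st r (L′ ▸ blocksText bs S) f g v c e s a i d)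
post-ticks zero    bs = _ , refl , id
post-ticks (suc n) bs =
  let (_ , eq , k) = post-ticks n bs
  in _ , eq , λ d → loop refl (ite-false refl act) (k d)

length-successors : ∀ {n} bs ws acc → Rows n bs → length acc ≡ n → length (successors bs ws acc) ≡ n
length-successors []       ws       acc rows         len = len
length-successors (b ∷ bs) []       acc rows         len = len
length-successors (b ∷ bs) (w ∷ ws) acc (len′ ∷ rows) len =
  length-successors bs ws _ rows (trans (length-zipWith _ acc (proj₁ b)) (trans (cong₂ _⊓_ len len′) (⊓-idem _)))

falses : ℕ → List Bool
falses n = replicate n false

eqBits : List Bool → List Bool → Bool
eqBits []       []       = true
eqBits []       (_ ∷ _)  = false
eqBits (_ ∷ _)  []       = false
eqBits (a ∷ as) (b ∷ bs) = not (a xor b) ∧ eqBits as bs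

has : Bool → List Bool → List (List Bool) → Bool
has p ds []       = p
has p ds (l ∷ ls) = has (p ∨ eqBits ds l) ds ls

-- Whether no world violates the atom, where w and p tell whether the last
-- world is in the set and has the proposition.
obeys : Bool → List Bool → Bool → Bool → Bool → List Block → List Bool → Bool
obeys q ds res w p ((_ , ls) ∷ bs) (w′ ∷ ws) = obeys q ds (res ∧ (not w ∨ not (q xor p))) w′ (has false ds ls) bs ws
obeys q ds res w p _               _         = res ∧ (not w ∨ not (q xor p))

isPos : Cell Symbol → Bool
isPos (` posˢ) = true
isPos _        = false

-- Whether the label of the current world has the proposition, provided that
-- all that remains of the current entry is its end.
seen : Reg → Cell Symbol → Bool
seen r y = Reg.found r ∨ (Reg.live r ∧ not (isBit y))

endWorld : Cell Symbol → Cell Symbol → Reg → Reg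
endWorld y w r = record r
  { res = Reg.res r ∧ (not (isTrue w) ∨ not (Reg.sign r xor seen r y)) ; found = false ; live = false }

startLabel : Reg → Cell Symbol → Reg × Act Symbol
startLabel r y = record r { found = seen r y ; live = true } , go left

sameBit : Bool → Cell Symbol → Bool
sameBit b y = isBit y ∧ not (isTrue y xor b)

compare : Cell Symbol → Cell Symbol → Reg → Reg × Act Symbol
compare (` bit b) y r = let m = Reg.live r ∧ sameBit b y in
                        record r { live = m } , (if m then go right else go stay)
compare _         y r = r , go stay

onBit : Reg → Cell Symbol → Bool
onBit _ y = isBit y

backToAtom checkBody checkLoop check : Prog
backToAtom = whileOn fT onBit (on fT (steer left))
checkBody = ite (λ _ h → isWorld (lookup h xT))
  (act false λ r h → endWorld (lookup h fT) (lookup h sT) r , idle [ xT ]≔ go right [ sT ]≔ go right)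
  (ite (λ _ h → isLabel (lookup h xT))
    (on fT startLabel ⨾ backToAtom ⨾ act false λ r _ → r , idle [ xT ]≔ go right [ fT ]≔ go right)
    (act false λ r h → let (r′ , m) = compare (lookup h xT) (lookup h fT) r in r′ , idle [ xT ]≔ go right [ fT ]≔ m))
checkLoop = while readsKripke checkBody
check = act false (λ r h → record r { sign = isPos (lookup h fT) ; res = true ; found = false ; live = false }
                         , idle [ xT ]≔ go right [ fT ]≔ go right) ⨾
        checkLoop ⨾
        act false (λ r h → endWorld (lookup h fT) (lookup h sT) r , idle [ fT ]≔ go left) ⨾
        backToAtom ⨾ rewind xT ⨾ rewind sT

headBit : List Symbol → Bool
headBit []      = false
headBit (y ∷ _) = isBit (` y)

top-end : ∀ (L : List Symbol) S → headBit S ≡ false → isBit (top (L ▸ S)) ≡ false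
top-end L []      _ = refl
top-end L (_ ∷ _) p = p

-- The tape f is on the digits ds of an atom, or at their end.
module Atom (L₀ : List Symbol) (h : Symbol) (ds : List Bool) (S₀ : List Symbol)
            (h-atom : isBit (` h) ≡ false) (end : headBit S₀ ≡ false) where

  InDigits : Zip Symbol → Set
  InDigits f = ∃₂ λ as bs → f ≡ ((bits as ++ h ∷ L₀) ▸ bits bs ++ S₀) × as ʳ++ bs ≡ ds

  atAtom atDigits : Zip Symbol
  atAtom   = L₀ ▸ h ∷ bits ds ++ S₀
  atDigits = h ∷ L₀ ▸ bits ds ++ S₀

  inDigits : InDigits atDigits
  inDigits = [] , ds , refl , refl

  back-run : ∀ {f} → InDigits f → backToAtom ⊢ st r x (shift left f) g v c e s a i d ⇓ st r x atAtom g v c e s a i d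
  back-run (as , bs , refl , eq) = from as bs eq
    where
    from : ∀ as bs → as ʳ++ bs ≡ ds →
      backToAtom ⊢ st r x (shift left ((bits as ++ h ∷ L₀) ▸ bits bs ++ S₀)) g v c e s a i d ⇓ st r x atAtom g v c e s a i d
    from []       bs refl = stop h-atom
    from (b ∷ as) bs eq   = loop refl act (from as (b ∷ bs) eq)

  digits-live : ∀ {L S q fl fo re si} as bs l → as ʳ++ bs ≡ ds → ∃₂ λ lv f′ → InDigits f′ ×
    lv ∧ not (isBit (top f′)) ≡ eqBits bs l ×
    (checkLoop ⊢ st (reg q fl true fo re si) (L ▸ bits l ++ S) ((bits as ++ h ∷ L₀) ▸ bits bs ++ S₀) g v c e s a i d
               ⟿ st (reg q fl lv fo re si) ((bits l ʳ++ L) ▸ S) f′ g v c e s a i d)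
  -- It serves two purposes: skipping the rest of an entry after a mismatch, and skipping the rows
  -- of the adjacency matrix, which are words of bits, too, and are read with `live` off.
  digits-dead : ∀ {L S q fl fo re si} l →
    checkLoop ⊢ st (reg q fl false fo re si) (L ▸ bits l ++ S) f g v c e s a i d
              ⟿ st (reg q fl false fo re si) ((bits l ʳ++ L) ▸ S) f g v c e s a i d

  digits-dead []      k = k
  digits-dead (_ ∷ l) k = loop refl (ite-false refl (ite-false refl act)) (digits-dead l k)

  digits-live as []      []      eq = true , _ , (as , [] , refl , eq) , cong not (top-end _ S₀ end) , id
  digits-live as (b ∷ bs) []     eq = true , _ , (as , b ∷ bs , refl , eq) , refl , id
  -- The entry is longer than the proposition of the atom. The mismatch is noticed because the
  -- symbol behind the atom is not a digit.
  digits-live {g} {v} {c} {e} {s} {a} {i} {d} {L} {S} {q} {fl} {fo} {re} {si} as [] (b ∷ l) eq =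
    false , _ , (as , [] , refl , eq) , refl ,
    λ k → loop refl (ite-false refl (ite-false refl act) ⇒ cong state mismatch) (digits-dead l k)
    where
    F : Zip Symbol
    F = (bits as ++ h ∷ L₀) ▸ S₀

    state : Bool → Conf
    state m = st (reg q fl m fo re si) (bit b ∷ L ▸ bits l ++ S) (perform false (if m then go right else go stay) F)
                 g v c e s a i d

    mismatch : sameBit b (top F) ≡ false
    mismatch rewrite top-end (bits as ++ h ∷ L₀) S₀ end = refl
  digits-live as (true ∷ bs) (false ∷ l) eq =
    false , _ , (as , true ∷ bs , refl , eq) , refl ,
    λ k → loop refl (ite-false refl (ite-false refl act)) (digits-dead l k)
  digits-live as (false ∷ bs) (true ∷ l) eq =
    false , _ , (as , false ∷ bs , refl , eq) , refl ,
    λ k → loop refl (ite-false refl (ite-false refl act)) (digits-dead l k)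
  digits-live as (true ∷ bs) (true ∷ l) eq =
    let (_ , _ , f , p , k′) = digits-live (true ∷ as) bs l eq
    in _ , _ , f , p , λ k → loop refl (ite-false refl (ite-false refl act)) (k′ k)
  digits-live as (false ∷ bs) (false ∷ l) eq =
    let (_ , _ , f , p , k′) = digits-live (false ∷ as) bs l eq
    in _ , _ , f , p , λ k → loop refl (ite-false refl (ite-false refl act)) (k′ k)

  -- An entry has no end symbol, so whether it equals the atom is settled only when the next symbol
  -- of the input is read. Until then the match is encoded in `live` together with the head being
  -- behind the digits of the atom.
  Pending : Bool → Bool → Bool → Zip Symbol → Set
  Pending p lv fo f = InDigits f × fo ∨ (lv ∧ not (isBit (top f))) ≡ p

  check-labels : ∀ {p L S f lv fo q fl re si} ls → Pending p lv fo f →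
    ∃₂ λ L′ f′ → ∃₂ λ lv′ fo′ → Pending (has p ds ls) lv′ fo′ f′ × L′ ʳ++ S ≡ L ʳ++ labelsText ls S ×
    (checkLoop ⊢ st (reg q fl lv fo re si) (L ▸ labelsText ls S) f g v c e s a i d
               ⟿ st (reg q fl lv′ fo′ re si) (L′ ▸ S) f′ g v c e s a i d)
  check-labels []       pd = _ , _ , _ , _ , pd , refl , id
  check-labels (l ∷ ls) (at , refl) =
    let (_ , _ , pos₁ , eq₁ , k₁) = digits-live [] ds l refl
        (_ , _ , _ , _ , pd₂ , eq₂ , k₂) = check-labels ls (pos₁ , cong (_ ∨_) eq₁)
    in _ , _ , _ , _ , pd₂ , trans eq₂ (ʳ++-ʳ++ (bits l)) ,
       λ k → loop refl (ite-false refl (ite-true refl (act ⨾ back-run at ⨾ act))) (k₁ (k₂ k))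

  check-blocks : ∀ {w p L M S s f lv fo q fl re si} bs ws → Pending p lv fo f → isTrue (top s) ≡ w →
    length ws ≡ length bs → shift right s ≡ (M ▸ bits ws) →
    ∃₂ λ L′ f′ → ∃₂ λ lv′ fo′ → ∃₂ λ re′ s′ → InDigits f′ × L′ ʳ++ S ≡ L ʳ++ blocksText bs S ×
    rewound s′ ≡ rewound (M ▸ bits ws) ×
    re′ ∧ (not (isTrue (top s′)) ∨ not (si xor (fo′ ∨ (lv′ ∧ not (isBit (top f′)))))) ≡ obeys si ds re w p bs ws ×
    (checkLoop ⊢ st (reg q fl lv fo re si) (L ▸ blocksText bs S) f g v c e s a i d
               ⟿ st (reg q fl lv′ fo′ re′ si) (L′ ▸ S) f′ g v c e s′ a i d)
  check-blocks [] [] (at , refl) refl lens es =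
    _ , _ , _ , _ , _ , _ , at , refl , trans (rewound-right _) (cong rewound es) , refl , id
  check-blocks {L = L} ((row , ls) ∷ bs) (w ∷ ws) (at , refl) refl lens es =
    let (_ , _ , _ , _ , pd₁ , eq₁ , k₁) = check-labels ls (at , refl)
        (_ , _ , _ , _ , _ , _ , pos₂ , eq₂ , es₂ , re₂ , k₂) = check-blocks bs ws pd₁ refl (suc-injective lens) refl
    in _ , _ , _ , _ , _ , _ , pos₂ , trans eq₂ (trans eq₁ (ʳ++-ʳ++ (bits row))) , es₂ , re₂ ,
       λ k → loop refl (ite-true refl act ⇒ replace-s es)
                  (digits-dead row (k₁ (k₂ k)))

  check-ticks : ∀ {L S} n bs → ∃ λ L′ → L′ ʳ++ blocksText bs S ≡ L ʳ++ text n bs S ×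
    (checkLoop ⊢ st r (L ▸ text n bs S) f g v c e s a i d ⟿ st r (L′ ▸ blocksText bs S) f g v c e s a i d)
  check-ticks zero    bs = _ , refl , id
  check-ticks (suc n) bs =
    let (_ , eq , k) = check-ticks n bs
    in _ , eq , λ d → loop refl (ite-false refl (ite-false refl act)) (k d)

module Text (k n : ℕ) (bs : List Block) (y : Symbol) (S : List Symbol)
            (rows : Rows n bs) (count : length bs ≡ n) (y-formula : isKripke (` y) ≡ false) where

  X₀ : Zip Symbol
  X₀ = ◂ text k bs (y ∷ S)

  Post : List Bool → List Bool
  Post ws = successors bs ws (falses n)

  length-Post : ∀ ws → length (Post ws) ≡ n
  length-Post ws = length-successors bs ws (falses n) rows (length-replicate n)

  post-run : ∀ ws → length ws ≡ n →
    post ⊢ st r X₀ f g v c e (◂ bits ws) (◂ bits (falses n)) i d ⇓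
           st r X₀ f g v c e (◂ bits (Post ws)) (◂ bits (falses n)) i d
  post-run ws len =
    let (_ , eq₁ , k₁) = post-ticks k bs
        (_ , _ , _ , eq₂ , es , ea , k₂) =
          post-blocks bs ws (falses n) rows (length-replicate n) (trans len (sym count)) refl refl
        final = cong₃ (cong ◂_ (trans eq₂ eq₁)) es ea
    in act ⨾ k₁ (k₂ (stop y-formula)) ⨾ rewind-run xT ⨾ rewind-run sT ⨾ (rewind-run aT ⇒ final) ⨾
       (move-successors lens ⇒ cong (λ z → st _ _ _ _ _ _ _ (◂ bits (Post ws)) (◂ z) _ _) zeros)
    where
    cong₃ : ∀ {x x′ s s′ a a′} → x ≡ x′ → s ≡ s′ → a ≡ a′ → st r x f g v c e s a i d ≡ st r x′ f g v c e s′ a′ i d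
    cong₃ refl refl refl = refl

    lens : length (bits (Post ws)) ≡ length (bits ws)
    lens = trans (length-map bit (Post ws)) (trans (length-Post ws) (trans (sym len) (sym (length-map bit ws))))

    zeros : replicate (length (bits (Post ws))) (bit false) ≡ bits (falses n)
    zeros = trans (cong (λ m → replicate m (bit false)) (trans (length-map bit (Post ws)) (length-Post ws)))
                  (sym (map-replicate bit n false))

  -- The first `worldˢ` triggers the judgement of a world that does not exist. The head on the set
  -- of worlds is then on the marker, which counts as `false`, so this judgement is vacuous; hence
  -- the initial values `true false false`.
  check-run : ∀ {L h Z q fl lv fo re si} ds ws → length ws ≡ n → isBit (` h) ≡ false → headBit Z ≡ false →
    check ⊢ st (reg q fl lv fo re si) X₀ (L ▸ h ∷ bits ds ++ Z) g v c e (◂ bits ws) a i d ⇓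
            st (reg q fl false false (obeys (isPos (` h)) ds true false false bs ws) (isPos (` h)))
               X₀ (L ▸ h ∷ bits ds ++ Z) g v c e (◂ bits ws) a i d
  check-run {L = L} {h} {Z} ds ws len h-atom end =
    let open Atom L h ds Z h-atom end
        (_ , eq₁ , k₁) = check-ticks k bs
        (_ , _ , _ , _ , _ , _ , at , eq₂ , es , re , k₂) =
          check-blocks bs ws (inDigits , refl) refl (trans len (sym count)) refl
    in act ⨾ k₁ (k₂ (stop y-formula)) ⨾ act ⨾ back-run at ⨾ rewind-run xT ⨾ rewind-run sT
       ⇒ cong₃ re (cong ◂_ (trans eq₂ eq₁)) es
    where
    cong₃ : ∀ {q fl si re re′ x x′ s s′} → re ≡ re′ → x ≡ x′ → s ≡ s′ →
            st (reg q fl false false re si) x f g v c e s a i d ≡ st (reg q fl false false re′ si) x′ f g v c e s′ a i d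
    cong₃ refl refl refl = refl

-- Sweeps and passes

val : List Bool → ℕ
val []           = 0
val (true ∷ bs)  = suc (2 * val bs)
val (false ∷ bs) = 2 * val bs

trues : ℕ → List Bool
trues n = replicate n true

length-pred₂ : ∀ bs → length (pred₂ bs) ≡ length bs
length-pred₂ []           = refl
length-pred₂ (true ∷ bs)  = refl
length-pred₂ (false ∷ bs) = cong suc (length-pred₂ bs)

pred-zero : ∀ bs → val bs ≡ 0 → pred? bs ≡ false × pred₂ bs ≡ trues (length bs)
pred-zero []           eq = refl , refl
pred-zero (false ∷ bs) eq = let (p , q) = pred-zero bs (m+n≡0⇒m≡0 _ eq) in p , cong (true ∷_) q

pred-suc : ∀ bs {m} → val bs ≡ suc m → pred? bs ≡ true × val (pred₂ bs) ≡ m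
pred-suc (true ∷ bs) eq = refl , suc-injective eq
pred-suc (false ∷ bs) {m} eq with val bs in eq′
... | suc l = let (p , q) = pred-suc bs eq′
              in p , trans (cong (λ j → suc (2 * j)) q) (trans (sym (+-suc l (l + 0))) (suc-injective eq))

val-trues : ∀ n → suc (val (trues n)) ≡ 2 ^ n
val-trues zero    = refl
val-trues (suc n) = trans (cong suc (sym (+-suc (val (trues n)) _))) (cong (2 *_) (val-trues n))

flagged : Reg → Heads → Bool
flagged r _ = Reg.flag r

replayLoop replay : Prog
replayLoop = while flagged (post ⨾ decrement eT)
replay = copy cT eT nothing ⨾ copy iT sT nothing ⨾ decrement eT ⨾ replayLoop

length-bits : ∀ as bs → length as ≡ length bs → length (bits as) ≡ length (bits bs)
length-bits as bs eq = trans (length-map bit as) (trans eq (sym (length-map bit bs)))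

module Run (k n : ℕ) (bs : List Block) (y : Symbol) (Y : List Symbol)
           (rows : Rows n bs) (count : length bs ≡ n) (y-formula : isKripke (` y) ≡ false)
           (ws₀ : List Bool) (length-ws₀ : length ws₀ ≡ n) where

  open Text k n bs y Y rows count y-formula

  zeros : Zip Symbol
  zeros = ◂ bits (falses n)

  after : ℕ → List Bool → List Bool
  after zero    ws = ws
  after (suc m) ws = after m (Post ws)

  length-after : ∀ m ws → length ws ≡ n → length (after m ws) ≡ n
  length-after zero    ws eq = eq
  length-after (suc m) ws eq = length-after m (Post ws) (length-Post ws)

  worlds : ℕ → List Bool
  worlds m = after m ws₀

  length-worlds : ∀ m → length (worlds m) ≡ n
  length-worlds m = length-after m ws₀ length-ws₀

  worlds-suc : ∀ m → worlds (suc m) ≡ Post (worlds m)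
  worlds-suc m = commute m ws₀
    where
    commute : ∀ m ws → after m (Post ws) ≡ Post (after m ws)
    commute zero    ws = refl
    commute (suc m) ws = commute m (Post ws)

  -- The last decrement wraps the counter around, so only its length is recorded. The next replay
  -- overwrites it and needs no more.
  replay-loop : ∀ m es ws → val es ≡ m → length ws ≡ n → ∃ λ es′ → length es′ ≡ length es ×
    (replayLoop ⊢ st (setFlag (pred? es) r) X₀ f g v c (◂ bits (pred₂ es)) (◂ bits ws) zeros i d
                ⇓ st (setFlag false r) X₀ f g v c (◂ bits es′) (◂ bits (after m ws)) zeros i d)
  replay-loop {r = r} zero es ws eq len with pred? es | pred-zero es eq
  ... | false | refl , _ = _ , length-pred₂ es , stop refl
  replay-loop {r = r} (suc m) es ws eq len with pred? es | pred-suc es eq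
  ... | true | refl , eq′ =
    let (_ , len′ , w) = replay-loop {r = r} m (pred₂ es) (Post ws) eq′ (length-Post ws)
    in _ , trans len′ (length-pred₂ es) , loop refl (post-run ws len ⨾ decrement-counter (pred₂ es)) w

  replay-run : ∀ cs es ws → length cs ≡ length es → length ws ≡ n → ∃ λ es′ → length es′ ≡ length cs ×
    (replay ⊢ st r X₀ f g v (◂ bits cs) (◂ bits es) (◂ bits ws) zeros (◂ bits ws₀) d
            ⇓ st (setFlag false r) X₀ f g v (◂ bits cs) (◂ bits es′) (◂ bits (worlds (val cs))) zeros (◂ bits ws₀) d)
  replay-run {r = r} cs es ws len len′ =
    let (_ , len″ , w) = replay-loop {r = r} (val cs) cs ws₀ refl length-ws₀
    in _ , len″ , copy-time (length-bits cs es len) ⨾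
                  copy-initial (length-bits ws₀ ws (trans length-ws₀ (sym len′))) ⨾
                  decrement-counter cs ⨾ w

isAtom isNext : Cell Symbol → Bool
isAtom (` posˢ) = true
isAtom (` negˢ) = true
isAtom _        = false

isNext (` Xˢ) = true
isNext _      = false

-- The expansion laws of until and release, where `g` is the value of the formula itself at the next
-- time.
connective : Cell Symbol → Bool → Bool → Bool → Bool
connective (` ∧ˢ) a b g = a ∧ b
connective (` Uˢ) a b g = b ∨ (a ∧ g)
connective (` Rˢ) a b g = b ∧ (a ∨ g)
connective _      a b g = false

isOpen : Reg → Heads → Bool
isOpen _ h = not (isMarker (lookup h fT)) ∧ not (isTick (lookup h gT))

unfinished : Reg → Heads → Bool
unfinished _ h = not (isEnd (lookup h fT))

both : Move → Prog
both m = act false λ r _ → r , idle [ fT ]≔ go m [ gT ]≔ go m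

-- Reading from right to left leaves the value of the first operand on top of the stack. The
-- register `sign` holds it while the head moves on to the second. A next operator swaps: it pushes
-- the value kept from the next time and keeps the value of its operand at the current time.
cell sweepLoop sweep : Prog
cell =
  ite (λ _ h → isBit (lookup h fT)) (act false λ r _ → r , idle) (
  ite (λ _ h → isAtom (lookup h fT)) (check ⨾ act false λ r _ → r , idle [ vT ]≔ putBit (Reg.res r) right) (
  on vT (steer left) ⨾
  ite (λ _ h → isNext (lookup h fT))
    (act false λ r h → r , idle [ vT ]≔ (symbol (lookup h gT) , right) [ gT ]≔ (symbol (lookup h vT) , stay))
    (act false (λ r h → record r { sign = isTrue (lookup h vT) } , idle [ vT ]≔ go left) ⨾
     act false (λ r h → let w = connective (lookup h fT) (Reg.sign r) (isTrue (lookup h vT)) (isTrue (lookup h gT))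
                        in r , idle [ vT ]≔ putBit w right [ gT ]≔ putBit w stay))))
sweepLoop = while isOpen (cell ⨾ both left)
sweep = while unfinished (both right) ⨾ rewind vT ⨾ on vT (steer right) ⨾ both left ⨾ sweepLoop

data IsAtom : Symbol → Set where
  posˢ : IsAtom posˢ
  negˢ : IsAtom negˢ

data IsConnective : Symbol → Set where
  ∧ˢ : IsConnective ∧ˢ
  Uˢ : IsConnective Uˢ
  Rˢ : IsConnective Rˢ

module Sweep (truth : Symbol → List Bool → Bool) where

  -- Update y s vs g g′ vs′: at a symbol y in front of s, a sweep replaces the
  -- stack vs by vs′, and the value g kept from the next time by g′.
  data Update : Symbol → List Symbol → List Bool → Bool → Bool → List Bool → Set where
    bit    : ∀ {b s vs g} → Update (bit b) s vs g g vs
    atom   : ∀ {h ds s vs g} → IsAtom h → headBit s ≡ false → Update h (bits ds ++ s) vs g g (truth h ds ∷ vs)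
    next   : ∀ {s a vs g} → Update Xˢ s (a ∷ vs) g a (g ∷ vs)
    binary : ∀ {y s a b vs g} → IsConnective y → let w = connective (` y) a b g in
             Update y s (a ∷ b ∷ vs) g w (w ∷ vs)

  length-update : ∀ {y s vs g g′ vs′} → Update y s vs g g′ vs′ → length vs′ ≤ suc (length vs)
  length-update bit        = n≤1+n _
  length-update (atom _ _) = ≤-refl
  length-update next       = n≤1+n _
  length-update (binary _) = ≤-trans (n≤1+n _) (n≤1+n _)

  data Updates : List Symbol → List Bool → List Bool → List Bool → Set where
    []  : Updates [] [] [] []
    _∷_ : ∀ {y s gs gs′ vs g g′ vs′} → Update y s vs g g′ vs′ → Updates s gs gs′ vs →
          Updates (y ∷ s) (g ∷ gs) (g′ ∷ gs′) vs′

  length-kept : ∀ {s gs gs′ vs} → Updates s gs gs′ vs → length s ≡ length gs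
  length-kept []       = refl
  length-kept (_ ∷ us) = cong suc (length-kept us)

  -- A symbol pushes at most one value net, so a stack tape as long as the formula always has room.
  -- This matters because a push at the right end of the content would be lost.
  length-updates : ∀ {s gs gs′ vs} → Updates s gs gs′ vs → length vs ≤ length s
  length-updates []       = z≤n
  length-updates (u ∷ us) = ≤-trans (length-update u) (s≤s (length-updates us))

replace-v : ∀ {v′} → v ≡ v′ → st r x f g v c e s a i d ≡ st r x f g v′ c e s a i d
replace-v refl = refl

replace-g : ∀ {g′} → g ≡ g′ → st r x f g v c e s a i d ≡ st r x f g′ v c e s a i d
replace-g refl = refl

replicate-ʳ++ : ∀ {A : Set} {y : A} m l → replicate m y ʳ++ replicate l y ≡ replicate (m + l) y
replicate-ʳ++         zero    l = refl
replicate-ʳ++ {y = y} (suc m) l = trans (replicate-ʳ++ m (suc l)) (cong (λ j → replicate j y) (+-suc m l))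

content : ∀ t → ∃ λ J → rewound t ≡ (◂ J) × length J ≡ width t
content (◂ S)   = S , refl , refl
content (L ▸ S) = L ʳ++ S , refl , length-ʳ++ L

-- The position in front of the part s of a formula that already has truth
-- values ns, where L is the rest of the formula.
standF : List Symbol → List Symbol → Zip Symbol
standF L s = shift left (L ▸ s)

standG : List Symbol → List Bool → Zip Symbol
standG L ns = shift left (replicate (length L) tick ▸ bits ns)

to-end : ∀ {L M} s ns → length s ≡ length ns → while unfinished (both right) ⊢
  st r x (L ▸ s) (M ▸ ns) v c e f a i d ⇓ st r x ((s ʳ++ L) ▸ []) ((ns ʳ++ M) ▸ []) v c e f a i d
to-end []      []       eq = stop refl
to-end (_ ∷ s) (_ ∷ ns) eq = loop refl act (to-end s ns (suc-injective eq))

stand-to-end : ∀ L s ns → length s ≡ length ns → while unfinished (both right) ⊢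
  st r x (standF L s) (standG L ns) v c e f a i d
  ⇓ st r x ((s ʳ++ L) ▸ []) ((bits ns ʳ++ replicate (length L) tick) ▸ []) v c e f a i d
stand-to-end []      s ns eq = loop refl act (to-end s (bits ns) (trans eq (sym (length-map bit ns))))
stand-to-end (l ∷ L) s ns eq = to-end (l ∷ s) (tick ∷ bits ns) (cong suc (trans eq (sym (length-map bit ns))))

stand-closed : ∀ L s ns → sweepLoop ⊢ st r x (standF L s) (standG L ns) v c e f a i d
                                    ⇓ st r x (standF L s) (standG L ns) v c e f a i d
stand-closed []      s ns = stop refl
stand-closed (_ ∷ L) s ns = stop refl

-- The counter `d` starts a pass at 2^n - 1, and the loop ends when decrementing finds 0. That makes
-- 2^n sweeps, and the wrap-around of the final decrement restores `d` for the next pass. In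
-- `lastLoop` the clock is decremented after the sweep, so that time 0 is included.
passLoop lastLoop : Prog
passLoop = while flagged (decrement cT ⨾ (replay ⨾ sweep) ⨾ decrement dT)
lastLoop = while flagged ((replay ⨾ sweep) ⨾ decrement cT)

-- A release is a greatest fixed point and is approached from `true`; an until is a least one and is
-- approached from `false`.
initially : Cell Symbol → Bool
initially (` Rˢ) = true
initially _      = false

standing : Reg → Heads → Bool
standing _ h = not (isMarker (lookup h fT))

activate passes answer core : Prog
activate = act false λ r h → setFlag true r , idle [ fT ]≔ go left [ gT ]≔ putBit (initially (lookup h fT)) left
passes   = while standing (activate ⨾ passLoop)
answer   = on vT (steer left) ⨾ on vT λ r y → record r { res = isTrue y } , go stay
core     = while unfinished (both right) ⨾ both left ⨾ passes ⨾ decrement cT ⨾ lastLoop ⨾ answer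

module Passes (k n : ℕ) (bs : List Block) (y : Symbol) (Y : List Symbol)
              (rows : Rows n bs) (count : length bs ≡ n) (y-formula : isKripke (` y) ≡ false)
              (ws₀ : List Bool) (length-ws₀ : length ws₀ ≡ n) where

  open Text k n bs y Y rows count y-formula
  open Run k n bs y Y rows count y-formula ws₀ length-ws₀

  Truth : List Bool → Symbol → List Bool → Bool
  Truth ws h ds = obeys (isPos (` h)) ds true false false bs ws

  module _ (ws : List Bool) (length-ws : length ws ≡ n) where

    open Sweep (Truth ws)

    cell-run : ∀ {y s gs vs g g′ vs′ L M J} → Update y s vs g g′ vs′ → 1 ≤ length J → ∃₂ λ r′ J′ →
      Reg.flag r′ ≡ Reg.flag r × length vs′ + length J′ ≡ length vs + length J ×
      (cell ⊢ st r X₀ (L ▸ y ∷ s) (M ▸ bit g ∷ gs) (bits vs ▸ J) c e (◂ bits ws) a i d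
            ⇓ st r′ X₀ (L ▸ y ∷ s) (M ▸ bit g′ ∷ gs) (bits vs′ ▸ J′) c e (◂ bits ws) a i d)
    cell-run bit _ = _ , _ , refl , refl , ite-true refl act
    cell-run {vs = vs} {J = _ ∷ J} (atom {ds = ds} posˢ end) _ =
      _ , J , refl , sym (+-suc (length vs) _) ,
      ite-false refl (ite-true refl (check-run ds ws length-ws refl end ⨾ act))
    cell-run {vs = vs} {J = _ ∷ J} (atom {ds = ds} negˢ end) _ =
      _ , J , refl , sym (+-suc (length vs) _) ,
      ite-false refl (ite-true refl (check-run ds ws length-ws refl end ⨾ act))
    cell-run next _ = _ , _ , refl , refl , ite-false refl (ite-false refl (act ⨾ ite-true refl act))
    cell-run {vs = _ ∷ _ ∷ vs} (binary ∧ˢ) _ = _ , _ , refl , cong suc (+-suc (length vs) _) ,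
      ite-false refl (ite-false refl (act ⨾ ite-false refl (act ⨾ act)))
    cell-run {vs = _ ∷ _ ∷ vs} (binary Uˢ) _ = _ , _ , refl , cong suc (+-suc (length vs) _) ,
      ite-false refl (ite-false refl (act ⨾ ite-false refl (act ⨾ act)))
    cell-run {vs = _ ∷ _ ∷ vs} (binary Rˢ) _ = _ , _ , refl , cong suc (+-suc (length vs) _) ,
      ite-false refl (ite-false refl (act ⨾ ite-false refl (act ⨾ act)))

    sweep-cells : ∀ {s gs gs′ vs} L M J → Updates s gs gs′ vs → length s ≤ length J → ∃₂ λ r′ J′ →
      Reg.flag r′ ≡ Reg.flag r × length vs + length J′ ≡ length J ×
      (sweepLoop ⊢ st r X₀ (shift left ((s ʳ++ L) ▸ [])) (shift left ((bits gs ʳ++ M) ▸ [])) ([] ▸ J) c e (◂ bits ws) a i d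
                 ⟿ st r′ X₀ (shift left (L ▸ s)) (shift left (M ▸ bits gs′)) (bits vs ▸ J′) c e (◂ bits ws) a i d)
    sweep-cells L M J []       _   = _ , J , refl , refl , id
    sweep-cells {s = y ∷ s} {g ∷ gs} L M J (u ∷ us) len =
      let (_ , J₁ , eq₁ , len₁ , k₁) = sweep-cells (y ∷ L) (bit g ∷ M) J us (≤-trans (n≤1+n _) len)
          (_ , J₂ , eq₂ , len₂ , k₂) = cell-run u (room J₁ len₁ us)
      in _ , J₂ , trans eq₂ eq₁ , trans len₂ len₁ , λ w → k₁ (loop refl (k₂ ⨾ act) w)
      where
      room : ∀ {vs gs′} J₁ → length vs + length J₁ ≡ length J → Updates s gs gs′ vs → 1 ≤ length J₁
      room {vs} J₁ eq us = +-cancelˡ-≤ (length s) 1 (length J₁)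
        (≤-trans (≤-reflexive (+-comm (length s) 1)) (≤-trans len (≤-trans (≤-reflexive (sym eq))
          (+-monoˡ-≤ (length J₁) (length-updates us)))))

    sweep-run : ∀ {s gs gs′ vs} L v → Updates s gs gs′ vs → length s ≤ width v → ∃₂ λ r′ J →
      Reg.flag r′ ≡ Reg.flag r × length vs + length J ≡ width v ×
      (sweep ⊢ st r X₀ (standF L s) (standG L gs) v c e (◂ bits ws) a i d
             ⇓ st r′ X₀ (standF L s) (standG L gs′) (bits vs ▸ J) c e (◂ bits ws) a i d)
    sweep-run {s = s} {gs} {gs′} L v us len =
      let (J , eq , len-J) = content v
          (_ , J′ , eq-flag , eq-len , w) =
            sweep-cells L (replicate (length L) tick) J us (≤-trans len (≤-reflexive (sym len-J)))
      in _ , J′ , eq-flag , trans eq-len len-J ,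
         stand-to-end L s gs (length-kept us) ⨾ rewind-run vT ⨾ act ⨾
         (act ⇒ replace-v (cong (shift right) eq)) ⨾ w (stand-closed L s gs′)
  open Sweep using (Updates)

  -- A configuration between two sweeps.
  data Stand (b : Bool) (L s : List Symbol) (ns cs ds : List Bool) (v : Zip Symbol) : Conf → Set where
    stand : ∀ {r es ws} → Reg.flag r ≡ b → length cs ≡ length es → length ws ≡ n →
            Stand b L s ns cs ds v (st r X₀ (standF L s) (standG L ns) v (◂ bits cs) (◂ bits es) (◂ bits ws)
                                       zeros (◂ bits ws₀) (◂ bits ds))

  private variable
    b : Bool
    L s′ : List Symbol
    ns cs ds : List Bool
    σ : Conf

  Leads : Prog → Conf → (Conf → Set) → Set
  Leads P σ Q = ∃ λ τ → P ⊢ σ ⇓ τ × Q τ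

  tick-time : Stand b L s′ ns cs ds v σ → Leads (decrement cT) σ (Stand (pred? cs) L s′ ns (pred₂ cs) ds v)
  tick-time {cs = cs} (stand _ eq len) = _ , decrement-time cs , stand refl (trans (length-pred₂ cs) eq) len

  tick-pass : Stand b L s′ ns cs ds v σ → Leads (decrement dT) σ (Stand (pred? ds) L s′ ns cs (pred₂ ds) v)
  tick-pass {ds = ds} (stand _ eq len) = _ , decrement-pass ds , stand refl eq len

  update : ∀ {ns′ vs t} → Stand b L s′ ns cs ds v σ → val cs ≡ t → Updates (Truth (worlds t)) s′ ns ns′ vs →
    length s′ ≤ width v → ∃ λ J → length vs + length J ≡ width v ×
    Leads (replay ⨾ sweep) σ (Stand false L s′ ns′ cs ds (bits vs ▸ J))
  update {L = L} {cs = cs} {v = v} (stand {r} {es} {ws} _ eq len) refl us room =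
    let (_ , eq′ , d) = replay-run cs es ws eq len
        (_ , J , fl , len-J , d′) = sweep-run (worlds (val cs)) (length-worlds (val cs)) {r = setFlag false r} L v us room
    in J , len-J , _ , (d ⨾ d′) , stand fl (sym eq′) (length-worlds (val cs))

  width-stack : ∀ vs {J} → width (bits vs ▸ J) ≡ length vs + length J
  width-stack vs = cong (_+ _) (length-map bit vs)

  convert : ∀ {b′ ns′ ds′} → b ≡ b′ → ns ≡ ns′ → ds ≡ ds′ →
            Stand b L s′ ns cs ds v σ → Stand b′ L s′ ns′ cs ds′ v σ
  convert refl refl refl s = s

  flagged-stand : Stand b L s′ ns cs ds v σ → holds flagged σ ≡ b
  flagged-stand (stand eq _ _) = eq

  -- A pass of suc m sweeps, where kept j t are the values kept at time t after j of them.
  pass-run : ∀ (kept : ℕ → ℕ → List Bool) →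
    (∀ j t → ∃ λ vs → Updates (Truth (worlds t)) s′ (kept j (suc t)) (kept (suc j) t) vs) →
    ∀ m j t {cs ds v σ} → val ds ≡ m → val cs ≡ suc m + t → length s′ ≤ width v →
    Stand true L s′ (kept j (suc m + t)) cs ds v σ →
    ∃₂ λ cs′ v′ → val cs′ ≡ t × length cs′ ≡ length cs × width v′ ≡ width v ×
    Leads passLoop σ (Stand false L s′ (kept (suc m + j) t) cs′ (trues (length ds)) v′)
  pass-run kept ups zero j t {cs} {ds} vd vc room s₀ =
    let (_ , d₁ , s₁) = tick-time s₀
        (vs , us) = ups j t
        (J , len-J , _ , d₂ , s₂) = update s₁ (proj₂ (pred-suc cs vc)) us room
        (_ , d₃ , s₃) = tick-pass s₂
        (p , q) = pred-zero ds vd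
        s₄ = convert p refl q s₃
    in _ , _ , proj₂ (pred-suc cs vc) , length-pred₂ cs , trans (width-stack vs {J}) len-J , _ ,
       loop (flagged-stand s₀) (d₁ ⨾ d₂ ⨾ d₃) (stop (flagged-stand s₄)) , s₄
  pass-run kept ups (suc m) j t {cs} {ds} vd vc room s₀ =
    let (_ , d₁ , s₁) = tick-time s₀
        (vs , us) = ups j (suc m + t)
        (J , len-J , _ , d₂ , s₂) = update s₁ (proj₂ (pred-suc cs vc)) us room
        (_ , d₃ , s₃) = tick-pass s₂
        (p , q) = pred-suc ds vd
        w = trans (width-stack vs {J}) len-J
        (cs′ , _ , vc′ , len-cs , w′ , _ , d₄ , s₄) =
          pass-run kept ups m (suc j) t q (proj₂ (pred-suc cs vc)) (≤-trans room (≤-reflexive (sym w)))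
                   (convert p refl refl s₃)
    in cs′ , _ , vc′ , trans len-cs (length-pred₂ cs) , trans w′ w , _ ,
       loop (flagged-stand s₀) (d₁ ⨾ d₂ ⨾ d₃) d₄ ,
       convert refl (cong (λ l → kept (suc l) t) (+-suc m j)) (cong trues (length-pred₂ ds)) s₄

  -- When all symbols are exact, `kept` no longer depends on the number of sweeps, and each sweep
  -- carries exactness one step back in time.
  last-run : ∀ (kept vals : ℕ → List Bool) → (∀ t → Updates (Truth (worlds t)) s′ (kept (suc t)) (kept t) (vals t)) →
    ∀ t {cs v σ} → val cs ≡ suc t → length s′ ≤ width v → Stand (pred? cs) L s′ (kept (suc t)) (pred₂ cs) ds v σ →
    ∃₂ λ cs′ J → Leads lastLoop σ (Stand false L s′ (kept 0) cs′ ds (bits (vals 0) ▸ J))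
  last-run kept vals us t {cs} vc room s₀ with pred-suc cs vc
  last-run kept vals us zero {cs} vc room s₀ | p , q =
    let (J , len-J , _ , d₁ , s₁) = update s₀ q (us 0) room
        (_ , d₂ , s₂) = tick-time s₁
        s₃ = convert (proj₁ (pred-zero (pred₂ cs) q)) refl refl s₂
    in _ , J , _ , loop (trans (flagged-stand s₀) p) (d₁ ⨾ d₂) (stop (flagged-stand s₃)) , s₃
  last-run kept vals us (suc t) vc room s₀ | p , q =
    let (J , len-J , _ , d₁ , s₁) = update s₀ q (us (suc t)) room
        (_ , d₂ , s₂) = tick-time s₁
        (cs′ , J′ , _ , d₃ , s₃) = last-run kept vals us t q
          (≤-trans room (≤-reflexive (sym (trans (width-stack (vals (suc t)) {J}) len-J)))) s₂
    in cs′ , J′ , _ , loop (trans (flagged-stand s₀) p) (d₁ ⨾ d₂) d₃ , s₃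

  -- The number 2 ^ n of sweeps in a pass.
  H : ℕ
  H = suc (val (trues n))

  -- u is the value kept for a symbol, app j its approximation after j sweeps.
  record Symbolic (c : Symbol) (s : List Symbol) (vs : ℕ → List Bool) (u : ℕ → Bool) (vs′ : ℕ → List Bool) : Set where
    field
      app       : ℕ → ℕ → Bool
      app-zero  : ∀ t → initially (` c) ≡ app 0 t
      app-step  : ∀ j t → ∃ λ vs″ → Sweep.Update (Truth (worlds t)) c s (vs t) (app j (suc t)) (app (suc j) t) vs″
      app-final : ∀ t → app H t ≡ u t
      step      : ∀ t → Sweep.Update (Truth (worlds t)) c s (vs t) (u (suc t)) (u t) (vs′ t)

  data Meaning : List Symbol → (ℕ → List Bool) → (ℕ → List Bool) → Set where
    []  : Meaning [] (λ _ → []) (λ _ → [])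
    _∷_ : ∀ {c s gs vs u vs′} → Symbolic c s vs u vs′ → Meaning s gs vs → Meaning (c ∷ s) (λ t → u t ∷ gs t) vs′

  exact : ∀ {gs vs} → Meaning s′ gs vs → ∀ t → Updates (Truth (worlds t)) s′ (gs (suc t)) (gs t) (vs t)
  exact []      t = Sweep.[]
  exact (c ∷ μ) t = Symbolic.step c t Sweep.∷ exact μ t

  start-pass : ∀ {c} → Stand b (c ∷ L) s′ ns cs ds v σ → holds standing σ ≡ true ×
    Leads activate σ (Stand true L (c ∷ s′) (initially (` c) ∷ ns) cs ds v)
  start-pass (stand eq len len′) = refl , _ , act , stand refl len len′

  -- Activation goes from right to left, so the passes of the tail precede the pass of the head
  -- symbol. Each symbol uses up `H` units of the clock; its pass may rely on `exact` for everything
  -- behind it.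
  passes-run : ∀ {gs vs} → Meaning s′ gs vs → ∀ L t {b cs v σ} → val cs ≡ length s′ * H + t → length s′ ≤ width v →
    Stand b (s′ ʳ++ L) [] [] cs (trues n) v σ →
    ∃₂ λ b′ cs′ → ∃₂ λ v′ τ → val cs′ ≡ t × width v′ ≡ width v ×
    Stand b′ L s′ (gs t) cs′ (trues n) v′ τ × (passes ⊢ σ ⟿ τ)
  passes-run [] L t vc room s₀ = _ , _ , _ , _ , vc , refl , s₀ , id
  passes-run (_∷_ {c} {s} {gs} {u = u} κ μ) L t vc room s₀ =
    let open Symbolic κ
        (_ , _ , _ , _ , vc₁ , w₁ , s₁ , k) =
          passes-run μ (c ∷ L) (H + t) 
                     (trans vc (trans (cong (_+ t) (+-comm H (length s * H))) (+-assoc (length s * H) H t)))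
                     (≤-trans (n≤1+n _) room) s₀
        (open? , _ , d₂ , s₂) = start-pass s₁
        (_ , _ , vc₃ , _ , w₃ , _ , d₃ , s₃) =
          pass-run (λ j t → app j t ∷ gs t) (λ j t → _ , proj₂ (app-step j t) Sweep.∷ exact μ t)
                   (val (trues n)) 0 t refl vc₁ (≤-trans room (≤-reflexive (sym w₁)))
                   (convert refl (cong (_∷ gs (H + t)) (app-zero (H + t))) refl s₂)
    in _ , _ , _ , _ , vc₃ , trans w₃ w₁ ,
       convert refl (cong (_∷ gs t) (trans (cong (λ j → app (suc j) t) (+-identityʳ (val (trues n)))) (app-final t)))
               (cong trues (length-replicate n)) s₃ ,
       λ w → k (loop open? (d₂ ⨾ d₃) w)

  stopped : Stand b [] s′ ns cs ds v σ → holds standing σ ≡ false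
  stopped (stand _ _ _) = refl

  answered : ∀ {b w vs J} → Stand b L s′ ns cs ds (bits (w ∷ vs) ▸ J) σ → Leads answer σ (λ τ → Reg.res (proj₁ τ) ≡ w)
  answered (stand _ _ _) = _ , (act ⨾ act) , refl

  -- The clock has to be positive after all passes, hence `suc t`: `lastLoop` must still make a
  -- sweep at time 0, which leaves the value of the formula on the stack.
  core-run : ∀ {gs vs w ws′ es ws t} → Meaning s′ gs vs → vs 0 ≡ w ∷ ws′ →
    val cs ≡ length s′ * H + suc t → length cs ≡ length es → length ws ≡ n → length s′ ≤ width v →
    Leads core (st r X₀ (◂ s′) (◂ replicate (length s′) tick) v (◂ bits cs) (◂ bits es) (◂ bits ws)
                   zeros (◂ bits ws₀) (◂ bits (trues n)))
               (λ τ → Reg.res (proj₁ τ) ≡ w)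
  core-run {s′ = s′} {gs = gs} {vs} {t = t} μ eq vc len len′ room =
    let (_ , _ , _ , _ , vc₁ , w₁ , s₁ , k) = passes-run μ [] (suc t) vc room (stand refl len len′)
        (_ , d₂ , s₂) = tick-time s₁
        (_ , J , _ , d₃ , s₃) = last-run gs vs (exact μ) t vc₁ (≤-trans room (≤-reflexive (sym w₁))) s₂
        (_ , d₄ , res) = answered (convert-v (cong (λ vs → bits vs ▸ J) eq) s₃)
    in _ , (loop refl act (to-end s′ _ (sym (length-replicate (length s′)))) ⨾ (act ⇒ replace-g ticks) ⨾
            k (stop (stopped s₁)) ⨾ d₂ ⨾ d₃ ⨾ d₄) , res
    where
    ticks : shift left ((replicate (length s′) tick ʳ++ []) ▸ []) ≡ standG (s′ ʳ++ []) []
    ticks = cong (λ L → shift left (L ▸ [])) (trans (replicate-ʳ++ (length s′) 0)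
              (cong (λ m → replicate m tick) (sym (length-ʳ++ s′))))

    convert-v : ∀ {v′} → v ≡ v′ → Stand b L s′ ns cs ds v σ → Stand b L s′ ns cs ds v′ σ
    convert-v refl s = s

-- Validation of the input

opens formulaic : Symbol → Bool
opens posˢ = true
opens negˢ = true
opens ∧ˢ   = true
opens Xˢ   = true
opens Uˢ   = true
opens Rˢ   = true
opens _    = false

formulaic (bit _) = true
formulaic y       = opens y

between nextStart : Symbol → Fin 5
between labelˢ = inBlock
between worldˢ = inRow
between y      = if opens y then inFormula else failed

nextStart tick   = atStart
nextStart worldˢ = inRow
nextStart _      = failed

-- Since `inRow` is left successfully only at an edge, the finite control by itself checks
-- left-totality. The lengths of the rows and the range of the initial world are beyond it and are
-- checked by `rowsCheck`.
nextPhase : Fin 5 → Symbol → Fin 5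
nextPhase atStart   y           = nextStart y
nextPhase inRow     (bit true)  = inBlock
nextPhase inRow     (bit false) = inRow
nextPhase inRow     _           = failed
nextPhase inBlock   (bit _)     = inBlock
nextPhase inBlock   y           = between y
nextPhase inFormula y           = if formulaic y then inFormula else failed
nextPhase failed    _           = failed

accepted : Fin 5 → Bool
accepted inFormula = true
accepted _         = false

-- The last phase, and the part of the input that is read in the formula.
phases : Fin 5 → List Symbol → Fin 5 × List Symbol
phases q []      = q , []
phases q (y ∷ x) = let q′ = nextPhase q y ; (p , z) = phases q′ x in
                   p , (if accepted q′ then y ∷ z else z)

FormulaText : List Symbol → Set
FormulaText = All λ y → formulaic y ≡ true

phases-digits : ∀ l S → phases inBlock (bits l ++ S) ≡ phases inBlock S
phases-digits []      S = refl
phases-digits (_ ∷ l) S = phases-digits l S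

phases-row : ∀ row S → or row ≡ true → phases inRow (bits row ++ S) ≡ phases inBlock S
phases-row (true ∷ row)  S _ = phases-digits row S
phases-row (false ∷ row) S p = phases-row row S p

phases-formula : ∀ S → FormulaText S → phases inFormula S ≡ (inFormula , S)
phases-formula []      []       = refl
phases-formula (y ∷ S) (p ∷ ps) rewrite p | phases-formula S ps = refl

data StartsFormula : List Symbol → Set where
  starts : ∀ {y S} → opens y ≡ true → FormulaText S → StartsFormula (y ∷ S)

phases-labels : ∀ ls S → phases inBlock (labelsText ls S) ≡ phases inBlock S
phases-labels []       S = refl
phases-labels (l ∷ ls) S = trans (phases-digits l (labelsText ls S)) (phases-labels ls S)

phases-start : ∀ {S} → StartsFormula S → phases inBlock S ≡ (inFormula , S)
phases-start (starts {posˢ} p ps) rewrite phases-formula _ ps = refl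
phases-start (starts {negˢ} p ps) rewrite phases-formula _ ps = refl
phases-start (starts {∧ˢ}   p ps) rewrite phases-formula _ ps = refl
phases-start (starts {Xˢ}   p ps) rewrite phases-formula _ ps = refl
phases-start (starts {Uˢ}   p ps) rewrite phases-formula _ ps = refl
phases-start (starts {Rˢ}   p ps) rewrite phases-formula _ ps = refl

Total : List Block → Set
Total = All λ b → or (proj₁ b) ≡ true

phases-blocks : ∀ bs {S} → Total bs → StartsFormula S → phases inBlock (blocksText bs S) ≡ (inFormula , S)
phases-blocks [] [] f = phases-start f
phases-blocks ((row , ls) ∷ bs) (p ∷ ps) f =
  trans (phases-row row _ p) (trans (phases-labels ls _) (phases-blocks bs ps f))

phases-text : ∀ k bs {S} → 0 < length bs → Total bs → StartsFormula S → phases atStart (text k bs S) ≡ (inFormula , S)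
phases-text zero    (b ∷ bs) _  ps f = phases-blocks (b ∷ bs) ps f
phases-text (suc k) bs       ne ps f = phases-text k bs ne ps f

phases-failed : ∀ x → proj₁ (phases failed x) ≡ failed
phases-failed []      = refl
phases-failed (_ ∷ x) = phases-failed x

private
  never : ∀ {C : Set} x → proj₁ (phases failed x) ≡ inFormula → C
  never x eq with () ← trans (sym (phases-failed x)) eq

formula-sound : ∀ S → proj₁ (phases inFormula S) ≡ inFormula → FormulaText S
formula-sound []      _ = []
formula-sound (y ∷ S) eq with formulaic y in p
... | true  = p ∷ formula-sound S eq
... | false = never S eq

-- What follows a position in the middle of a row or of a label entry: `current` is the remainder of
-- that word of bits. In a row that has shown no edge so far, `P` demands an edge in the remainder.
record Parts (x : List Symbol) (P : List Bool → Set) : Set where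
  constructor parts
  field
    {current} : List Bool
    {labels}  : List (List Bool)
    {blocks}  : List Block
    {formula} : List Symbol
    decompose : x ≡ bits current ++ labelsText labels (blocksText blocks formula)
    first     : P current
    total     : Total blocks
    start     : StartsFormula formula

parts-bit : ∀ {x P Q} b → (∀ {l} → P l → Q (b ∷ l)) → Parts x P → Parts (bit b ∷ x) Q
parts-bit b pq (parts eq p t s) = parts (cong (bit b ∷_) eq) (pq p) t s

parts-label : ∀ {x P Q} → Q [] → Parts x P → Parts (labelˢ ∷ x) Q
parts-label q (parts {l} {ls} eq _ t s) = parts {current = []} {l ∷ ls} (cong (labelˢ ∷_) eq) q t s

parts-world : ∀ {x Q} → Q [] → Parts x (λ l → or l ≡ true) → Parts (worldˢ ∷ x) Q
parts-world q (parts {l} {ls} {bs} eq p t s) =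
  parts {current = []} {[]} {(l , ls) ∷ bs} (cong (worldˢ ∷_) eq) q (p ∷ t) s

parts-formula : ∀ {y x Q} → Q [] → opens y ≡ true → proj₁ (phases inFormula x) ≡ inFormula → Parts (y ∷ x) Q
parts-formula {x = x} q o eq = parts {current = []} {[]} {[]} refl q [] (starts o (formula-sound x eq))

Any : List Bool → Set
Any l = or l ≡ true

Whatever : List Bool → Set
Whatever _ = true ≡ true

row-sound   : ∀ x → proj₁ (phases inRow x) ≡ inFormula → Parts x Any
block-sound : ∀ x → proj₁ (phases inBlock x) ≡ inFormula → Parts x Whatever

row-sound (bit true ∷ x)  eq = parts-bit true (λ _ → refl) (block-sound x eq)
row-sound (bit false ∷ x) eq = parts-bit false id (row-sound x eq)
row-sound (tick ∷ x)      eq = never x eq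
row-sound (worldˢ ∷ x)    eq = never x eq
row-sound (labelˢ ∷ x)    eq = never x eq
row-sound (posˢ ∷ x)      eq = never x eq
row-sound (negˢ ∷ x)      eq = never x eq
row-sound (∧ˢ ∷ x)        eq = never x eq
row-sound (∨ˢ ∷ x)        eq = never x eq
row-sound (Xˢ ∷ x)        eq = never x eq
row-sound (Uˢ ∷ x)        eq = never x eq
row-sound (Rˢ ∷ x)        eq = never x eq

block-sound (bit b ∷ x)  eq = parts-bit b (λ _ → refl) (block-sound x eq)
block-sound (tick ∷ x)   eq = never x eq
block-sound (worldˢ ∷ x) eq = parts-world refl (row-sound x eq)
block-sound (labelˢ ∷ x) eq = parts-label refl (block-sound x eq)
block-sound (posˢ ∷ x)   eq = parts-formula refl refl eq
block-sound (negˢ ∷ x)   eq = parts-formula refl refl eq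
block-sound (∧ˢ ∷ x)     eq = parts-formula refl refl eq
block-sound (∨ˢ ∷ x)     eq = never x eq
block-sound (Xˢ ∷ x)     eq = parts-formula refl refl eq
block-sound (Uˢ ∷ x)     eq = parts-formula refl refl eq
block-sound (Rˢ ∷ x)     eq = parts-formula refl refl eq

start-sound : ∀ x → proj₁ (phases atStart x) ≡ inFormula →
  ∃₂ λ k bs → ∃ λ S → x ≡ text k bs S × 0 < length bs × Total bs × StartsFormula S
start-sound (tick ∷ x) eq =
  let (k , bs , S , p , q) = start-sound x eq in suc k , bs , S , cong (tick ∷_) p , q
start-sound (worldˢ ∷ x) eq =
  let parts {l} {ls} {bs} {S} p any t s = row-sound x eq
  in 0 , (l , ls) ∷ bs , S , cong (worldˢ ∷_) p , s≤s z≤n , any ∷ t , s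
start-sound (bit _ ∷ x)  eq = never x eq
start-sound (labelˢ ∷ x) eq = never x eq
start-sound (posˢ ∷ x)   eq = never x eq
start-sound (negˢ ∷ x)   eq = never x eq
start-sound (∧ˢ ∷ x)     eq = never x eq
start-sound (∨ˢ ∷ x)     eq = never x eq
start-sound (Xˢ ∷ x)     eq = never x eq
start-sound (Uˢ ∷ x)     eq = never x eq
start-sound (Rˢ ∷ x)     eq = never x eq

when : Bool → Act Symbol → Act Symbol
when b w = if b then w else go stay

scanCell : Cell Symbol → Reg → Reg × Vec (Act Symbol) 10
scanCell (` y) r =
  let q = nextPhase (Reg.phase r) y ; z = accepted q ; w = isWorld (` y) in
  record r { phase = q } ,
  idle [ xT ]≔ go right
       [ fT ]≔ when z (just y , right) [ gT ]≔ when z (just tick , right) [ vT ]≔ when z (putBit false right)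
       [ cT ]≔ putBit true right [ eT ]≔ putBit true right
       [ sT ]≔ when w (putBit false right) [ aT ]≔ when w (putBit false right)
       [ iT ]≔ when w (putBit false right) [ dT ]≔ when w (putBit true right)
scanCell _     r = r , idle

-- The only place where contents may grow. Every symbol of the input extends each tape by at most
-- one cell, which is why the cost of the whole program is the length of the input.
scanLoop scan : Prog
scanLoop = while (λ _ h → not (isEnd (lookup h xT))) (act true λ r h → scanCell (lookup h xT) r)
scan = scanLoop ⨾ rewind xT ⨾ rewind fT ⨾ rewind gT ⨾ rewind vT ⨾ rewind cT ⨾ rewind eT ⨾
       rewind sT ⨾ rewind aT ⨾ rewind iT ⨾ rewind dT

grow : Bool → Symbol → List Symbol → List Symbol
grow b y L = if b then y ∷ L else L

growF : (Symbol → Symbol) → Fin 5 → List Symbol → List Symbol → List Symbol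
growF h q []      L = L
growF h q (y ∷ x) L = growF h (nextPhase q y) x (grow (accepted (nextPhase q y)) (h y) L)

growW : Bool → List Symbol → List Symbol → List Symbol
growW b []      L = L
growW b (y ∷ x) L = growW b x (grow (isWorld (` y)) (bit b) L)

growX : List Symbol → List Symbol → List Symbol
growX []      L = L
growX (y ∷ x) L = growX x (bit true ∷ L)

marks : Bool → List Symbol → List Bool
marks b []      = []
marks b (y ∷ x) = if isWorld (` y) then b ∷ marks b x else marks b x

growF-≡ : ∀ h q x L → growF h q x L ≡ map h (proj₂ (phases q x)) ʳ++ L
growF-≡ h q []      L = refl
growF-≡ h q (y ∷ x) L with accepted (nextPhase q y) | growF-≡ h (nextPhase q y) x
... | true  | ih = ih (h y ∷ L)
... | false | ih = ih L

growW-≡ : ∀ b x L → growW b x L ≡ bits (marks b x) ʳ++ L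
growW-≡ b []      L = refl
growW-≡ b (y ∷ x) L with isWorld (` y)
... | true  = growW-≡ b x (bit b ∷ L)
... | false = growW-≡ b x L

growX-≡ : ∀ x L → growX x L ≡ bits (trues (length x)) ʳ++ L
growX-≡ []      L = refl
growX-≡ (y ∷ x) L = growX-≡ x (bit true ∷ L)

st-cong : ∀ {x′ f′ g′ v′ c′ e′ s′ a′ i′ d′} → x ≡ x′ → f ≡ f′ → g ≡ g′ → v ≡ v′ → c ≡ c′ → e ≡ e′ → s ≡ s′ → a ≡ a′ →
          i ≡ i′ → d ≡ d′ → st r x f g v c e s a i d ≡ st r x′ f′ g′ v′ c′ e′ s′ a′ i′ d′
st-cong refl refl refl refl refl refl refl refl refl refl = refl

grown : ∀ b y {m L} → m ≡ (just y , right) → perform true (when b m) (L ▸ []) ≡ (grow b y L ▸ [])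
grown true  y refl = refl
grown false y refl = refl

scan-loop : ∀ x q {fl lv fo re si X F G V C E S A I D} →
  scanLoop ⊢ st (reg q fl lv fo re si) (X ▸ x) (F ▸ []) (G ▸ []) (V ▸ [])
                (C ▸ []) (E ▸ []) (S ▸ []) (A ▸ []) (I ▸ []) (D ▸ [])
           ⇓[ length x ]
             st (reg (proj₁ (phases q x)) fl lv fo re si) ((x ʳ++ X) ▸ [])
                (growF id q x F ▸ []) (growF (const tick) q x G ▸ [])
                (growF (const (bit false)) q x V ▸ []) (growX x C ▸ []) (growX x E ▸ [])
                (growW false x S ▸ []) (growW false x A ▸ []) (growW false x I ▸ []) (growW true x D ▸ [])
scan-loop []      q = stop refl
scan-loop (y ∷ x) q =
  loop refl (act ⇒ st-cong refl (grown z _ refl) (grown z _ refl) (grown z _ refl) refl refl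
                           (grown w _ refl) (grown w _ refl) (grown w _ refl) (grown w _ refl))
       (scan-loop x (nextPhase q y))
  where
  z w : Bool
  z = accepted (nextPhase q y)
  w = isWorld (` y)

map-const : ∀ {A B : Set} (b : B) (as : List A) → map (const b) as ≡ replicate (length as) b
map-const b []       = refl
map-const b (_ ∷ as) = cong (b ∷_) (map-const b as)

no-cost : ∀ {P σ τ n} → P ⊢ σ ⇓[ n + 0 ] τ → P ⊢ σ ⇓[ n ] τ
no-cost {P} {σ} {τ} {n} = subst (λ n → P ⊢ σ ⇓[ n ] τ) (+-identityʳ n)

scan-run : ∀ x {q fl lv fo re si} → let (p , z) = phases q x in
  scan ⊢ (reg q fl lv fo re si , loaded x) ⇓[ length x ]
         st (reg p fl lv fo re si) (◂ x) (◂ z) (◂ replicate (length z) tick) (◂ replicate (length z) (bit false))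
            (◂ bits (trues (length x))) (◂ bits (trues (length x)))
            (◂ bits (marks false x)) (◂ bits (marks false x)) (◂ bits (marks false x)) (◂ bits (marks true x))
scan-run x {q} = no-cost
  (scan-loop x q ⨾ rewind-run xT ⨾ rewind-run fT ⨾ rewind-run gT ⨾ rewind-run vT ⨾ rewind-run cT ⨾ rewind-run eT ⨾
   rewind-run sT ⨾ rewind-run aT ⨾ rewind-run iT ⨾ rewind-run dT
   ⇒ st-cong (cong ◂_ (there-and-back x)) (back _ (growF-≡ id q x []) (map-id z))
             (back _ (growF-≡ (const tick) q x []) (map-const tick z))
             (back _ (growF-≡ (const (bit false)) q x []) (map-const (bit false) z))
             (back (bits (trues (length x))) (growX-≡ x []) refl) (back (bits (trues (length x))) (growX-≡ x []) refl)
             (back (bits (marks false x)) (growW-≡ false x []) refl) (back (bits (marks false x)) (growW-≡ false x []) refl)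
             (back (bits (marks false x)) (growW-≡ false x []) refl) (back (bits (marks true x)) (growW-≡ true x []) refl))
  where
  z = proj₂ (phases q x)

  back : ∀ xs {L ys} → L ≡ xs ʳ++ [] → xs ≡ ys → (◂ (L ʳ++ [])) ≡ (◂ ys)
  back xs refl refl = cong ◂_ (there-and-back xs)

marks-digits : ∀ b l S → marks b (bits l ++ S) ≡ marks b S
marks-digits b []      S = refl
marks-digits b (_ ∷ l) S = marks-digits b l S

marks-labels : ∀ b ls S → marks b (labelsText ls S) ≡ marks b S
marks-labels b []       S = refl
marks-labels b (l ∷ ls) S = trans (marks-digits b l _) (marks-labels b ls S)

marks-formula : ∀ b {S} → FormulaText S → marks b S ≡ []
marks-formula b []                = refl
marks-formula b (_∷_ {bit _} _ p) = marks-formula b p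
marks-formula b (_∷_ {posˢ} _ p)  = marks-formula b p
marks-formula b (_∷_ {negˢ} _ p)  = marks-formula b p
marks-formula b (_∷_ {∧ˢ} _ p)    = marks-formula b p
marks-formula b (_∷_ {Xˢ} _ p)    = marks-formula b p
marks-formula b (_∷_ {Uˢ} _ p)    = marks-formula b p
marks-formula b (_∷_ {Rˢ} _ p)    = marks-formula b p

opens-formulaic : ∀ y → opens y ≡ true → formulaic y ≡ true
opens-formulaic posˢ _ = refl
opens-formulaic negˢ _ = refl
opens-formulaic ∧ˢ   _ = refl
opens-formulaic Xˢ   _ = refl
opens-formulaic Uˢ   _ = refl
opens-formulaic Rˢ   _ = refl

starts-formula : ∀ {S} → StartsFormula S → FormulaText S
starts-formula (starts p ps) = opens-formulaic _ p ∷ ps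

marks-text : ∀ b k bs {S} → StartsFormula S → marks b (text k bs S) ≡ replicate (length bs) b
marks-text b zero    []                f = marks-formula b (starts-formula f)
marks-text b zero    ((row , ls) ∷ bs) f =
  cong (b ∷_) (trans (marks-digits b row _) (trans (marks-labels b ls _) (marks-text b zero bs f)))
marks-text b (suc k) bs                f = marks-text b k bs f

-- Square adjacency matrix and range of the initial world

closed : Reg → Cell Symbol → Bool
closed r y = Reg.res r ∧ (not (Reg.live r) ∨ isEnd y)

rowsCell : Cell Symbol → Reg → Cell Symbol → Reg × Vec (Act Symbol) 10
rowsCell (` bit _) r y = record r { res = Reg.res r ∧ (not (Reg.live r) ∨ not (isEnd y)) }
                       , idle [ xT ]≔ go right [ aT ]≔ (if Reg.live r then go right else go stay)
rowsCell (` tick)  r y = r , idle [ xT ]≔ go right [ iT ]≔ go right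
rowsCell _         r y = record r { res = closed r y ; live = false } , idle [ xT ]≔ go right

-- The tape `a` is a ruler with one cell per world. Its head moves along with a row: a bit read when
-- the head is at the end shows that the row is too long, and `closed` detects a row that is too
-- short. Likewise every tick moves the head on `i`, which ends on the cell of the initial world or,
-- if the index is out of range, behind the last cell.
rowsBody rowsLoop rowsCheck : Prog
rowsBody = ite (λ _ h → isWorld (lookup h xT))
  (act false (λ r h → record r { res = closed r (lookup h aT) ; live = true } , idle) ⨾ rewind aT ⨾
   act false λ r _ → r , idle [ xT ]≔ go right [ aT ]≔ go right)
  (act false λ r h → rowsCell (lookup h xT) r (lookup h aT))
rowsLoop = while readsKripke rowsBody
rowsCheck = act false (λ r _ → record r { res = true ; live = false } , idle [ xT ]≔ go right [ iT ]≔ go right) ⨾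
  rowsLoop ⨾
  act false (λ r h → record r { res = closed r (lookup h aT) ∧ not (isEnd (lookup h iT)) } , idle [ iT ]≔ putBit true stay) ⨾
  rewind xT ⨾ rewind aT ⨾ rewind iT

isEnd-bits : ∀ L bs → isEnd (top (L ▸ bits bs)) ≡ (length bs ≡ᵇ 0)
isEnd-bits L []      = refl
isEnd-bits L (_ ∷ _) = refl

replace-a : ∀ {a′} → a ≡ a′ → st r x f g v c e s a i d ≡ st r x f g v c e s a′ i d
replace-a refl = refl

rows-row : ∀ {re S L V q fl fo si} acc row → ∃₂ λ re′ a′ →
  re′ ∧ isEnd (top a′) ≡ re ∧ (length acc ≡ᵇ length row) × rewound a′ ≡ rewound (V ▸ bits acc) ×
  (rowsLoop ⊢ st (reg q fl true fo re si) (L ▸ bits row ++ S) f g v c e s (V ▸ bits acc) i d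
            ⟿ st (reg q fl true fo re′ si) ((bits row ʳ++ L) ▸ S) f g v c e s a′ i d)
rows-row {re = re} {V = V} acc [] = re , _ , cong (re ∧_) (isEnd-bits V acc) , refl , id
rows-row {re = re} [] (_ ∷ row) =
  let (_ , _ , eq , ea , k) = rows-row {re = re ∧ false} [] row
  in _ , _ , trans eq (trans (cong (_∧ (0 ≡ᵇ length row)) (∧-zeroʳ re)) (sym (∧-zeroʳ re))) , ea ,
     λ d → loop refl (ite-false refl act) (k d)
rows-row {re = re} (_ ∷ acc) (_ ∷ row) =
  let (_ , _ , eq , ea , k) = rows-row {re = re ∧ true} acc row
  in _ , _ , trans eq (cong (_∧ (length acc ≡ᵇ length row)) (∧-identityʳ re)) , ea ,
     λ d → loop refl (ite-false refl act) (k d)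

rows-digits : ∀ {re S L q fl fo si} l → ∃ λ re′ → re′ ≡ re ×
  (rowsLoop ⊢ st (reg q fl false fo re si) (L ▸ bits l ++ S) f g v c e s a i d
            ⟿ st (reg q fl false fo re′ si) ((bits l ʳ++ L) ▸ S) f g v c e s a i d)
rows-digits []      = _ , refl , id
rows-digits {re = re} (_ ∷ l) =
  let (_ , eq , k) = rows-digits {re = re ∧ true} l
  in _ , trans eq (∧-identityʳ re) , λ d → loop refl (ite-false refl act) (k d)

rows-labels : ∀ {p re lv S L q fl fo si} ls → re ∧ (not lv ∨ isEnd (top a)) ≡ p →
  ∃₂ λ re′ lv′ → ∃ λ L′ → re′ ∧ (not lv′ ∨ isEnd (top a)) ≡ p × L′ ʳ++ S ≡ L ʳ++ labelsText ls S ×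
  (rowsLoop ⊢ st (reg q fl lv fo re si) (L ▸ labelsText ls S) f g v c e s a i d
            ⟿ st (reg q fl lv′ fo re′ si) (L′ ▸ S) f g v c e s a i d)
rows-labels []       eq = _ , _ , _ , eq , refl , id
rows-labels (l ∷ ls) eq =
  let (_ , eq₁ , k₁) = rows-digits l
      (_ , _ , _ , eq₂ , eq-x , k₂) = rows-labels ls (trans (∧-identityʳ _) (trans eq₁ eq))
  in _ , _ , _ , eq₂ , trans eq-x (ʳ++-ʳ++ (bits l)) ,
     λ d → loop refl (ite-false refl act) (k₁ (k₂ d))

lengths : Bool → ℕ → List Block → Bool
lengths p n []             = p
lengths p n ((row , _) ∷ bs) = lengths (p ∧ (n ≡ᵇ length row)) n bs

rows-blocks : ∀ {p re lv S L q fl fo si} acc bs → re ∧ (not lv ∨ isEnd (top a)) ≡ p → rewound a ≡ (◂ bits acc) →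
  ∃₂ λ re′ lv′ → ∃₂ λ L′ a′ → re′ ∧ (not lv′ ∨ isEnd (top a′)) ≡ lengths p (length acc) bs ×
  L′ ʳ++ S ≡ L ʳ++ blocksText bs S × rewound a′ ≡ (◂ bits acc) ×
  (rowsLoop ⊢ st (reg q fl lv fo re si) (L ▸ blocksText bs S) f g v c e s a i d
            ⟿ st (reg q fl lv′ fo re′ si) (L′ ▸ S) f g v c e s a′ i d)
rows-blocks acc []                eq ea = _ , _ , _ , _ , eq , refl , ea , id
rows-blocks acc ((row , ls) ∷ bs) refl ea =
  let (_ , _ , eq₁ , ea₁ , k₁) = rows-row acc row
      (_ , _ , _ , eq₂ , x₂ , k₂) = rows-labels ls eq₁
      (_ , _ , _ , _ , eq₃ , x₃ , ea₃ , k₃) = rows-blocks acc bs eq₂ ea₁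
  in _ , _ , _ , _ , eq₃ , trans x₃ (trans x₂ (ʳ++-ʳ++ (bits row))) , ea₃ ,
     λ d → loop refl (ite-true refl (act ⨾ rewind-run aT ⨾ (act ⇒ replace-a (cong (shift right) ea)))) (k₁ (k₂ (k₃ d)))

mark : ℕ → List Bool → List Bool
mark k       []       = []
mark zero    (b ∷ bs) = true ∷ bs
mark (suc k) (b ∷ bs) = b ∷ mark k bs

rows-ticks : ∀ {S L M} k bs ws → ∃₂ λ L′ i′ → L′ ʳ++ blocksText bs S ≡ L ʳ++ text k bs S ×
  rewound (put false (just (bit true)) i′) ≡ (◂ (M ʳ++ bits (mark k ws))) × not (isEnd (top i′)) ≡ (k <ᵇ length ws) ×
  (rowsLoop ⊢ st r (L ▸ text k bs S) f g v c e s a (M ▸ bits ws) d ⟿ st r (L′ ▸ blocksText bs S) f g v c e s a i′ d)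
rows-ticks zero    bs []       = _ , _ , refl , refl , refl , id
rows-ticks zero    bs (w ∷ ws) = _ , _ , refl , refl , refl , id
rows-ticks (suc k) bs []       =
  let (_ , _ , x , i , n , k₁) = rows-ticks k bs []
  in _ , _ , x , i , trans n (<ᵇ-nil k) , λ d → loop refl (ite-false refl act) (k₁ d)
  where
  <ᵇ-nil : ∀ k → (k <ᵇ 0) ≡ false
  <ᵇ-nil zero    = refl
  <ᵇ-nil (suc _) = refl
rows-ticks (suc k) bs (w ∷ ws) =
  let (_ , _ , x , i , n , k₁) = rows-ticks k bs ws
  in _ , _ , x , i , n , λ d → loop refl (ite-false refl act) (k₁ d)

rows-run : ∀ {q fl lv fo re si y S ws acc} k bs → isKripke (` y) ≡ false → ∃ λ r′ →
  Reg.res r′ ≡ lengths true (length acc) bs ∧ (k <ᵇ length ws) ×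
  (rowsCheck ⊢ st (reg q fl lv fo re si) (◂ text k bs (y ∷ S)) f g v c e s (◂ bits acc) (◂ bits ws) d
             ⇓ st r′ (◂ text k bs (y ∷ S)) f g v c e s (◂ bits acc) (◂ bits (mark k ws)) d)
rows-run {ws = ws} {acc} k bs y-formula =
  let (_ , _ , x₁ , i₁ , n₁ , k₁) = rows-ticks k bs ws
      (_ , _ , _ , _ , eq₂ , x₂ , a₂ , k₂) = rows-blocks acc bs refl refl
  in _ , cong₂ _∧_ eq₂ n₁ ,
     (act ⨾ k₁ (k₂ (stop y-formula)) ⨾ act ⨾ rewind-run xT ⨾ rewind-run aT ⨾ rewind-run iT
     ⇒ st-cong (cong ◂_ (trans x₂ x₁)) refl refl refl refl refl refl a₂ i₁ refl)

-- Whether the symbols are the end of a sequence of formulas, whether they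
-- start within the digits of an atom, and how many formulas they contain.
record Count : Set where
  constructor count
  field
    ok pending : Bool
    number     : ℕ

data Kind : Set where
  digit atom unary binary : Kind

kind : Symbol → Kind
kind (bit _) = digit
kind posˢ    = atom
kind negˢ    = atom
kind Xˢ      = unary
kind _       = binary

-- The tests are nested in the order in which the machine makes them, so that its registers agree
-- with them by `refl`.
extend : Kind → Count → Count
extend digit  (count ok _ n) = count ok true n
extend atom   (count ok _ n) = count ok false (suc n)
extend unary  (count ok p n) = count ((ok ∧ not p) ∧ (1 ≤ᵇ n)) p n
extend binary (count ok p n) = count (((ok ∧ not p) ∧ (1 ≤ᵇ n)) ∧ (2 ≤ᵇ n)) p (pred n)

polish : List Symbol → Count
polish []      = count true false 0
polish (y ∷ s) = extend (kind y) (polish s)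

isCount : Count → Bool
isCount (count ok p n) = ((ok ∧ not p) ∧ (1 ≤ᵇ n)) ∧ not (2 ≤ᵇ n)

clean inside : Prog
clean  = on vT λ r y → record r { res = Reg.res r ∧ not (Reg.live r) } , go left
inside = on vT λ r y → record r { res = Reg.res r ∧ not (isMarker y) } , go left

polishCell polishLoop polishCheck : Prog
polishCell =
  ite (λ _ h → isBit (lookup h fT)) (act false λ r _ → record r { live = true } , idle) (
  ite (λ _ h → isAtom (lookup h fT)) (act false λ r _ → record r { live = false } , idle [ vT ]≔ go right) (
  clean ⨾ ite (λ _ h → isNext (lookup h fT)) (act false λ r _ → r , idle) inside ⨾
  on vT λ r y → record r { res = Reg.res r ∧ not (isMarker y) } , go right))
polishLoop = while standing (polishCell ⨾ both left)
polishCheck = on vT (steer right) ⨾ while unfinished (both right) ⨾ both left ⨾ polishLoop ⨾ clean ⨾ inside ⨾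
  on vT λ r y → record r { res = Reg.res r ∧ isMarker y } , go stay

number≤ : ∀ s → Count.number (polish s) ≤ length s
number≤ []      = z≤n
number≤ (y ∷ s) with kind y
... | digit  = ≤-trans (number≤ s) (n≤1+n _)
... | atom   = s≤s (number≤ s)
... | unary  = ≤-trans (number≤ s) (n≤1+n _)
... | binary = ≤-trans pred[n]≤n (≤-trans (number≤ s) (n≤1+n _))

-- The stack in v is represented by its height only.
data Height (m : ℕ) : ℕ → Zip Symbol → Set where
  height : ∀ {L J} → length L + length J ≡ m → Height m (length L) (L ▸ J)

Cell-run : Symbol → Count → Set
Cell-run y (count ok p n) = ∀ {q fl fo si x L S g v c e s a i d m} → Height m n v → n < m → ∃₂ λ r′ v′ →
  let count ok′ p′ n′ = extend (kind y) (count ok p n) in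
  Height m n′ v′ × Reg.res r′ ≡ ok′ × Reg.live r′ ≡ p′ ×
  (polishCell ⊢ st (reg q fl p fo ok si) x (L ▸ y ∷ S) g v c e s a i d ⇓ st r′ x (L ▸ y ∷ S) g v′ c e s a i d)

push-height : ∀ {L J m} → length L + length J ≡ m → length L < m → Height m (suc (length L)) (shift right (L ▸ J))
push-height {L} {[]}    eq lt = contradiction (trans (sym (+-identityʳ _)) eq) (<⇒≢ lt)
push-height {L} {_ ∷ J} eq lt = height (trans (sym (+-suc (length L) (length J))) eq)

atom-run : ∀ y {κ} → kind y ≡ atom → isBit (` y) ≡ false → isAtom (` y) ≡ true → Cell-run y κ
atom-run y k b a (height eq) lt rewrite k = _ , _ , push-height eq lt , refl , refl , ite-false b (ite-true a act)

unary-run : ∀ {κ} → Cell-run Xˢ κ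
unary-run (height {[]} {[]} eq) lt = _ , _ , height eq , refl , refl ,
  ite-false refl (ite-false refl (act ⨾ ite-true refl act ⨾ act))
unary-run (height {[]} {_ ∷ _} eq) lt = _ , _ , height eq , refl , refl ,
  ite-false refl (ite-false refl (act ⨾ ite-true refl act ⨾ act))
unary-run (height {_ ∷ _} eq) lt = _ , _ , height eq , refl , refl ,
  ite-false refl (ite-false refl (act ⨾ ite-true refl act ⨾ act))

-- Moving left on the marker has no effect. So the height changes like `pred` even if operands are
-- missing, and the run stays described by `extend` after an error.
binary-run : ∀ y {κ} → kind y ≡ binary → isBit (` y) ≡ false → isAtom (` y) ≡ false → isNext (` y) ≡ false → Cell-run y κ
binary-run y k b a n (height {[]} eq) lt rewrite k = _ , _ , height eq , refl , refl ,
  ite-false b (ite-false a (act ⨾ ite-false n act ⨾ act))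
binary-run y k b a n (height {_ ∷ []} eq) lt rewrite k = _ , _ , height eq , refl , refl ,
  ite-false b (ite-false a (act ⨾ ite-false n act ⨾ act))
binary-run y k b a n (height {_ ∷ _ ∷ L} {J} eq) lt rewrite k =
  _ , _ , height (trans (cong suc (+-suc (length L) _)) eq) , refl , refl ,
  ite-false b (ite-false a (act ⨾ ite-false n act ⨾ act))

polish-cell : ∀ {y κ} → formulaic y ≡ true → Cell-run y κ
polish-cell {bit _} p h lt = _ , _ , h , refl , refl , ite-true refl act
polish-cell {posˢ}  p = atom-run posˢ refl refl refl
polish-cell {negˢ}  p = atom-run negˢ refl refl refl
polish-cell {∧ˢ}    p = binary-run ∧ˢ refl refl refl refl
polish-cell {Xˢ}    p = unary-run
polish-cell {Uˢ}    p = binary-run Uˢ refl refl refl refl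
polish-cell {Rˢ}    p = binary-run Rˢ refl refl refl refl

polish-loop : ∀ {q fl fo si S m} → FormulaText S → ∀ L M J → length S ≤ m → length J ≡ m →
  let count ok p n = polish S in ∃₂ λ r′ v′ → Height m n v′ × Reg.res r′ ≡ ok × Reg.live r′ ≡ p ×
  (polishLoop ⊢ st (reg q fl false fo true si) x (shift left ((S ʳ++ L) ▸ []))
                   (shift left ((replicate (length S) tick ʳ++ M) ▸ [])) ([] ▸ J) c e s a i d
              ⟿ st r′ x (shift left (L ▸ S)) (shift left (M ▸ replicate (length S) tick)) v′ c e s a i d)
polish-loop []       L M J len eq = _ , _ , height eq , refl , refl , id
polish-loop {S = y ∷ S} (p ∷ ps) L M J len eq =
  let (r₁ , _ , h₁ , res₁ , live₁ , k₁) = polish-loop ps (y ∷ L) (tick ∷ M) J (≤-trans (n≤1+n _) len) eq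
      (_ , v₂ , h₂ , res₂ , live₂ , d₂) =
        polish-cell {y} {count (Reg.res r₁) (Reg.live r₁) _} p h₁ (≤-trans (s≤s (number≤ S)) len)
      κ≡ = cong₂ (λ ok p → extend (kind y) (count ok p (Count.number (polish S)))) res₁ live₁
  in _ , _ , subst (λ κ → Height _ (Count.number κ) v₂) κ≡ h₂ ,
     trans res₂ (cong Count.ok κ≡) , trans live₂ (cong Count.pending κ≡) ,
     λ w → k₁ (loop refl (d₂ ⨾ act) w)

polish-end : ∀ {m n} → Height m n v → ∃₂ λ r′ v′ → width v′ ≡ m × Reg.res r′ ≡ isCount (count (Reg.res r) (Reg.live r) n) ×
  (clean ⨾ inside ⨾ on vT (λ r y → record r { res = Reg.res r ∧ isMarker y } , go stay) ⊢
   st r x f g v c e s a i d ⇓ st r′ x f g v′ c e s a i d)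
polish-end (height {[]} {[]} eq)    = _ , _ , eq , refl , (act ⨾ act ⨾ act)
polish-end (height {[]} {_ ∷ _} eq) = _ , _ , eq , refl , (act ⨾ act ⨾ act)
polish-end (height {_ ∷ []} eq)     = _ , _ , eq , refl , (act ⨾ act ⨾ act)
polish-end (height {_ ∷ _ ∷ L} eq)  =
  _ , _ , trans (+-suc (length L) _) (trans (cong suc (+-suc (length L) _)) eq) , refl , (act ⨾ act ⨾ act)

polish-run : ∀ {q fl fo si S J} → FormulaText S → length J ≡ length S → ∃₂ λ r′ v′ →
  width v′ ≡ length S × Reg.res r′ ≡ isCount (polish S) ×
  (polishCheck ⊢ st (reg q fl false fo true si) x (◂ S) (◂ replicate (length S) tick) (◂ J) c e s a i d
               ⇓ st r′ x (◂ S) (◂ replicate (length S) tick) v′ c e s a i d)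
polish-run {S = S} {J} ps eq =
  let (r₁ , _ , h₁ , res₁ , live₁ , k₁) = polish-loop ps [] [] J ≤-refl eq
      (_ , _ , w₂ , res₂ , d₂) = polish-end {r = r₁} h₁
  in _ , _ , w₂ , trans res₂ (cong₂ (λ ok p → isCount (count ok p (Count.number (polish S)))) res₁ live₁) ,
     (act ⨾ loop refl act (to-end S _ (sym (length-replicate (length S)))) ⨾ act ⨾ k₁ (stop refl) ⨾ d₂)

reject main : Prog
reject = act false λ r _ → record r { res = false } , idle

isRes : Reg → Heads → Bool
isRes r _ = Reg.res r

clear : Prog
clear = act false λ r _ → record r { live = false ; res = true } , idle

main = scan ⨾ ite (λ r _ → accepted (Reg.phase r))
  (rowsCheck ⨾ ite isRes (clear ⨾ polishCheck ⨾ ite isRes core reject) reject) reject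

-- Encodings

digitBits : ℕᵇ → List Bool
digitBits ℕᵇ.zero  = []
digitBits 1+[2 n ] = false ∷ digitBits n
digitBits 2[1+ n ] = true  ∷ digitBits n

fromBits : List Bool → ℕᵇ
fromBits []           = ℕᵇ.zero
fromBits (false ∷ bs) = 1+[2 fromBits bs ]
fromBits (true ∷ bs)  = 2[1+ fromBits bs ]

apBits : AP → List Bool
apBits p = digitBits (fromℕ p)

bitsAP : List Bool → AP
bitsAP bs = toℕᵇ (fromBits bs)

digits-bits : ∀ n → digits n ≡ bits (digitBits n)
digits-bits ℕᵇ.zero  = refl
digits-bits 1+[2 n ] = cong (bit false ∷_) (digits-bits n)
digits-bits 2[1+ n ] = cong (bit true ∷_) (digits-bits n)

digitBits-fromBits : ∀ bs → digitBits (fromBits bs) ≡ bs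
digitBits-fromBits []           = refl
digitBits-fromBits (false ∷ bs) = cong (false ∷_) (digitBits-fromBits bs)
digitBits-fromBits (true ∷ bs)  = cong (true ∷_) (digitBits-fromBits bs)

fromBits-digitBits : ∀ n → fromBits (digitBits n) ≡ n
fromBits-digitBits ℕᵇ.zero  = refl
fromBits-digitBits 1+[2 n ] = cong 1+[2_] (fromBits-digitBits n)
fromBits-digitBits 2[1+ n ] = cong 2[1+_] (fromBits-digitBits n)

encodeAP-bits : ∀ p → encodeAP p ≡ bits (apBits p)
encodeAP-bits p = digits-bits (fromℕ p)

apBits-bitsAP : ∀ bs → apBits (bitsAP bs) ≡ bs
apBits-bitsAP bs = trans (cong digitBits (fromℕ-toℕ (fromBits bs))) (digitBits-fromBits bs)

apBits-injective : ∀ {p q} → apBits p ≡ apBits q → p ≡ q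
apBits-injective {p} {q} eq = fromℕ-injective
  (trans (sym (fromBits-digitBits (fromℕ p))) (trans (cong fromBits eq) (fromBits-digitBits (fromℕ q))))

formulaic-bits : ∀ l → FormulaText (bits l)
formulaic-bits []      = []
formulaic-bits (_ ∷ l) = refl ∷ formulaic-bits l

formulaic-AP : ∀ p → FormulaText (encodeAP p)
formulaic-AP p = subst FormulaText (sym (encodeAP-bits p)) (formulaic-bits (apBits p))

formula-text : ∀ φ → SplitFree φ → FormulaText (encodeFormula φ)
formula-text (pos p)  _       = refl ∷ formulaic-AP p
formula-text (neg p)  _       = refl ∷ formulaic-AP p
formula-text (φ ∧ᶠ ψ) (s , t) = refl ∷ All.++⁺ (formula-text φ s) (formula-text ψ t)
formula-text (X φ)    s       = refl ∷ formula-text φ s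
formula-text (φ U ψ)  (s , t) = refl ∷ All.++⁺ (formula-text φ s) (formula-text ψ t)
formula-text (φ R ψ)  (s , t) = refl ∷ All.++⁺ (formula-text φ s) (formula-text ψ t)

formula-starts : ∀ φ → SplitFree φ → StartsFormula (encodeFormula φ)
formula-starts φ s with φ | s | formula-text φ s
... | pos _  | _ | _ ∷ p = starts refl p
... | neg _  | _ | _ ∷ p = starts refl p
... | _ ∧ᶠ _ | _ | _ ∷ p = starts refl p
... | X _    | _ | _ ∷ p = starts refl p
... | _ U _  | _ | _ ∷ p = starts refl p
... | _ R _  | _ | _ ∷ p = starts refl p

polish-bits : ∀ l {S n} → polish S ≡ count true false n → ∃ λ p → polish (bits l ++ S) ≡ count true p n
polish-bits []      eq = _ , eq
polish-bits (_ ∷ l) eq = _ , cong (extend digit) (proj₂ (polish-bits l eq))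

polish-AP : ∀ p {S n} → polish S ≡ count true false n → extend atom (polish (encodeAP p ++ S)) ≡ count true false (suc n)
polish-AP p {S} eq rewrite encodeAP-bits p | proj₂ (polish-bits (apBits p) {S} eq) = refl

polish-formula : ∀ φ {S n} → SplitFree φ → polish S ≡ count true false n →
                 polish (encodeFormula φ ++ S) ≡ count true false (suc n)
polish-binary : ∀ φ ψ {S n} → SplitFree φ → SplitFree ψ → polish S ≡ count true false n →
                extend binary (polish ((encodeFormula φ ++ encodeFormula ψ) ++ S)) ≡ count true false (suc n)
polish-binary φ ψ {S} s t eq rewrite ++-assoc (encodeFormula φ) (encodeFormula ψ) S =
  cong (extend binary) (polish-formula φ s (polish-formula ψ t eq))

polish-formula (pos p)  _       eq = polish-AP p eq
polish-formula (neg p)  _       eq = polish-AP p eq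
polish-formula (φ ∧ᶠ ψ) (s , t) eq = polish-binary φ ψ s t eq
polish-formula (X φ)    s       eq = cong (extend unary) (polish-formula φ s eq)
polish-formula (φ U ψ)  (s , t) eq = polish-binary φ ψ s t eq
polish-formula (φ R ψ)  (s , t) eq = polish-binary φ ψ s t eq

isCount-formula : ∀ φ → SplitFree φ → isCount (polish (encodeFormula φ)) ≡ true
isCount-formula φ s = cong isCount
  (trans (cong polish (sym (++-identityʳ (encodeFormula φ)))) (polish-formula φ {[]} s refl))

formulas : List Formula → List Symbol
formulas = concatMap encodeFormula

-- The formula is read from its end, so the digits of an atom are met before its head symbol. They
-- form the word `leading`, which belongs to no formula yet.
record Parsed (S : List Symbol) (κ : Count) : Set where
  constructor parsed
  field
    {leading}  : List Bool
    {sequence} : List Formula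
    text≡      : S ≡ bits leading ++ formulas sequence
    split-free : All SplitFree sequence
    number≡    : length sequence ≡ Count.number κ
    pending≡   : Count.pending κ ≡ false → leading ≡ []

atom-sound : ∀ {S y κ} (φ : AP → Formula) → (∀ p → encodeFormula (φ p) ≡ y ∷ encodeAP p) → (∀ p → SplitFree (φ p)) →
             Parsed S κ → Parsed (y ∷ S) (extend atom κ)
atom-sound {S} {y} φ enc sf (parsed {l} {φs} eq sfs n _) =
  parsed {leading = []} {φ (bitsAP l) ∷ φs} text≡′ (sf _ ∷ sfs) (cong suc n) λ _ → refl
  where
  text≡′ : y ∷ S ≡ encodeFormula (φ (bitsAP l)) ++ formulas φs
  text≡′ rewrite enc (bitsAP l) | encodeAP-bits (bitsAP l) | apBits-bitsAP l = cong (y ∷_) eq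

unary-sound : ∀ {S κ} → Parsed S κ → Count.ok (extend unary κ) ≡ true → Parsed (Xˢ ∷ S) (extend unary κ)
unary-sound {κ = count _ false (suc n)} (parsed {sequence = φ ∷ φs} eq (s ∷ sf) n≡ e) ok with refl ← e refl =
  parsed {leading = []} {X φ ∷ φs} (cong (Xˢ ∷_) eq) (s ∷ sf) n≡ λ _ → refl
unary-sound {κ = count true true _}      _ ()
unary-sound {κ = count false true _}     _ ()
unary-sound {κ = count true false zero}  _ ()
unary-sound {κ = count false false zero} _ ()

binary-sound : ∀ {S y κ} (_⊙_ : Formula → Formula → Formula) →
  (∀ φ ψ → encodeFormula (φ ⊙ ψ) ≡ y ∷ encodeFormula φ ++ encodeFormula ψ) →
  (∀ {φ ψ} → SplitFree φ → SplitFree ψ → SplitFree (φ ⊙ ψ)) →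
  Parsed S κ → Count.ok (extend binary κ) ≡ true → Parsed (y ∷ S) (extend binary κ)
binary-sound {S} {y} {κ = count _ false (suc (suc n))} _⊙_ enc sf (parsed {sequence = φ ∷ ψ ∷ φs} eq (s ∷ t ∷ sfs) n≡ e) ok
  with refl ← e refl = parsed {leading = []} {(φ ⊙ ψ) ∷ φs} text≡′ (sf s t ∷ sfs) (suc-injective n≡) λ _ → refl
  where
  text≡′ : y ∷ S ≡ encodeFormula (φ ⊙ ψ) ++ formulas φs
  text≡′ rewrite enc φ ψ = cong (y ∷_) (trans eq (sym (++-assoc (encodeFormula φ) (encodeFormula ψ) (formulas φs))))
binary-sound {κ = count true true _}            _ _ _ _ ()
binary-sound {κ = count false true _}           _ _ _ _ ()
binary-sound {κ = count true false zero}        _ _ _ _ ()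
binary-sound {κ = count false false zero}       _ _ _ _ ()
binary-sound {κ = count true false (suc zero)}  _ _ _ _ ()
binary-sound {κ = count false false (suc zero)} _ _ _ _ ()

ok-unary : ∀ κ → Count.ok (extend unary κ) ≡ true → Count.ok κ ≡ true
ok-unary κ ok = proj₁ (∧-elim (proj₁ (∧-elim ok)))

ok-binary : ∀ κ → Count.ok (extend binary κ) ≡ true → Count.ok κ ≡ true
ok-binary κ ok = ok-unary κ (proj₁ (∧-elim ok))

polish-sound : ∀ S → FormulaText S → Count.ok (polish S) ≡ true → Parsed S (polish S)
polish-sound []          _        _  = parsed {leading = []} {[]} refl [] refl λ _ → refl
polish-sound (bit b ∷ S) (_ ∷ ps) ok with parsed {l} {φs} eq sf n _ ← polish-sound S ps ok =
  parsed {leading = b ∷ l} {φs} (cong (bit b ∷_) eq) sf n λ ()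
polish-sound (posˢ ∷ S)  (_ ∷ ps) ok = atom-sound pos (λ _ → refl) _ (polish-sound S ps ok)
polish-sound (negˢ ∷ S)  (_ ∷ ps) ok = atom-sound neg (λ _ → refl) _ (polish-sound S ps ok)
polish-sound (Xˢ ∷ S)    (_ ∷ ps) ok = unary-sound (polish-sound S ps (ok-unary (polish S) ok)) ok
polish-sound (∧ˢ ∷ S)    (_ ∷ ps) ok = binary-sound _∧ᶠ_ (λ _ _ → refl) _,_ (polish-sound S ps (ok-binary (polish S) ok)) ok
polish-sound (Uˢ ∷ S)    (_ ∷ ps) ok = binary-sound _U_ (λ _ _ → refl) _,_ (polish-sound S ps (ok-binary (polish S) ok)) ok
polish-sound (Rˢ ∷ S)    (_ ∷ ps) ok = binary-sound _R_ (λ _ _ → refl) _,_ (polish-sound S ps (ok-binary (polish S) ok)) ok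

isCount-sound : ∀ S → FormulaText S → isCount (polish S) ≡ true → ∃ λ φ → SplitFree φ × S ≡ encodeFormula φ
isCount-sound S ps eq = one (polish S) (polish-sound S ps (ok-unary (polish S) (proj₁ (∧-elim eq)))) eq
  where
  one : ∀ κ → Parsed S κ → isCount κ ≡ true → ∃ λ φ → SplitFree φ × S ≡ encodeFormula φ
  one (count _ false 1) (parsed {sequence = φ ∷ []} eq (s ∷ []) _ e) _ with refl ← e refl =
    φ , s , trans eq (++-identityʳ (encodeFormula φ))
  one (count true true _)               _ ()
  one (count false true _)              _ ()
  one (count true false 0)              _ ()
  one (count false false 0)             _ ()
  one (count true false (suc (suc _)))  _ ()
  one (count false false (suc (suc _))) _ ()

module Blocks (K : Kripke) where
  open Kripke K

  block : Fin size → Block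
  block w = map (edge w) (allFin size) , map apBits (label w)

  blocks : List Block
  blocks = map block (allFin size)

labels-text : ∀ ps S → concatMap (λ p → labelˢ ∷ encodeAP p) ps ++ S ≡ labelsText (map apBits ps) S
labels-text []       S = refl
labels-text (p ∷ ps) S = cong (labelˢ ∷_) (trans (++-assoc (encodeAP p) _ S)
  (cong₂ _++_ (encodeAP-bits p) (labels-text ps S)))

blocks-text : ∀ {W : Set} (f : W → List Symbol) (g : W → Block) →
  (∀ w S → f w ++ S ≡ blocksText (g w ∷ []) S) → ∀ ws S → concatMap f ws ++ S ≡ blocksText (map g ws) S
blocks-text f g eq []       S = refl
blocks-text f g eq (w ∷ ws) S =
  trans (++-assoc (f w) _ S) (trans (eq w _) (cong (blocksText (g w ∷ [])) (blocks-text f g eq ws S)))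

ticks-text : ∀ k bs S → replicate k tick ++ blocksText bs S ≡ text k bs S
ticks-text zero    bs S = refl
ticks-text (suc k) bs S = cong (tick ∷_) (ticks-text k bs S)

encode-text : ∀ φ K → encode φ K ≡ text (toℕ (Kripke.initial K)) (Blocks.blocks K) (encodeFormula φ)
encode-text φ K = trans (++-assoc (replicate (toℕ initial) tick) _ (encodeFormula φ))
  (trans (cong (replicate (toℕ initial) tick ++_) (blocks-text _ block world (allFin size) (encodeFormula φ)))
         (ticks-text (toℕ initial) blocks (encodeFormula φ)))
  where
  open Kripke K
  open Blocks K

  world : ∀ w S → (worldˢ ∷ map (λ v → bit (edge w v)) (allFin size) ++
                   concatMap (λ p → labelˢ ∷ encodeAP p) (label w)) ++ S ≡ blocksText (block w ∷ []) S
  world w S = cong (worldˢ ∷_) (trans (++-assoc (map (λ v → bit (edge w v)) (allFin size)) _ S)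
    (cong₂ _++_ (map-∘ (allFin size)) (labels-text (label w) S)))

any-edge : ∀ {A : Set} (h : A → Bool) {v} us → v ∈ us → h v ≡ true → or (map h us) ≡ true
any-edge h (u ∷ us) (here refl) eq rewrite eq = refl
any-edge h (u ∷ us) (there v∈)  eq with h u
... | true  = refl
... | false = any-edge h us v∈ eq

module _ (K : Kripke) where
  open Kripke K
  open Blocks K

  blocks-total : Total blocks
  blocks-total = All.map⁺ (All.universal (λ w → any-edge (edge w) _ (∈-allFin _) (proj₂ (total w))) (allFin size))

  blocks-count : length blocks ≡ size
  blocks-count = trans (length-map block (allFin size)) (length-tabulate id)

  blocks-rows : Rows size blocks
  blocks-rows = All.map⁺ (All.universal (λ w → trans (length-map (edge w) (allFin size)) (length-tabulate id)) (allFin size))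

at : {A : Set} → A → List A → ℕ → A
at z []       n       = z
at z (x ∷ xs) zero    = x
at z (x ∷ xs) (suc n) = at z xs n

at-all : ∀ {A : Set} (z : A) xs {n} → length xs ≡ n → map (λ v → at z xs (toℕ v)) (allFin n) ≡ xs
at-all z xs {n} len = trans (map-tabulate id (λ (v : Fin n) → at z xs (toℕ v))) (tab xs len)
  where
  tab : ∀ xs {n} → length xs ≡ n → tabulate (λ (v : Fin n) → at z xs (toℕ v)) ≡ xs
  tab []       refl = refl
  tab (x ∷ xs) refl = cong (x ∷_) (tab xs refl)

at-All : ∀ {A : Set} {P : A → Set} {z} {xs} → All P xs → ∀ {n} → n < length xs → P (at z xs n)
at-All (p ∷ ps) {zero}  _         = p
at-All (p ∷ ps) {suc n} (s≤s n<) = at-All ps n<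

or-at : ∀ row {n} → length row ≡ n → or row ≡ true → ∃ λ (v : Fin n) → at false row (toℕ v) ≡ true
or-at (true ∷ row)  refl _ = zero , refl
or-at (false ∷ row) refl p = let (v , eq) = or-at row refl p in suc v , eq

-- The converse of encoding: a word that passes the validation comes from a genuine structure, so
-- the evaluation is only ever reached on encodings of instances.
structure : ∀ {k bs} → Rows (length bs) bs → Total bs → k < length bs →
            ∃ λ K → toℕ (Kripke.initial K) ≡ k × Blocks.blocks K ≡ bs
structure {k} {bs} rows tot k< = K , toℕ-fromℕ< k< ,
  trans (map-cong block≡ (allFin n)) (at-all ([] , []) bs refl)
  where
  n : ℕ
  n = length bs

  world : Fin n → Block
  world w = at ([] , []) bs (toℕ w)

  K : Kripke
  K = record
    { size    = n
    ; edge    = λ w v → at false (proj₁ (world w)) (toℕ v)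
    ; total   = λ w → or-at (proj₁ (world w)) (at-All rows (toℕ<n w)) (at-All tot (toℕ<n w))
    ; label   = λ w → map bitsAP (proj₂ (world w))
    ; initial = fromℕ< k<
    }

  block≡ : ∀ w → Blocks.block K w ≡ world w
  block≡ w = cong₂ _,_ (at-all false (proj₁ (world w)) (at-All rows (toℕ<n w)))
    (trans (sym (map-∘ (proj₂ (world w)))) (trans (map-cong apBits-bitsAP _) (map-id _)))

iff : ∀ {a b} → (a ≡ true → b ≡ true) → (b ≡ true → a ≡ true) → a ≡ b
iff {true}  {b}     f g = sym (f refl)
iff {false} {true}  f g = g refl
iff {false} {false} f g = refl

-- Until and release on bounded horizons

-- The value at time t after the first j steps are unfolded.
approx : Symbol → (ℕ → Bool) → (ℕ → Bool) → ℕ → ℕ → Bool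
approx y a b zero    t = initially (` y)
approx y a b (suc j) t = connective (` y) (a t) (b t) (approx y a b j (suc t))

approx-cong : ∀ y {a b a′ b′ : ℕ → Bool} j {p q} → (∀ m → a (p + m) ≡ a′ (q + m)) → (∀ m → b (p + m) ≡ b′ (q + m)) →
              approx y a b j p ≡ approx y a′ b′ j q
approx-cong y zero eqa eqb = refl
approx-cong y {a} {b} {a′} {b′} (suc j) {p} {q} eqa eqb
  rewrite trans (cong a (sym (+-identityʳ p))) (trans (eqa 0) (cong a′ (+-identityʳ q)))
        | trans (cong b (sym (+-identityʳ p))) (trans (eqb 0) (cong b′ (+-identityʳ q))) =
  cong (connective (` y) (a′ q) (b′ q))
       (approx-cong y j (λ m → trans (cong a (sym (+-suc p m))) (trans (eqa (suc m)) (cong a′ (+-suc q m))))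
                        (λ m → trans (cong b (sym (+-suc p m))) (trans (eqb (suc m)) (cong b′ (+-suc q m)))))

Witness : (ℕ → Bool) → (ℕ → Bool) → ℕ → ℕ → Set
Witness a b t i = b (t + i) ≡ true × (∀ l → l < i → a (t + l) ≡ true)

until-witness : ∀ a b j t → approx Uˢ a b j t ≡ true → ∃ λ i → i < j × Witness a b t i
until-witness a b (suc j) t p with ∨-true {b t} p
... | inj₁ q = 0 , z<s , trans (cong b (+-identityʳ t)) q , λ _ ()
... | inj₂ q =
  let (at , rest) = ∧-elim q
      (i , i<j , bi , as) = until-witness a b j (suc t) rest
  in suc i , s<s i<j , trans (cong b (+-suc t i)) bi ,
     λ { zero    _         → trans (cong a (+-identityʳ t)) at
       ; (suc l) (s≤s l<i) → trans (cong a (+-suc t l)) (as l l<i) }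

witness-until : ∀ a b j t {i} → i < j → Witness a b t i → approx Uˢ a b j t ≡ true
witness-until a b (suc j) t {zero} _ (bt , _) =
  cong (_∨ (a t ∧ approx Uˢ a b j (suc t))) (trans (cong b (sym (+-identityʳ t))) bt)
witness-until a b (suc j) t {suc i} (s≤s i<j) (bi , as)
  rewrite trans (cong a (sym (+-identityʳ t))) (as 0 z<s)
        | witness-until a b j (suc t) i<j (trans (cong b (sym (+-suc t i))) bi ,
                                           λ l l<i → trans (cong a (sym (+-suc t l))) (as (suc l) (s<s l<i))) =
  ∨-zeroʳ (b t)

-- De Morgan's law on each unfolding. It reduces the stabilization of releases to that of untils.
release-until : ∀ a b j t → approx Rˢ a b j t ≡ not (approx Uˢ (not ∘ a) (not ∘ b) j t)
release-until a b zero    t = refl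
release-until a b (suc j) t rewrite release-until a b j (suc t) = dual (a t) (b t) _
  where
  dual : ∀ a b g → b ∧ (a ∨ not g) ≡ not (not b ∨ (not a ∧ g))
  dual true  true  g = refl
  dual true  false g = refl
  dual false true  g = refl
  dual false false g = refl

release-elim : ∀ a b j t → approx Rˢ a b j t ≡ true → ∀ k → k < j →
               b (t + k) ≡ true ⊎ ∃ λ l → l < k × a (t + l) ≡ true
release-elim a b (suc j) t p k k<j with ∧-elim {b t} p
release-elim a b (suc j) t p zero    _         | bt , _ = inj₁ (trans (cong b (+-identityʳ t)) bt)
release-elim a b (suc j) t p (suc k) (s≤s k<j) | bt , q with ∨-true {a t} q
... | inj₁ at = inj₂ (0 , z<s , trans (cong a (+-identityʳ t)) at)
... | inj₂ q′ with release-elim a b j (suc t) q′ k k<j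
...   | inj₁ bk            = inj₁ (trans (cong b (+-suc t k)) bk)
...   | inj₂ (l , l<k , al) = inj₂ (suc l , s<s l<k , trans (cong a (+-suc t l)) al)

-- Once `a` holds at time t, having `b` at time t is enough. As long as `a` fails there, it cannot
-- be the releasing position, and the hypothesis passes on to the next time.
release-intro : ∀ a b j t → (∀ k → b (t + k) ≡ true ⊎ ∃ λ l → l < k × a (t + l) ≡ true) → approx Rˢ a b j t ≡ true
release-intro a b zero    t _ = refl
release-intro a b (suc j) t h with h 0 | a t in at
... | inj₁ bt | true  = ∧-intro (trans (cong b (sym (+-identityʳ t))) bt) refl
... | inj₁ bt | false = ∧-intro (trans (cong b (sym (+-identityʳ t))) bt) (release-intro a b j (suc t) later)
  where
  later : ∀ k → b (suc t + k) ≡ true ⊎ ∃ λ l → l < k × a (suc t + l) ≡ true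
  later k with h (suc k)
  ... | inj₁ bk = inj₁ (trans (cong b (sym (+-suc t k))) bk)
  ... | inj₂ (zero , _ , a0) with () ← trans (sym at) (trans (cong a (sym (+-identityʳ t))) a0)
  ... | inj₂ (suc l , s≤s l<k , al) = inj₂ (l , l<k , trans (cong a (sym (+-suc t l))) al)

-- What the pigeonhole principle yields for a sequence driven by at most `H` states: after every
-- time t, two of the next `H + 1` positions have the same future.
Recurs : (ℕ → Bool) → ℕ → Set
Recurs f H = ∀ t → ∃₂ λ p q → p < q × q ≤ H × (∀ m → f (t + p + m) ≡ f (t + q + m))

-- One more unfolding can matter only for a witness exactly `H` steps ahead. Recurrence of `b`
-- suffices, since an earlier witness asks for a shorter stretch of `a`.
until-stable : ∀ a b H → Recurs b H → ∀ t → approx Uˢ a b (suc H) t ≡ approx Uˢ a b H t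
until-stable a b H rec t = iff shrink λ p →
  let (i , i<H , w) = until-witness a b H t p in witness-until a b (suc H) t (m<n⇒m<1+n i<H) w
  where
  -- A first witness after time t + q would have an earlier copy.
  shrink : approx Uˢ a b (suc H) t ≡ true → approx Uˢ a b H t ≡ true
  shrink p with until-witness a b (suc H) t p | rec t
  ... | i , i<1+H , bi , as | l , q , l<q , q≤H , copies with i <? H
  ...   | yes i<H = witness-until a b H t i<H (bi , as)
  ...   | no i≮H = witness-until a b H t (<-≤-trans i′<i (≤-pred i<1+H))
                     (trans (cong b (sym (+-assoc t l (i ∸ q)))) (trans (copies (i ∸ q)) (trans (cong b q≡) bi)) ,
                      λ m m<i′ → as m (<-trans m<i′ i′<i))
    where
    q≤i : q ≤ i
    q≤i = ≤-trans q≤H (≮⇒≥ i≮H)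

    i′<i : l + (i ∸ q) < i
    i′<i = <-≤-trans (+-monoˡ-< (i ∸ q) l<q) (≤-reflexive (m+[n∸m]≡n q≤i))

    q≡ : t + q + (i ∸ q) ≡ t + i
    q≡ = trans (+-assoc t q (i ∸ q)) (cong (t +_) (m+[n∸m]≡n q≤i))

release-stable : ∀ a b H → Recurs b H → ∀ t → approx Rˢ a b (suc H) t ≡ approx Rˢ a b H t
release-stable a b H rec t = trans (release-until a b (suc H) t)
  (trans (cong not (until-stable (not ∘ a) (not ∘ b) H rec′ t)) (sym (release-until a b H t)))
  where
  rec′ : Recurs (not ∘ b) H
  rec′ t = let (p , q , p<q , q≤H , eq) = rec t in p , q , p<q , q≤H , cong not ∘ eq

stable-from : ∀ y a b H → (∀ t → approx y a b (suc H) t ≡ approx y a b H t) →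
              ∀ m t → approx y a b (m + H) t ≡ approx y a b H t
stable-from y a b H st zero    t = refl
stable-from y a b H st (suc m) t = trans (cong (connective (` y) (a t) (b t)) (stable-from y a b H st m (suc t))) (st t)

val-bound : ∀ bs → val bs ≤ val (trues (length bs))
val-bound []           = z≤n
val-bound (true ∷ bs)  = s≤s (*-monoʳ-≤ 2 (val-bound bs))
val-bound (false ∷ bs) = ≤-trans (*-monoʳ-≤ 2 (val-bound bs)) (n≤1+n _)

val-injective : ∀ as bs → length as ≡ length bs → val as ≡ val bs → as ≡ bs
val-injective []           []           _   _  = refl
val-injective (true ∷ as)  (true ∷ bs)  len eq =
  cong (true ∷_) (val-injective as bs (suc-injective len) (*-cancelˡ-≡ _ _ 2 (suc-injective eq)))
val-injective (false ∷ as) (false ∷ bs) len eq =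
  cong (false ∷_) (val-injective as bs (suc-injective len) (*-cancelˡ-≡ _ _ 2 eq))
val-injective (true ∷ as)  (false ∷ bs) len eq = contradiction (sym eq) (even≢odd (val bs) (val as))
val-injective (false ∷ as) (true ∷ bs)  len eq = contradiction eq (even≢odd (val as) (val bs))

-- Evaluation on the sequence of sets of worlds

module Valuation (k n : ℕ) (bs : List Block) (y : Symbol) (Y : List Symbol)
                 (rows : Rows n bs) (count : length bs ≡ n) (y-formula : isKripke (` y) ≡ false)
                 (ws₀ : List Bool) (length-ws₀ : length ws₀ ≡ n) where

  open Run k n bs y Y rows count y-formula ws₀ length-ws₀ public
  open Passes k n bs y Y rows count y-formula ws₀ length-ws₀ public

  -- Conjunction goes through `approx` as well, although its unfolding ignores the value from the
  -- next time: then all three binary connectives share their lemmas about sweeps.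
  value : Formula → ℕ → Bool
  value (pos p)  t = Truth (worlds t) posˢ (apBits p)
  value (neg p)  t = Truth (worlds t) negˢ (apBits p)
  value (φ ∧ᶠ ψ) t = approx ∧ˢ (value φ) (value ψ) H t
  value (φ ∨ᶠ ψ) t = false
  value (X φ)    t = value φ (suc t)
  value (φ U ψ)  t = approx Uˢ (value φ) (value ψ) H t
  value (φ R ψ)  t = approx Rˢ (value φ) (value ψ) H t

  worlds-cong : ∀ {p q} → worlds p ≡ worlds q → ∀ m → worlds (p + m) ≡ worlds (q + m)
  worlds-cong {p} {q} eq zero    rewrite +-identityʳ p | +-identityʳ q = eq
  worlds-cong {p} {q} eq (suc m) rewrite +-suc p m | +-suc q m =
    trans (worlds-suc (p + m)) (trans (cong (Text.Post k n bs y Y rows count y-formula) (worlds-cong {p} {q} eq m))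
                                (sym (worlds-suc (q + m))))

  -- The set of worlds at one time determines all later sets, and the truth of an atom is read off
  -- the current set.
  value-cong : ∀ φ {p q} → worlds p ≡ worlds q → value φ p ≡ value φ q
  value-cong′ : ∀ φ {p q} → worlds p ≡ worlds q → ∀ m → value φ (p + m) ≡ value φ (q + m)
  value-cong′ φ {p} {q} eq m = value-cong φ {p + m} {q + m} (worlds-cong {p} {q} eq m)

  value-cong₂ : ∀ φ ψ c {p q} → worlds p ≡ worlds q →
                approx c (value φ) (value ψ) H p ≡ approx c (value φ) (value ψ) H q
  value-cong₂ φ ψ c {p} {q} eq = approx-cong c {value φ} {value ψ} {value φ} {value ψ} H {p} {q}
    (value-cong′ φ {p} {q} eq) (value-cong′ ψ {p} {q} eq)

  value-cong (pos p)  eq = cong (λ ws → Truth ws posˢ (apBits p)) eq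
  value-cong (neg p)  eq = cong (λ ws → Truth ws negˢ (apBits p)) eq
  value-cong (φ ∧ᶠ ψ) {p} {q} eq = value-cong₂ φ ψ ∧ˢ {p} {q} eq
  value-cong (φ ∨ᶠ ψ) eq = refl
  value-cong (X φ) {p} {q} eq = value-cong φ {suc p} {suc q}
    (trans (cong worlds (+-comm 1 p)) (trans (worlds-cong {p} {q} eq 1) (cong worlds (+-comm q 1))))
  value-cong (φ U ψ)  {p} {q} eq = value-cong₂ φ ψ Uˢ {p} {q} eq
  value-cong (φ R ψ)  {p} {q} eq = value-cong₂ φ ψ Rˢ {p} {q} eq

  -- There are at most H sets of worlds.
  value-recurs : ∀ φ → Recurs (value φ) H
  value-recurs φ t with pigeonhole {n = suc H} (n<1+n H) (λ j → fromℕ< (bound (t + toℕ j)))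
    where
    bound : ∀ t → val (worlds t) < H
    bound t = s≤s (≤-trans (val-bound (worlds t)) (≤-reflexive (cong (val ∘ trues) (length-worlds t))))
  ... | i , j , i<j , eq = toℕ i , toℕ j , i<j , ≤-pred (toℕ<n j) , value-cong′ φ {t + toℕ i} {t + toℕ j}
    (val-injective _ _ (trans (length-worlds (t + toℕ i)) (sym (length-worlds (t + toℕ j)))) (fromℕ<-injective _ _ _ _ eq))

  -- By stability the approximation with `H` unfoldings solves the expansion law. This is why a
  -- value that is exact at the end of its pass stays exact under all further sweeps.
  binary-symbolic : ∀ {c s a b} {vs : ℕ → List Bool} → IsConnective c → (∀ t → approx c a b (suc H) t ≡ approx c a b H t) →
    Symbolic c s (λ t → a t ∷ b t ∷ vs t) (approx c a b H) (λ t → approx c a b H t ∷ vs t)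
  binary-symbolic {c} {s} {a} {b} {vs} con stable = record
    { app       = approx c a b
    ; app-zero  = λ _ → refl
    ; app-step  = λ j t → _ , Sweep.binary con
    ; app-final = λ _ → refl
    ; step      = λ t → subst (λ w → Sweep.Update _ c s (a t ∷ b t ∷ vs t) (approx c a b H (suc t)) w (w ∷ vs t))
                              (stable t) (Sweep.binary {vs = vs t} con)
    }

  meaning-bits : ∀ {s gs vs} l → Meaning s gs vs → ∃ λ gs′ → Meaning (bits l ++ s) gs′ vs
  meaning-bits []      μ = _ , μ
  meaning-bits (_ ∷ l) μ = _ , record
    { app = λ _ _ → false ; app-zero = λ _ → refl ; app-step = λ _ _ → _ , Sweep.bit ; app-final = λ _ → refl
    ; step = λ _ → Sweep.bit } ∷ proj₂ (meaning-bits l μ)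

  meaning-atom : ∀ {h s gs vs} p → IsAtom h → headBit s ≡ false → Meaning s gs vs →
                 ∃ λ gs′ → Meaning (h ∷ encodeAP p ++ s) gs′ (λ t → Truth (worlds t) h (apBits p) ∷ vs t)
  meaning-atom {h} {s} p at end μ rewrite encodeAP-bits p = _ , record
    { app = λ _ _ → false ; app-zero = λ _ → plain at
    ; app-step = λ _ _ → _ , Sweep.atom {ds = apBits p} {s} at end ; app-final = λ _ → refl
    ; step = λ _ → Sweep.atom {ds = apBits p} {s} at end } ∷ proj₂ (meaning-bits (apBits p) μ)
    where
    plain : ∀ {h} → IsAtom h → initially (` h) ≡ false
    plain posˢ = refl
    plain negˢ = refl

  headBit-formula : ∀ φ s → headBit (encodeFormula φ ++ s) ≡ false
  headBit-formula (pos p)  s = refl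
  headBit-formula (neg p)  s = refl
  headBit-formula (φ ∧ᶠ ψ) s = refl
  headBit-formula (φ ∨ᶠ ψ) s = refl
  headBit-formula (X φ)    s = refl
  headBit-formula (φ U ψ)  s = refl
  headBit-formula (φ R ψ)  s = refl

  meaning : ∀ φ {s gs vs} → SplitFree φ → headBit s ≡ false → Meaning s gs vs →
            ∃ λ gs′ → Meaning (encodeFormula φ ++ s) gs′ (λ t → value φ t ∷ vs t)
  meaning-binary : ∀ φ ψ {c s gs vs} → IsConnective c → SplitFree φ → SplitFree ψ →
    (∀ t → approx c (value φ) (value ψ) (suc H) t ≡ approx c (value φ) (value ψ) H t) → headBit s ≡ false → Meaning s gs vs →
    ∃ λ gs′ → Meaning (c ∷ (encodeFormula φ ++ encodeFormula ψ) ++ s) gs′ (λ t → approx c (value φ) (value ψ) H t ∷ vs t)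

  meaning (pos p)  _       end μ = meaning-atom p posˢ end μ
  meaning (neg p)  _       end μ = meaning-atom p negˢ end μ
  meaning (φ ∧ᶠ ψ) (f , g) end μ = meaning-binary φ ψ ∧ˢ f g (λ _ → refl) end μ
  meaning (X φ)    f       end μ = _ , record
    -- A single sweep replaces the value written at activation by the exact value of the operand.
    { app       = λ { zero _ → false ; (suc _) t → value φ t }
    ; app-zero  = λ _ → refl
    ; app-step  = λ _ _ → _ , Sweep.next
    ; app-final = λ _ → refl
    ; step      = λ _ → Sweep.next
    } ∷ proj₂ (meaning φ f end μ)
  meaning (φ U ψ)  (f , g) end μ = meaning-binary φ ψ Uˢ f g (until-stable (value φ) (value ψ) H (value-recurs ψ)) end μ
  meaning (φ R ψ)  (f , g) end μ = meaning-binary φ ψ Rˢ f g (release-stable (value φ) (value ψ) H (value-recurs ψ)) end μ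

  meaning-binary φ ψ {s = s} {vs = vs} con f g stable end μ rewrite ++-assoc (encodeFormula φ) (encodeFormula ψ) s =
    _ , binary-symbolic {a = value φ} {value ψ} {vs} con stable ∷
        proj₂ (meaning φ f (headBit-formula ψ s) (proj₂ (meaning ψ g end μ)))

-- Team semantics

foldl-∨ : ∀ {A : Set} (h : A → Bool) a ws → foldl (λ a w → a ∨ h w) a ws ≡ true → a ≡ true ⊎ ∃ λ w → h w ≡ true
foldl-∨ h a []       p = inj₁ p
foldl-∨ h a (w ∷ ws) p with foldl-∨ h (a ∨ h w) ws p
... | inj₁ q = Sum.map₂ (w ,_) (∨-true q)
... | inj₂ q = inj₂ q

∨-foldl : ∀ {A : Set} (h : A → Bool) ws → foldl (λ a w → a ∨ h w) true ws ≡ true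
∨-foldl h []       = refl
∨-foldl h (w ∷ ws) = ∨-foldl h ws

foldl-∈ : ∀ {A : Set} (h : A → Bool) a {w} ws → w ∈ ws → h w ≡ true → foldl (λ a w → a ∨ h w) a ws ≡ true
foldl-∈ h a (w ∷ ws) (here refl) p rewrite p | ∨-zeroʳ a = ∨-foldl h ws
foldl-∈ h a (w ∷ ws) (there w∈)  p = foldl-∈ h (a ∨ h w) ws w∈ p

tabulate-false : ∀ n → falses n ≡ tabulate {n = n} (const false)
tabulate-false zero    = refl
tabulate-false (suc n) = cong (false ∷_) (tabulate-false n)

mark-tabulate : ∀ {n} (i : Fin n) → mark (toℕ i) (falses n) ≡ tabulate (λ w → does (i Fin.≟ w))
mark-tabulate {suc n} zero    = cong (true ∷_) (tabulate-false n)
mark-tabulate {suc n} (suc i) = cong (false ∷_) (mark-tabulate i)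

map-allFin : ∀ {A : Set} {n} (h : Fin n → A) → tabulate h ≡ map h (allFin n)
map-allFin h = sym (map-tabulate id h)

addRow-map : ∀ {A : Set} w (α β : A → Bool) us → addRow w (map α us) (map β us) ≡ map (λ v → α v ∨ (w ∧ β v)) us
addRow-map w α β []       = refl
addRow-map w α β (u ∷ us) = cong (_ ∷_) (addRow-map w α β us)

eqBits-refl : ∀ l → eqBits l l ≡ true
eqBits-refl []          = refl
eqBits-refl (true ∷ l)  = eqBits-refl l
eqBits-refl (false ∷ l) = eqBits-refl l

eqBits-sound : ∀ l m → eqBits l m ≡ true → l ≡ m
eqBits-sound []          []          _ = refl
eqBits-sound (true ∷ l)  (true ∷ m)  p = cong (true ∷_) (eqBits-sound l m p)
eqBits-sound (false ∷ l) (false ∷ m) p = cong (false ∷_) (eqBits-sound l m p)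

eqBits-ap : ∀ p q → eqBits (apBits p) (apBits q) ≡ does (p ≟ q)
eqBits-ap p q with p ≟ q
... | yes refl = trans (eqBits-refl (apBits p)) (sym (dec-true (p ≟ p) refl))
... | no p≢q = trans differ (sym (dec-false (p ≟ q) p≢q))
  where
  differ : eqBits (apBits p) (apBits q) ≡ false
  differ with eqBits (apBits p) (apBits q) in eq
  ... | true  = contradiction (apBits-injective (eqBits-sound _ _ eq)) p≢q
  ... | false = refl

has-label : ∀ b p qs → has b (apBits p) (map apBits qs) ≡ b ∨ does (p ∈? qs)
has-label b p []       = sym (∨-identityʳ b)
has-label b p (q ∷ qs) = trans (has-label (b ∨ eqBits (apBits p) (apBits q)) p qs)
  (trans (∨-assoc b _ _) (cong (λ c → b ∨ (c ∨ does (p ∈? qs))) (eqBits-ap p q)))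

module Worlds (K : Kripke) where
  open Kripke K
  open Path
  open Blocks K

  us : List (Fin size)
  us = allFin size

  reached : ℕ → Fin size → Bool
  reached zero    w = does (initial Fin.≟ w)
  reached (suc k) v = foldl (λ b w → b ∨ (reached k w ∧ edge w v)) false us

  reached-path : ∀ π k → reached k (Path.at π k) ≡ true
  reached-path π zero rewrite Path.start π with initial Fin.≟ initial
  ... | yes _ = refl
  ... | no ¬p = contradiction refl ¬p
  reached-path π (suc k) =
    foldl-∈ (λ w → reached k w ∧ edge w (Path.at π (suc k))) false us (∈-allFin (Path.at π k))
            (∧-intro (reached-path π k) (follow π k))

  -- Following the successors chosen by left-totality prolongs every finite path. It is needed in
  -- `path-to`, where a reached world has to lie on an infinite path.
  walk : Fin size → ℕ → Fin size
  walk w zero    = w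
  walk w (suc i) = walk (proj₁ (total w)) i

  walk-follows : ∀ w i → edge (walk w i) (walk w (suc i)) ≡ true
  walk-follows w zero    = proj₂ (total w)
  walk-follows w (suc i) = walk-follows (proj₁ (total w)) i

  Follows : (ℕ → Fin size) → Set
  Follows h = ∀ i → edge (h i) (h (suc i)) ≡ true

  -- The first k + 1 worlds of h, followed by h′.
  splice : ℕ → (ℕ → Fin size) → (ℕ → Fin size) → ℕ → Fin size
  splice k       h h′ zero    = h 0
  splice zero    h h′ (suc i) = h′ i
  splice (suc k) h h′ (suc i) = splice k (h ∘ suc) h′ i

  splice-first : ∀ k h h′ → splice k h h′ 0 ≡ h 0
  splice-first zero    h h′ = refl
  splice-first (suc k) h h′ = refl

  splice-follows : ∀ k h h′ → Follows h → Follows h′ → edge (h k) (h′ 0) ≡ true → Follows (splice k h h′)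
  splice-follows zero    h h′ f f′ e zero    = e
  splice-follows zero    h h′ f f′ e (suc i) = f′ i
  splice-follows (suc k) h h′ f f′ e zero    = trans (cong (edge (h 0)) (splice-first k (h ∘ suc) h′)) (f 0)
  splice-follows (suc k) h h′ f f′ e (suc i) = splice-follows k (h ∘ suc) h′ (f ∘ suc) f′ e i

  splice-next : ∀ k h h′ → splice k h h′ (suc k) ≡ h′ 0
  splice-next zero    h h′ = refl
  splice-next (suc k) h h′ = splice-next k (h ∘ suc) h′

  path-to : ∀ k w → reached k w ≡ true → ∃ λ π → Path.at π k ≡ w
  path-to zero w eq with initial Fin.≟ w
  ... | yes p = record { at = walk initial ; start = refl ; follow = walk-follows initial } , p
  path-to (suc k) v eq with foldl-∨ (λ w → reached k w ∧ edge w v) false us eq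
  ... | inj₂ (w , both) =
    let (rw , e) = ∧-elim both
        (π , at≡) = path-to k w rw
    in record
      { at     = splice k (Path.at π) (walk v)
      ; start  = trans (splice-first k (Path.at π) (walk v)) (Path.start π)
      ; follow = splice-follows k (Path.at π) (walk v) (follow π) (walk-follows v)
                   (subst (λ u → edge u v ≡ true) (sym at≡) e)
      } , splice-next k (Path.at π) (walk v)

  judge : Bool → Bool → Bool → Bool
  judge q w p = not w ∨ not (q xor p)

  holdsAt : Bool → AP → ℕ → Fin size → Bool
  holdsAt q p k w = judge q (reached k w) (does (p ∈? label w))

  obeys-elim : ∀ {q p s b w c} vs → obeys q (apBits p) b w c (map block vs) (map s vs) ≡ true →
    b ≡ true × judge q w c ≡ true × (∀ {v} → v ∈ vs → judge q (s v) (does (p ∈? label v)) ≡ true)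
  obeys-elim [] eq = let (x , y) = ∧-elim eq in x , y , λ ()
  obeys-elim {q} {p} {s} (v ∷ vs) eq =
    let (x , y , all) = obeys-elim {q} {p} {s} vs eq
        (b , j) = ∧-elim x
        y′ = trans (cong (judge q (s v)) (sym (has-label false p (label v)))) y
    in b , j , λ { (here refl) → y′ ; (there v∈) → all v∈ }

  obeys-intro : ∀ {q p s b w c} vs → b ≡ true → judge q w c ≡ true →
    (∀ v → judge q (s v) (does (p ∈? label v)) ≡ true) → obeys q (apBits p) b w c (map block vs) (map s vs) ≡ true
  obeys-intro [] b j all = ∧-intro b j
  obeys-intro {q} {p} {s} (v ∷ vs) b j all =
    obeys-intro {q} {p} {s} vs (∧-intro b j) (trans (cong (judge q (s v)) (has-label false p (label v))) (all v)) all

  length-start : length (mark (toℕ initial) (falses size)) ≡ size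
  length-start = trans (cong length (mark-tabulate initial)) (length-tabulate _)

  -- An exchange of loops: the machine goes through the sources and updates all targets, whereas
  -- `reached` fixes a target and goes through the sources.
  successors-map : ∀ (s α : Fin size → Bool) vs → successors (map block vs) (map s vs) (map α us) ≡
    map (λ v → foldl (λ b w → b ∨ (s w ∧ edge w v)) (α v) vs) us
  successors-map s α []       = refl
  successors-map s α (v ∷ vs) = trans (cong (successors (map block vs) (map s vs)) (addRow-map (s v) α (edge v) us))
                                      (successors-map s (λ u → α u ∨ (s v ∧ edge v u)) vs)

  module Model (y : Symbol) (Y : List Symbol) (y-formula : isKripke (` y) ≡ false) where

    open Valuation (toℕ initial) size blocks y Y (blocks-rows K) (blocks-count K) y-formula
                   (mark (toℕ initial) (falses size)) length-start public

    worlds-reached : ∀ k → worlds k ≡ map (reached k) us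
    worlds-reached zero    = trans (mark-tabulate initial) (map-allFin _)
    worlds-reached (suc k) = trans (worlds-suc k) (trans
      (cong₂ (successors blocks) (worlds-reached k) (trans (tabulate-false size) (map-allFin (const false))))
      (successors-map (reached k) (const false) us))

    truth-elim : ∀ {h} p k → Truth (worlds k) h (apBits p) ≡ true → ∀ w → holdsAt (isPos (` h)) p k w ≡ true
    truth-elim {h} p k eq w = proj₂ (proj₂ (obeys-elim {isPos (` h)} {p} {reached k} us
      (trans (cong (λ ws → Truth ws h (apBits p)) (sym (worlds-reached k))) eq))) (∈-allFin w)

    truth-intro : ∀ {h} p k → (∀ w → holdsAt (isPos (` h)) p k w ≡ true) → Truth (worlds k) h (apBits p) ≡ true
    truth-intro {h} p k all = trans (cong (λ ws → Truth ws h (apBits p)) (worlds-reached k))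
      (obeys-intro {isPos (` h)} {p} {reached k} us refl refl all)

    From : ℕ → Team
    From k u = ∃ λ π → u ≋ suffix k (trace π)

    from-suffix : ∀ {T : Team} {k} → T ≐ From k → ∀ j → (T [ j ,∞⟩) ≐ From (k + j)
    from-suffix {T} {k} (T⊆ , ⊆T) j =
      (λ (t , t∈ , u≋) → let (π , t≋) = T⊆ t∈ in
        π , λ i p → trans (u≋ i p) (trans (t≋ (j + i) p) (cong (λ l → trace π l p) (sym (+-assoc k j i))))) ,
      λ (π , u≋) → suffix k (trace π) , ⊆T (π , λ _ _ → refl) ,
        λ i p → trans (u≋ i p) (cong (λ l → trace π l p) (+-assoc k j i))

    at-time : ∀ {k t p} π → t ≋ suffix k (trace π) → t 0 p ≡ does (p ∈? label (Path.at π k))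
    at-time {k} {p = p} π t≋ = trans (t≋ 0 p) (cong (λ l → trace π l p) (+-identityʳ k))

    judge-elim : ∀ q {w c} → judge q w c ≡ true → w ≡ true → c ≡ q
    judge-elim true  {c = true}  p refl = refl
    judge-elim false {c = false} p refl = refl
    judge-elim true  {c = false} () refl
    judge-elim false {c = true}  () refl

    judge-intro : ∀ q {w c} → (w ≡ true → c ≡ q) → judge q w c ≡ true
    judge-intro q {false} f = refl
    judge-intro true  {true} f rewrite f refl = refl
    judge-intro false {true} f rewrite f refl = refl

    truth-sound : ∀ {T : Team} {k h} p → T ≐ From k → Truth (worlds k) h (apBits p) ≡ true → ∀ t → T t → t 0 p ≡ isPos (` h)
    truth-sound {k = k} {h} p (T⊆ , _) eq t t∈ =
      let (π , t≋) = T⊆ t∈ in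
      trans (at-time π t≋) (judge-elim (isPos (` h)) (truth-elim p k eq (Path.at π k)) (reached-path π k))

    truth-complete : ∀ {T : Team} {k h} p → T ≐ From k → (∀ t → T t → t 0 p ≡ isPos (` h)) →
                     Truth (worlds k) h (apBits p) ≡ true
    truth-complete {k = k} {h} p (_ , ⊆T) all = truth-intro p k λ w → judge-intro (isPos (` h)) λ rw →
      let (π , at≡) = path-to k w rw in
      trans (cong (λ u → does (p ∈? label u)) (sym at≡))
            (trans (sym (at-time {p = p} π (λ _ _ → refl))) (all (suffix k (trace π)) (⊆T (π , λ _ _ → refl))))

    -- The team is arbitrary up to `≐`, because the suffix teams in the definition of satisfaction
    -- agree with `From` only extensionally. Deciding `value` first and comparing afterwards keeps
    -- the argument constructive.
    sound    : ∀ φ {T : Team} {k} → SplitFree φ → T ≐ From k → value φ k ≡ true → T ⊨ φ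
    complete : ∀ φ {T : Team} {k} → SplitFree φ → T ≐ From k → T ⊨ φ → value φ k ≡ true

    sound (pos p)  _       T≐ eq = lift (truth-sound {h = posˢ} p T≐ eq)
    sound (neg p)  _       T≐ eq = lift (truth-sound {h = negˢ} p T≐ eq)
    sound (φ ∧ᶠ ψ) (f , g) T≐ eq = let (a , b) = ∧-elim eq in sound φ f T≐ a , sound ψ g T≐ b
    sound (X φ) {k = k} f  T≐ eq = sound φ f (from-suffix T≐ 1) (trans (cong (value φ) (+-comm k 1)) eq)
    sound (φ U ψ) {k = k} (f , g) T≐ eq =
      let (i , _ , b , as) = until-witness (value φ) (value ψ) H k eq
      in i , sound ψ g (from-suffix T≐ i) b , λ j j<i → sound φ f (from-suffix T≐ j) (as j j<i)
    sound (φ R ψ) {k = k} (f , g) T≐ eq i =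
      Sum.map (sound ψ g (from-suffix T≐ i)) (λ (j , j<i , a) → j , j<i , sound φ f (from-suffix T≐ j) a)
        (release-elim (value φ) (value ψ) (suc i + H) k
          -- A release must be verified at every distance i, possibly beyond `H`. Stability allows
          -- the horizon to be raised above i.
          (trans (stable-from Rˢ (value φ) (value ψ) H (release-stable (value φ) (value ψ) H (value-recurs ψ)) (suc i) k) eq)
          i (m≤m+n (suc i) H))

    complete (pos p)  _       T≐ sat = truth-complete {h = posˢ} p T≐ (lower sat)
    complete (neg p)  _       T≐ sat = truth-complete {h = negˢ} p T≐ (lower sat)
    complete (φ ∧ᶠ ψ) (f , g) T≐ (a , b) = ∧-intro (complete φ f T≐ a) (complete ψ g T≐ b)
    complete (X φ) {k = k} f  T≐ sat = trans (cong (value φ) (+-comm 1 k)) (complete φ f (from-suffix T≐ 1) sat)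
    complete (φ U ψ) {k = k} (f , g) T≐ (i , b , as) =
      -- The given witness i may lie beyond `H`; it is found with a larger horizon, and stability
      -- brings the horizon back to `H`.
      trans (sym (stable-from Uˢ (value φ) (value ψ) H (until-stable (value φ) (value ψ) H (value-recurs ψ)) (suc i) k))
        (witness-until (value φ) (value ψ) (suc i + H) k (m≤m+n (suc i) H)
          (complete ψ g (from-suffix T≐ i) b , λ j j<i → complete φ f (from-suffix T≐ j) (as j j<i)))
    complete (φ R ψ) {k = k} (f , g) T≐ sat = release-intro (value φ) (value ψ) H k λ i →
      Sum.map (complete ψ g (from-suffix T≐ i)) (λ (j , j<i , a) → j , j<i , complete φ f (from-suffix T≐ j) a) (sat i)

-- Length of the input and range of the clock

length-digits : ∀ l S → length S ≤ length (bits l ++ S)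
length-digits []      S = ≤-refl
length-digits (_ ∷ l) S = m≤n⇒m≤1+n (length-digits l S)

length-labels : ∀ ls S → length S ≤ length (labelsText ls S)
length-labels []       S = ≤-refl
length-labels (l ∷ ls) S = m≤n⇒m≤1+n (≤-trans (length-labels ls S) (length-digits l _))

length-row : ∀ row S → or row ≡ true → suc (length S) ≤ length (bits row ++ S)
length-row (_ ∷ row) S _ = s≤s (length-digits row S)

-- Every world contributes two symbols: its header and at least one bit of its row, since the row
-- has an edge. The second summand gives the slack that `clock` needs.
length-blocks : ∀ bs S → Total bs → length bs + (length bs + length S) ≤ length (blocksText bs S)
length-blocks []                S []       = ≤-refl
length-blocks ((row , ls) ∷ bs) S (p ∷ ps) = s≤s (≤-trans (≤-reflexive (+-suc (length bs) _))
  (≤-trans (s≤s (≤-trans (length-blocks bs S ps) (length-labels ls _))) (length-row row _ p)))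

length-text : ∀ k bs S → Total bs → length bs + (length bs + length S) ≤ length (text k bs S)
length-text zero    bs S ps = length-blocks bs S ps
length-text (suc k) bs S ps = m≤n⇒m≤1+n (length-text k bs S ps)

1+n≤2^n : ∀ n → suc n ≤ 2 ^ n
1+n≤2^n zero    = ≤-refl
1+n≤2^n (suc n) = ≤-trans (+-mono-≤ (≤-trans (s≤s z≤n) (1+n≤2^n n)) (1+n≤2^n n))
                          (≤-reflexive (cong (2 ^ n +_) (sym (+-identityʳ (2 ^ n)))))

-- The clock suffices for a pass for every symbol of the formula.
clock : ∀ n m l → 0 < n → n + (n + m) ≤ l → ∃ λ t → val (trues l) ≡ m * suc (val (trues n)) + suc t
clock n m l 0<n n+n+m≤l with m≤n⇒∃[o]m+o≡n (≤-pred (≤-trans bound (≤-reflexive (sym (val-trues l)))))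
  where
  open ≤-Reasoning

  enough : suc m + n ≤ l
  enough = ≤-trans (≤-trans (≤-reflexive (cong suc (+-comm m n))) (+-monoˡ-≤ (n + m) 0<n)) n+n+m≤l

  -- The summand 1 is the sweep that must remain after the m passes, and the outer `suc` is there
  -- because l digits 1 have the value 2^l - 1. The estimate rests on m + 2 ≤ 2^(m + 1).
  bound : suc (m * suc (val (trues n)) + 1) ≤ 2 ^ l
  bound = begin
    suc (m * suc (val (trues n)) + 1) ≡⟨ cong (λ h → suc (m * h + 1)) (val-trues n) ⟩
    suc (m * 2 ^ n + 1)               ≡⟨ sym (+-suc (m * 2 ^ n) 1) ⟩
    m * 2 ^ n + 2                     ≤⟨ +-monoʳ-≤ (m * 2 ^ n) (*-monoʳ-≤ 2 (≤-trans (s≤s z≤n) (1+n≤2^n n))) ⟩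
    m * 2 ^ n + 2 * 2 ^ n             ≡⟨ sym (*-distribʳ-+ (2 ^ n) m 2) ⟩
    (m + 2) * 2 ^ n                   ≡⟨ cong (_* 2 ^ n) (trans (+-suc m 1) (cong suc (+-comm m 1))) ⟩
    (1 + suc m) * 2 ^ n               ≤⟨ *-monoˡ-≤ (2 ^ n) (1+n≤2^n (suc m)) ⟩
    2 ^ suc m * 2 ^ n                 ≡⟨ sym (^-distribˡ-+-* 2 (suc m) n) ⟩
    2 ^ (suc m + n)                   ≤⟨ ^-monoʳ-≤ 2 enough ⟩
    2 ^ l                             ∎
... | t , eq = t , trans (sym eq) (+-assoc (m * suc (val (trues n))) 1 t)

≡ᵇ-refl : ∀ n → (n ≡ᵇ n) ≡ true
≡ᵇ-refl zero    = refl
≡ᵇ-refl (suc n) = ≡ᵇ-refl n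

lengths-complete : ∀ {n} bs → Rows n bs → lengths true n bs ≡ true
lengths-complete         []       []            = refl
lengths-complete {n = n} (b ∷ bs) (refl ∷ rows) rewrite ≡ᵇ-refl n = lengths-complete bs rows

lengths-sound : ∀ {p n} bs → lengths p n bs ≡ true → p ≡ true × Rows n bs
lengths-sound             []               eq = eq , []
lengths-sound {p} {n} ((row , _) ∷ bs) eq with lengths-sound {p ∧ (n ≡ᵇ length row)} bs eq
... | q , rows with p | n ≡ᵇ length row in eq′
...   | true | true = refl , sym (≡ᵇ⇒≡ n (length row) (Equivalence.from T-≡ eq′)) ∷ rows

-- The decision procedure

r₀ : Reg
r₀ = reg atStart false false false false false

Outcome : List Symbol → Bool → Set
Outcome x b = ∃₂ λ r σ → main ⊢ (r₀ , loaded x) ⇓[ length x ] (r , σ) × Reg.res r ≡ b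

afterScan : List Symbol → Fin 5 × List Symbol → List Bool → List Bool → Conf
afterScan x (q , z) m₀ m₁ = st (reg q false false false false false)
  (◂ x) (◂ z) (◂ replicate (length z) tick) (◂ replicate (length z) (bit false))
  (◂ bits (trues (length x))) (◂ bits (trues (length x))) (◂ bits m₀) (◂ bits m₀) (◂ bits m₀) (◂ bits m₁)

Rejects : List Symbol → Set
Rejects x = Outcome x false

rejects-shape : ∀ x → accepted (proj₁ (phases atStart x)) ≡ false → Rejects x
rejects-shape x eq = _ , _ , no-cost (scan-run x ⨾ ite-false eq act) , refl

module Shape (k n : ℕ) (bs : List Block) (y : Symbol) (Y : List Symbol) (count : length bs ≡ n)
             (0<n : 0 < n) (total : Total bs) (start : StartsFormula (y ∷ Y)) where

  S input : List Symbol
  S = y ∷ Y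
  input = text k bs S

  y-formula : isKripke (` y) ≡ false
  y-formula = opens-kripke start
    where
    opens-kripke : ∀ {y Y} → StartsFormula (y ∷ Y) → isKripke (` y) ≡ false
    opens-kripke (starts {posˢ} _ _) = refl
    opens-kripke (starts {negˢ} _ _) = refl
    opens-kripke (starts {∧ˢ} _ _)   = refl
    opens-kripke (starts {Xˢ} _ _)   = refl
    opens-kripke (starts {Uˢ} _ _)   = refl
    opens-kripke (starts {Rˢ} _ _)   = refl

  through-scan : ∀ {τ} → rowsCheck ⨾ ite isRes (clear ⨾ polishCheck ⨾ ite isRes core reject) reject
                         ⊢ afterScan input (inFormula , S) (falses n) (trues n) ⇓ τ →
                 main ⊢ (r₀ , loaded input) ⇓[ length input ] τ
  through-scan d = no-cost ((scan-run input ⇒ read) ⨾ ite-true refl d)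
    where
    read : afterScan input (phases atStart input) (marks false input) (marks true input) ≡
           afterScan input (inFormula , S) (falses n) (trues n)
    read rewrite phases-text k bs (subst (0 <_) (sym count) 0<n) total start
                  | marks-text false k bs start | marks-text true k bs start | count = refl

  afterRows : Reg → Conf
  afterRows r = st r (◂ input) (◂ S) (◂ replicate (length S) tick) (◂ replicate (length S) (bit false))
    (◂ bits (trues (length input))) (◂ bits (trues (length input)))
    (◂ bits (falses n)) (◂ bits (falses n)) (◂ bits (mark k (falses n))) (◂ bits (trues n))

  through-rows : ∃ λ r → Reg.res r ≡ lengths true n bs ∧ (k <ᵇ n) ×
    (∀ {τ} → ite isRes (clear ⨾ polishCheck ⨾ ite isRes core reject) reject ⊢ afterRows r ⇓ τ →
             main ⊢ (r₀ , loaded input) ⇓[ length input ] τ)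
  through-rows =
    let (r , eq , d) = rows-run {ws = falses n} {falses n} k bs y-formula
    in r , trans eq (cong₂ (λ l m → lengths true l bs ∧ (k <ᵇ m)) (length-replicate n) (length-replicate n)) ,
       λ d′ → through-scan (d ⨾ d′)

  rejects-rows : lengths true n bs ∧ (k <ᵇ n) ≡ false → Rejects input
  rejects-rows eq = let (_ , res , d) = through-rows in _ , _ , d (ite-false (trans res eq) act) , refl

  through-polish : lengths true n bs ∧ (k <ᵇ n) ≡ true → ∃₂ λ r v → width v ≡ length S × Reg.res r ≡ isCount (polish S) ×
    (∀ {τ} → ite isRes core reject ⊢
             st r (◂ input) (◂ S) (◂ replicate (length S) tick) v
                (◂ bits (trues (length input))) (◂ bits (trues (length input)))
                (◂ bits (falses n)) (◂ bits (falses n)) (◂ bits (mark k (falses n))) (◂ bits (trues n)) ⇓ τ →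
             main ⊢ (r₀ , loaded input) ⇓[ length input ] τ)
  through-polish eq =
    let (_ , res , d) = through-rows
        (_ , _ , w , res′ , d′) = polish-run (starts-formula start) (length-replicate (length S))
    in _ , _ , w , res′ , λ d″ → d (ite-true (trans res eq) (act ⨾ d′ ⨾ d″))

  rejects-polish : lengths true n bs ∧ (k <ᵇ n) ≡ true → isCount (polish S) ≡ false → Rejects input
  rejects-polish eq eq′ = let (_ , _ , _ , res , d) = through-polish eq in _ , _ , d (ite-false (trans res eq′) act) , refl

accepted-sound : ∀ q → accepted q ≡ true → q ≡ inFormula
accepted-sound inFormula _ = refl

Encodes : List Symbol → Set
Encodes x = ∃₂ λ φ K → SplitFree φ × x ≡ encode φ K

classify-text : ∀ k bs {S} → 0 < length bs → Total bs → StartsFormula S → Rejects (text k bs S) ⊎ Encodes (text k bs S)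
classify-text k bs {y ∷ Y} ne tot start
  with lengths true (length bs) bs ∧ (k <ᵇ length bs) in rows | isCount (polish (y ∷ Y)) in pol
... | false | _     = inj₁ (Shape.rejects-rows k _ bs y Y refl ne tot start rows)
... | true  | false = inj₁ (Shape.rejects-polish k _ bs y Y refl ne tot start rows pol)
... | true  | true  =
  let (lens , k<) = ∧-elim rows
      (φ , sf , S≡) = isCount-sound (y ∷ Y) (starts-formula start) pol
      (K , k≡ , bs≡) = structure {k} {bs} (proj₂ (lengths-sound bs lens)) tot (<ᵇ⇒< k (length bs) (Equivalence.from T-≡ k<))
  in inj₂ (φ , K , sf , trans (cong (text k bs) S≡)
       (trans (cong₂ (λ k bs → text k bs (encodeFormula φ)) (sym k≡) (sym bs≡)) (sym (encode-text φ K))))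

classify : ∀ x → Rejects x ⊎ Encodes x
classify x with accepted (proj₁ (phases atStart x)) in acc
... | false = inj₁ (rejects-shape x acc)
... | true with start-sound x (accepted-sound _ acc)
...   | k , bs , S , refl , ne , tot , start = classify-text k bs ne tot start

valid-run : ∀ φ K → SplitFree φ → ∀ {S} → StartsFormula S → S ≡ encodeFormula φ →
            ∃ λ b → Outcome (text (toℕ (Kripke.initial K)) (Blocks.blocks K) S) b × (b ≡ true ⇔ Kripke.traces K ⊨ φ)
valid-run φ K sf {y ∷ Y} start S≡ =
  let (_ , v , w , res , d) = through-polish (∧-intro (lengths-complete blocks (blocks-rows K))
                                                      (Equivalence.to T-≡ (<⇒<ᵇ (toℕ<n initial))))
      (_ , μ) = meaning φ {[]} sf refl []
      (_ , clk) = clock size (length S) (length input) 0<size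
                  (subst (λ m → m + (m + length S) ≤ length input) (blocks-count K)
                                                                (length-text (toℕ initial) blocks S (blocks-total K)))
      (_ , d′ , eq) = core-run (transport (trans (++-identityʳ _) (sym S≡)) μ) refl clk refl
                        (length-replicate size) (≤-reflexive (sym w))
  in value φ 0 , (_ , _ , d (ite-true (trans res (trans (cong (isCount ∘ polish) S≡) (isCount-formula φ sf))) d′) , eq) ,
     mk⇔ (sound φ sf traces≐) (complete φ sf traces≐)
  where
  open Kripke K
  open Blocks K

  0<size : 0 < size
  0<size = ≤-trans (s≤s z≤n) (toℕ<n initial)

  open Shape (toℕ initial) size blocks y Y (blocks-count K) 0<size (blocks-total K) start
  open Worlds K
  open Model y Y y-formula

  transport : ∀ {S S′ gs vs} → S ≡ S′ → Meaning S gs vs → Meaning S′ gs vs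
  transport refl μ = μ

  traces≐ : traces ≐ From 0
  traces≐ = id , id

accepts : ∀ φ K → SplitFree φ → ∃ λ b → Outcome (encode φ K) b × (b ≡ true ⇔ Kripke.traces K ⊨ φ)
accepts φ K sf = subst (λ x → ∃ λ b → Outcome x b × (b ≡ true ⇔ Kripke.traces K ⊨ φ)) (sym (encode-text φ K))
                       (valid-run φ K sf (formula-starts φ sf) refl)

-- It turns a rejecting run into non-membership: a word of the language also has an accepting run,
-- and determinism makes the two runs agree.
outcome-unique : ∀ {x b c} → Outcome x b → Outcome x c → b ≡ c
outcome-unique (_ , _ , d , refl) (_ , _ , d′ , refl) = cong (Reg.res ∘ proj₁) (⇓-deterministic d d′)

theorem4p4 : PSPACE (MC SplitFree)
theorem4p4 = Compile.decides-in-pspace Symbol-finite Reg-finite main r₀ Reg.res λ x → run-on x (classify x)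
  where
  member : ∀ {x b} → Outcome x b → MC SplitFree x → b ≡ true
  member o (φ , K , sf , refl , sat) =
    let (_ , o′ , eq) = accepts φ K sf in trans (outcome-unique o o′) (Equivalence.from eq sat)

  run-on : ∀ x → Rejects x ⊎ Encodes x →
    ∃₂ λ r σ → main ⊢ (r₀ , loaded x) ⇓[ length x ] (r , σ) × (Reg.res r ≡ true ⇔ MC SplitFree x)
  run-on x (inj₁ o@(_ , _ , d , res)) =
    _ , _ , d , mk⇔ (λ eq → contradiction (trans (sym res) eq) λ ()) (trans res ∘ member o)
  run-on x (inj₂ (φ , K , sf , refl)) =
    let (b , o@(_ , _ , d , res) , eq) = accepts φ K sf
    in _ , _ , d , mk⇔ (λ p → φ , K , sf , refl , Equivalence.to eq (trans (sym res) p)) (trans res ∘ member o)
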